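{- Let $s\ge 1$ be a fixed integer, and let $k_1(n)\ge k_2(n)$, $M(n)$, $B(n)$ be positive non-decreasing integer-valued functions of a parameter $n$ with $M(n)/k_2(n)\to 0$ and $B(n)/M(n)\to 0$ as $n\to\infty$. Let $C_s(k_1,k_2)$ be the minimum number of simple I/Os needed in the external memory model (internal memory size $M$, block size $B$) to evaluate the $s$-star stencil once, out of place, on the two-dimensional grid $[k_1]\times[k_2]$. Then, as $n\to\infty$, $$C_s(k_1,k_2)\le\left(2+\frac{4s^2}{M}\left(1+\mathcal{O}\left(\frac{B}{M}+\frac{M}{k_1}\right)\right)\right)\frac{k_1k_2}{B}$$ and $$C_s(k_1,k_2)\ge\left(2+\frac{4s^2}{M}\left(1-\mathcal{O}\left(\frac{1}{M}+\frac{M}{k_2}\right)\right)\right)\frac{k_1k_2}{B}.$$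
   Context: Asymptotics: $k_i,M,B$ abbreviate $k_i(n),M(n),B(n)$; all asymptotic notation is for $n\to\infty$; the dimension and $s$ are constants and may enter the implied constants. External memory model: there is an external memory of infinite size, organized in blocks of $B$ elements, and an internal memory holding $M$ elements. Each value attached to a vertex is one element. Computations can only be performed on elements in internal memory. One I/O operation transfers one block of up to $B$ elements from external to internal memory (read) or from internal to external memory (write). The internal memory is managed explicitly by the algorithm (it chooses what is evicted; data may be deleted in internal memory at no cost; blocks of external memory may be written without being read first). I/Os are simple: elements are moved, not copied, between internal and external memory, so an input value that has been read and is needed again after being evicted must be written back to external memory. The algorithm may choose the arrangement (data layout) of the input and output elements in external memory. Task: $[k]=\{0,\dots,k-1\}$ and $V=[k_1]\times[k_2]$. There is an input layer $V_{in}=V\times\{in\}$ and an output layer $V_{out}=V\times\{out\}$. Initially each input vertex stores a value in external memory and the output layer is empty. The $s$-star stencil of the output vertex $v_{out}$ corresponding to $v\in V$ is $S_s(v_{out})=\{w_{in}: w\in V,\ \|w-v\|_1\le s\}$ (so stencils are truncated at the boundary of the grid). Evaluating $v_{out}$ computes its value from the values of all vertices of $S_s(v_{out})$. This is an atomic operation: all vertices of $S_s(v_{out})$ must be in internal memory simultaneously, and partial evaluations are not allowed. The task is to compute the values of all vertices of $V_{out}$ and write them to external memory. -}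

module Defs where

open import Data.Nat using (ℕ; _+_; _≤_; _≥_; ∣_-_∣; NonZero; _≟_)
open import Data.Integer using (+_)
open import Data.Rational as ℚ using (ℚ; 0ℚ)
open import Data.Fin using (Fin; toℕ)
open import Data.List using (List; []; _∷_; _++_; length)
open import Data.List.Membership.Propositional using (_∈_)
open import Data.List.Relation.Unary.Unique.Propositional using (Unique)
open import Data.List.Relation.Binary.Permutation.Propositional using (_↭_)
open import Data.Product using (_×_; _,_; ∃-syntax)
open import Relation.Binary.PropositionalEquality using (_≡_)
open import Relation.Nullary using (yes; no)

infixl 7 _÷_
_÷_ : (a b : ℕ) .{{_ : NonZero b}} → ℚ
a ÷ b = + a ℚ./ b

Eventually : (ℕ → Set) → Set
Eventually P = ∃[ n₀ ] ∀ n → n ≥ n₀ → P n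

TendsToZero : (ℕ → ℚ) → Set
TendsToZero f = ∀ (ε : ℚ) → 0ℚ ℚ.< ε → Eventually λ n → ℚ.∣ f n ∣ ℚ.< ε

infix 4 _∈𝒪_
_∈𝒪_ : (ℕ → ℚ) → (ℕ → ℚ) → Set
f ∈𝒪 g = ∃[ c ] Eventually λ n → ℚ.∣ f n ∣ ℚ.≤ c ℚ.* ℚ.∣ g n ∣

data Layer : Set where
  input output : Layer

module Grid (s k₁ k₂ : ℕ) where

  V : Set
  V = Fin k₁ × Fin k₂

  -- A vertex stands for the value attached to it.
  Element : Set
  Element = V × Layer

  dist₁ : V → V → ℕ
  dist₁ (x , y) (x′ , y′) = ∣ toℕ x - toℕ x′ ∣ + ∣ toℕ y - toℕ y′ ∣

  data Stencil (v : V) : Element → Set where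
    within : ∀ {w} → dist₁ w v ≤ s → Stencil v (w , input)

-- Memory contents are lists whose order is irrelevant: an element occupies one
-- cell for each of its occurrences.
module ExternalMemory (s k₁ k₂ M B : ℕ) where
  open Grid s k₁ k₂

  External : Set
  External = ℕ → List Element

  -- Replaces the previous contents of block b.
  setBlock : ℕ → List Element → External → External
  setBlock b xs ext b′ with b′ ≟ b
  ... | yes _ = xs
  ... | no  _ = ext b′

  record State : Set where
    constructor ⟨_,_⟩
    field
      internal : List Element
      external : External

  -- The index in the middle is the number of I/Os.  I/Os are simple: reading
  -- empties the block, writing removes the elements from internal memory.
  data Step : State → ℕ → State → Set where
    read : ∀ {int ext} b →
      length (ext b ++ int) ≤ M →
      Step ⟨ int , ext ⟩ 1 ⟨ ext b ++ int , setBlock b [] ext ⟩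
    write : ∀ {int ext} b xs {rest} →
      int ↭ xs ++ rest → length xs ≤ B →
      Step ⟨ int , ext ⟩ 1 ⟨ rest , setBlock b xs ext ⟩
    delete : ∀ {int ext} x {rest} →
      int ↭ x ∷ rest →
      Step ⟨ int , ext ⟩ 0 ⟨ rest , ext ⟩
    evaluate : ∀ {int ext} v →
      (∀ {x} → Stencil v x → x ∈ int) →
      length ((v , output) ∷ int) ≤ M →
      Step ⟨ int , ext ⟩ 0 ⟨ (v , output) ∷ int , ext ⟩

  data Run : State → ℕ → State → Set where
    []  : ∀ {σ} → Run σ 0 σ
    _∷_ : ∀ {σ τ υ i j} → Step σ i τ → Run τ j υ → Run σ (i + j) υ

  -- Every input value is stored exactly once; nothing else is stored.
  record InputLayout (ext : External) : Set where
    field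
      blockSize : ∀ b → length (ext b) ≤ B
      inputOnly : ∀ {b v l} → (v , l) ∈ ext b → l ≡ input
      complete  : ∀ v → ∃[ b ] (v , input) ∈ ext b
      onceBlock : ∀ b → Unique (ext b)
      oneBlock  : ∀ {x b b′} → x ∈ ext b → x ∈ ext b′ → b ≡ b′

  AllOutputsWritten : External → Set
  AllOutputsWritten ext = ∀ v → ∃[ b ] (v , output) ∈ ext b

  -- The input layout is chosen by the algorithm, and so is the output layout.
  ComputableWith : ℕ → Set
  ComputableWith i =
    ∃[ ext ] ∃[ σ ] InputLayout ext × Run ⟨ [] , ext ⟩ i σ × AllOutputsWritten (State.external σ)

  -- i = C_s(k₁,k₂).
  IsMinimumIO : ℕ → Set
  IsMinimumIO i = ComputableWith i × (∀ j → ComputableWith j → i ≤ j)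

open ExternalMemory public using (ComputableWith; IsMinimumIO)

{-# OPTIONS --safe #-}

-- Lower bound.  Every input read beyond the first time must have been written, and every output is written, so
-- the number of transferred elements is at least twice the number of inputs read.  Cut a run into phases
-- of 2r² newly evaluated vertices at distance at least s from the boundary, with r ≈ M/2s.  In the plane the
-- s-neighbourhood of 2r² points has at least 2r² + 4sr - O(s) points, of which at most M are in internal memory
-- when the phase starts, so a phase reads about M more inputs than it evaluates vertices: a surplus of 2s²/M per
-- vertex.
--
-- Upper bound.  Cut the grid into diagonal strips of width W ≈ M/s and sweep each strip perpendicularly to its
-- direction.  The sweep keeps 2s antidiagonals of the strip, about s W elements, in internal memory.  Only
-- the 2s diagonals shared by two consecutive strips are written back and read again, which concerns a fraction
-- 2s/W of the grid; these elements return in the order in which they left, so a queue of blocks holds them.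

module Submission where

open import Data.Nat
open import Data.Nat.Properties
open import Data.Nat.DivMod using (m≡m%n+[m/n]*n; m%n<n; [m+kn]%n≡m%n; m*n/n≡m; m/n*n≤m; m/n≤m; /-monoˡ-≤; m<n*o⇒m/o<n)
open import Data.Nat.Tactic.RingSolver using (solve-∀)
import Data.Integer as ℤ
import Data.Integer.Properties as ℤ
open import Data.Rational as ℚ using (ℚ; 0ℚ; 1ℚ; toℚᵘ)
import Data.Rational.Properties as ℚ
open import Data.Rational.Solver using (module +-*-Solver)
open import Data.Rational.Unnormalised as ℚᵘ using (ℚᵘ; mkℚᵘ; *≡*; *≤*)
import Data.Rational.Unnormalised.Properties as ℚᵘ
open import Data.Fin as Fin using (Fin; toℕ; fromℕ<)
open import Data.Fin.Properties using (toℕ<n; toℕ-fromℕ<; toℕ-injective)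
open import Data.Vec using (Vec; []; _∷_)
open import Data.List using (List; []; _∷_; [_]; _++_; _∷ʳ_; map; filter; foldr; concatMap; length; upTo; allFin; cartesianProduct; deduplicate)
open import Data.List.Properties
  using (length-++; length-map; length-tabulate; length-upTo; length-filter; filter-++; filter-none; filter-accept; filter-reject; filter-≐;
         map-++; ++-assoc; ++-identityʳ; concatMap-++)
open import Data.List.Extrema.Nat using (max; xs≤max)
open import Data.List.Membership.Propositional using (_∈_; _∉_)
open import Data.List.Membership.Propositional.Properties
open import Data.List.Relation.Unary.Any using (here; there)
open import Data.List.Relation.Unary.All as All using (All; []; _∷_)
open import Data.List.Relation.Unary.All.Properties using (¬Any⇒All¬) renaming (++⁻ˡ to All-++⁻ˡ)
open import Data.List.Relation.Unary.Unique.Propositional using (Unique; []; _∷_)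
import Data.List.Relation.Unary.Unique.Propositional.Properties as Unique
import Data.List.Relation.Unary.Unique.DecPropositional.Properties as DecUnique
open import Data.List.Relation.Binary.Subset.Propositional using (_⊆_)
open import Data.List.Relation.Binary.Permutation.Propositional using (_↭_; prep; ↭-refl; ↭-sym; ↭-trans; ↭-reflexive)
open import Data.List.Relation.Binary.Permutation.Propositional.Properties
  using (shift; ∈-resp-↭; ↭-length; map⁺; ++⁺ˡ; ++⁺ʳ; ++-comm; ++-commutativeMonoid)
open import Data.Product using (_×_; _,_; proj₁; proj₂; Σ-syntax; ∃-syntax)
open import Data.Product.Properties using (≡-dec)
open import Data.Sum using (_⊎_; inj₁; inj₂)
open import Data.Unit using (⊤; tt)
open import Data.Empty using (⊥-elim)
open import Function using (_∘_)
open import Relation.Binary.Definitions using (DecidableEquality; Monotonic₁)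
open import Relation.Binary.PropositionalEquality hiding ([_])
open import Relation.Nullary
open import Relation.Nullary.Decidable using (_×-dec_)
import Algebra.Solver.CommutativeMonoid as CommutativeMonoidSolver
open import Defs

-- Discrete isoperimetry in the plane

-- The constant 4s² has to come out exactly. In coordinates rotated by 45 degrees a ball of the
-- 1-norm is a pair of squares, one in each parity class, and a set grows under a square according
-- to its numbers of rows and columns. A phase of 2r² vertices reads about 4sr - M inputs more than
-- it evaluates vertices, and r = M/2s maximizes the ratio of this surplus to 2r². For the upper
-- bound, the elements held during a sweep must be counted sharply, also where strips meet the
-- border of the grid. A linear form κ, injective on each strip, serves as a clock: a vertex enters
-- at time κ, is evaluated at κ + R and leaves after κ + 2R. The window then has at most one vertex
-- for each of 2R + 1 clock values, whatever the shape of the strip. Leaving is entering delayed by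
-- 2R, which is why a queue suffices. With 2R close to sW, the choice W ≈ M/s fills the memory; a
-- shared element costs one write and one read, so the overhead 2 · 2s/W = 4s²/M is twice the
-- surplus 2s²/M of the lower bound.

unique-⊆⇒length≤ : ∀ {a} {A : Set a} {xs ys : List A} → Unique xs → xs ⊆ ys → length xs ≤ length ys
unique-⊆⇒length≤ {xs = []} _ _ = z≤n
unique-⊆⇒length≤ {xs = x ∷ xs} u@(_ ∷ u′) xs⊆ys with ∈-∃++ (xs⊆ys (here refl))
... | as , bs , refl = ≤-trans (s≤s (unique-⊆⇒length≤ u′ sub)) (≤-reflexive eq)
  where
  sub : xs ⊆ as ++ bs
  sub {z} z∈xs with ∈-++⁻ as (xs⊆ys (there z∈xs))
  ... | inj₁ z∈as = ∈-++⁺ˡ z∈as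
  ... | inj₂ (here refl) = ⊥-elim (Unique.Unique[x∷xs]⇒x∉xs u z∈xs)
  ... | inj₂ (there z∈bs) = ∈-++⁺ʳ as z∈bs
  eq : suc (length (as ++ bs)) ≡ length (as ++ x ∷ bs)
  eq rewrite length-++ as {bs} | length-++ as {x ∷ bs} = sym (+-suc _ _)

-- Linear-arithmetic certificate: a ≤ b, with both sides moved so that no subtraction occurs.
≤-cert : ∀ {a b a′ b′} k → a ≤ b → a′ + b + k ≡ b′ + a → a′ ≤ b′
≤-cert {a} {b} {a′} {b′} k a≤b eq = +-cancelʳ-≤ b a′ b′ (begin
  a′ + b     ≤⟨ m≤m+n _ k ⟩
  a′ + b + k ≡⟨ eq ⟩
  b′ + a     ≤⟨ +-monoʳ-≤ b′ a≤b ⟩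
  b′ + b     ∎)
  where open ≤-Reasoning

-- Here `t` stands for a root of `p * q`, so that integers suffice. If `p + q` were below `2 * t`,
-- squaring would contradict 4pq ≤ (p + q)².
am-gm : ∀ p q t → t * t ≤ p * q → 2 * t ≤ p + q
am-gm p q t tt≤pq with 2 * t ≤? p + q
... | yes ok = ok
... | no ¬ok = ⊥-elim (<-irrefl refl (begin-strict
  4 * (p * q)             ≤⟨ 4pq≤ p q ⟩
  (p + q) * (p + q)       <⟨ *-mono-< (≰⇒> ¬ok) (≰⇒> ¬ok) ⟩
  2 * t * (2 * t)         ≡⟨ (λ (t : ℕ) → eq t) t ⟩
  4 * (t * t)             ≤⟨ *-monoʳ-≤ 4 tt≤pq ⟩
  4 * (p * q)             ∎))
  where
  open ≤-Reasoning
  eq : ∀ t → 2 * t * (2 * t) ≡ 4 * (t * t)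
  eq = solve-∀
  half : ∀ p d → 4 * (p * (p + d)) ≤ (p + (p + d)) * (p + (p + d))
  half p d = ≤-trans (m≤m+n _ (d * d)) (≤-reflexive (eq′ p d))
    where
    eq′ : ∀ p d → 4 * (p * (p + d)) + d * d ≡ (p + (p + d)) * (p + (p + d))
    eq′ = solve-∀
  4pq≤ : ∀ p q → 4 * (p * q) ≤ (p + q) * (p + q)
  4pq≤ p q with ≤-total p q
  ... | inj₁ p≤q with m≤n⇒∃[o]m+o≡n p≤q
  ...   | d , refl = half p d
  4pq≤ p q | inj₂ q≤p with m≤n⇒∃[o]m+o≡n q≤p
  ...   | d , refl = subst₂ _≤_ (cong (4 *_) (*-comm q (q + d)))
                       (cong₂ _*_ (+-comm q (q + d)) (+-comm q (q + d))) (half q d)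

Point : Set
Point = ℕ × ℕ

_≟ₚ_ : DecidableEquality Point
_≟ₚ_ = ≡-dec _≟_ _≟_

open import Data.List.Membership.DecPropositional _≟ₚ_ using (_∈?_)

lines : (Point → ℕ) → List Point → ℕ
lines ρ A = length (deduplicate _≟_ (map ρ A))

lines-mono : ∀ ρ {A A′} → A ⊆ A′ → lines ρ A ≤ lines ρ A′
lines-mono ρ {A} {A′} A⊆A′ = unique-⊆⇒length≤ (DecUnique.deduplicate-! _≟_ (map ρ A)) λ x∈ →
  let a , a∈A , x≡ = ∈-map⁻ ρ (∈-deduplicate⁻ _≟_ (map ρ A) x∈)
  in ∈-deduplicate⁺ _≟_ (subst (_∈ map ρ A′) (sym x≡) (∈-map⁺ ρ (A⊆A′ a∈A)))

-- Each line in direction τ, a fibre of ρ, that meets a finite set A gains the successor of its last point in A.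
module Translate (τ : Point → Point) (τ-injective : ∀ {p q} → τ p ≡ τ q → p ≡ q)
                 (height : Point → ℕ) (height-τ : ∀ p → height p < height (τ p))
                 (ρ : Point → ℕ) (ρ-τ : ∀ p → ρ (τ p) ≡ ρ p) where

  last? : ∀ A p → Dec (τ p ∉ A)
  last? A p = ¬? (τ p ∈? A)

  step : List Point → List Point
  step A = A ++ map τ (filter (last? A) A)

  step-unique : ∀ {A} → Unique A → Unique (step A)
  step-unique {A} u = Unique.++⁺ u (Unique.map⁺ τ-injective (Unique.filter⁺ (last? A) u)) λ (x∈A , x∈new) →
    let p , p∈ , x≡ = ∈-map⁻ τ x∈new
    in proj₂ (∈-filter⁻ (last? A) {xs = A} p∈) (subst (_∈ A) x≡ x∈A)

  -- Following `τ` inside `A` must stop, because each translation raises `height` and the heights in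
  -- `A` are bounded; the fuel of `search` is the room left below that bound.
  line-end : ∀ A {p} → p ∈ A → ∃[ q ] q ∈ A × τ q ∉ A × ρ q ≡ ρ p
  line-end A p∈A = search (suc (max 0 (map height A))) p∈A (m≤n+m _ _)
    where
    search : ∀ n {p} → p ∈ A → max 0 (map height A) < height p + n → ∃[ q ] q ∈ A × τ q ∉ A × ρ q ≡ ρ p
    search zero {p} p∈A lt =
      ⊥-elim (<-irrefl refl (<-≤-trans lt (≤-trans (≤-reflexive (+-identityʳ _))
        (All.lookup (xs≤max 0 (map height A)) (∈-map⁺ height p∈A)))))
    search (suc n) {p} p∈A lt with τ p ∈? A
    ... | no  τp∉A = p , p∈A , τp∉A , refl
    ... | yes τp∈A with search n τp∈A (<-≤-trans lt (≤-trans (≤-reflexive (+-suc _ n)) (+-monoˡ-≤ n (height-τ p))))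
    ...   | q , q∈A , τq∉A , ρq = q , q∈A , τq∉A , trans ρq (ρ-τ p)

  step-length : ∀ A → length A + lines ρ A ≤ length (step A)
  step-length A = begin
    length A + lines ρ A                                ≤⟨ +-monoʳ-≤ (length A) lines≤ ⟩
    length A + length (map ρ (filter (last? A) A))      ≡⟨ cong (length A +_) (trans (length-map ρ (filter (last? A) A)) (sym (length-map τ (filter (last? A) A)))) ⟩
    length A + length (map τ (filter (last? A) A))      ≡⟨ length-++ A ⟨
    length (step A)                                     ∎
    where
    open ≤-Reasoning
    lines≤ : lines ρ A ≤ length (map ρ (filter (last? A) A))
    lines≤ = unique-⊆⇒length≤ (DecUnique.deduplicate-! _≟_ (map ρ A)) λ x∈ →
      let p , p∈A , x≡ = ∈-map⁻ ρ (∈-deduplicate⁻ _≟_ (map ρ A) x∈)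
          q , q∈A , τq∉A , ρq≡ = line-end A p∈A
      in subst (_∈ _) (trans ρq≡ (sym x≡)) (∈-map⁺ ρ (∈-filter⁺ (last? A) q∈A τq∉A))

  -- As a set, `step A` is the union of `A` and its translate, so `steps n A` is the Minkowski sum
  -- of `A` with n + 1 consecutive multiples of `τ`, starting at 0.
  steps : ℕ → List Point → List Point
  steps zero    A = A
  steps (suc n) A = steps n (step A)

  τ^ : ℕ → Point → Point
  τ^ zero    p = p
  τ^ (suc n) p = τ^ n (τ p)

  steps-unique : ∀ n {A} → Unique A → Unique (steps n A)
  steps-unique zero    u = u
  steps-unique (suc n) u = steps-unique n (step-unique u)

  steps-⊇ : ∀ n A → A ⊆ steps n A
  steps-⊇ zero    A x∈ = x∈
  steps-⊇ (suc n) A x∈ = steps-⊇ n (step A) (∈-++⁺ˡ x∈)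

  steps-length : ∀ n A → length A + n * lines ρ A ≤ length (steps n A)
  steps-length zero    A = ≤-reflexive (+-identityʳ _)
  steps-length (suc n) A = begin
    length A + (lines ρ A + n * lines ρ A)   ≡⟨ +-assoc (length A) _ _ ⟨
    length A + lines ρ A + n * lines ρ A     ≤⟨ +-mono-≤ (step-length A) (*-monoʳ-≤ n (lines-mono ρ {A} {step A} ∈-++⁺ˡ)) ⟩
    length (step A) + n * lines ρ (step A)   ≤⟨ steps-length n (step A) ⟩
    length (steps n (step A))                ∎
    where open ≤-Reasoning

  ∈-steps⁻ : ∀ n A {q} → q ∈ steps n A → ∃[ p ] ∃[ i ] p ∈ A × i ≤ n × q ≡ τ^ i p
  ∈-steps⁻ zero    A q∈ = _ , 0 , q∈ , z≤n , refl
  ∈-steps⁻ (suc n) A q∈ with ∈-steps⁻ n (step A) q∈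
  ... | p , i , p∈ , i≤n , q≡ with ∈-++⁻ A p∈
  ...   | inj₁ p∈A = p , i , p∈A , m≤n⇒m≤1+n i≤n , q≡
  ...   | inj₂ p∈new with ∈-map⁻ τ p∈new
  ...     | p′ , p′∈ , refl = p′ , suc i , proj₁ (∈-filter⁻ (last? A) {xs = A} p′∈) , s≤s i≤n , q≡

-- Translations by two stay within a parity class of the rotated grid, in which each part of a ball
-- is a square lattice of spacing two.
rightward upward : Point → Point
rightward (u , v) = 2 + u , v
upward    (u , v) = u , 2 + v

rightward-injective : ∀ {p q} → rightward p ≡ rightward q → p ≡ q
rightward-injective refl = refl

upward-injective : ∀ {p q} → upward p ≡ upward q → p ≡ q
upward-injective refl = refl

module Horizontal = Translate rightward rightward-injective proj₁ (λ (u , _) → m<n+m u z<s) proj₂ (λ _ → refl)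
module Vertical   = Translate upward upward-injective proj₂ (λ (_ , v) → m<n+m v z<s) proj₁ (λ _ → refl)

displace : ℕ → ℕ → Point → Point
displace i j (u , v) = u + i * 2 , v + j * 2

expand : ℕ → List Point → List Point
expand n A = Vertical.steps n (Horizontal.steps n A)

rows columns : List Point → ℕ
rows    = lines proj₂
columns = lines proj₁

expand-unique : ∀ n {A} → Unique A → Unique (expand n A)
expand-unique n u = Vertical.steps-unique n (Horizontal.steps-unique n u)

-- The horizontal steps come first and cannot reduce the number of columns, so each later vertical
-- step still gains at least `columns A` points.
expand-length : ∀ n A → length A + n * (rows A + columns A) ≤ length (expand n A)
expand-length n A = begin
  length A + n * (rows A + columns A)        ≡⟨ cong (length A +_) (*-distribˡ-+ n (rows A) _) ⟩
  length A + (n * rows A + n * columns A)    ≡⟨ +-assoc (length A) _ _ ⟨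
  length A + n * rows A + n * columns A      ≤⟨ +-mono-≤ (Horizontal.steps-length n A) (*-monoʳ-≤ n (lines-mono proj₁ {A} (Horizontal.steps-⊇ n A))) ⟩
  length A₁ + n * columns A₁                 ≤⟨ Vertical.steps-length n A₁ ⟩
  length (expand n A)                        ∎
  where
  open ≤-Reasoning
  A₁ = Horizontal.steps n A

∈-expand⁻ : ∀ n A {q} → q ∈ expand n A → ∃[ p ] ∃[ i ] ∃[ j ] p ∈ A × i ≤ n × j ≤ n × q ≡ displace i j p
∈-expand⁻ n A q∈ with Vertical.∈-steps⁻ n _ q∈
... | p₁ , j , p₁∈ , j≤n , q≡ with Horizontal.∈-steps⁻ n A p₁∈
...   | p , i , p∈ , i≤n , refl = p , i , j , p∈ , i≤n , j≤n , trans q≡ (trans (vert j _) (cong (λ (u , v) → u , v + j * 2) (horiz i p)))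
  where
  horiz : ∀ i p → Horizontal.τ^ i p ≡ (proj₁ p + i * 2 , proj₂ p)
  horiz zero    (u , v) = cong (_, v) (sym (+-identityʳ u))
  horiz (suc i) (u , v) = trans (horiz i _) (cong (_, v) (eq u (i * 2)))
    where
    eq : ∀ u k → 2 + u + k ≡ u + (2 + k)
    eq = solve-∀
  vert : ∀ j p → Vertical.τ^ j p ≡ (proj₁ p , proj₂ p + j * 2)
  vert zero    (u , v) = cong (u ,_) (sym (+-identityʳ v))
  vert (suc j) (u , v) = trans (vert j _) (cong (u ,_) (eq v (j * 2)))
    where
    eq : ∀ u k → 2 + u + k ≡ u + (2 + k)
    eq = solve-∀

length-cartesianProduct : ∀ {a b} {A : Set a} {B : Set b} (xs : List A) (ys : List B) →
  length (cartesianProduct xs ys) ≡ length xs * length ys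
length-cartesianProduct []       ys = refl
length-cartesianProduct (x ∷ xs) ys = trans (length-++ (map (x ,_) ys))
  (cong₂ _+_ (length-map (x ,_) ys) (length-cartesianProduct xs ys))

-- `A` lies in the product of its two projections: the Loomis-Whitney inequality in the plane.
length≤rows*columns : ∀ {A} → Unique A → length A ≤ rows A * columns A
length≤rows*columns {A} u = begin
  length A                                     ≤⟨ unique-⊆⇒length≤ u sub ⟩
  length (cartesianProduct us vs)              ≡⟨ length-cartesianProduct us vs ⟩
  columns A * rows A                           ≡⟨ *-comm (columns A) _ ⟩
  rows A * columns A                           ∎
  where
  open ≤-Reasoning
  us = deduplicate _≟_ (map proj₁ A)
  vs = deduplicate _≟_ (map proj₂ A)
  sub : A ⊆ cartesianProduct us vs
  sub p∈ = ∈-cartesianProduct⁺ (∈-deduplicate⁺ _≟_ (∈-map⁺ proj₁ p∈)) (∈-deduplicate⁺ _≟_ (∈-map⁺ proj₂ p∈))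

-- Each of the `n` rounds gains rows plus columns, whose product is at least the size of `A`; by
-- `am-gm` a square shape is the worst case.
expand-length-≥ : ∀ n t {A} → Unique A → t * t ≤ length A → length A + n * (2 * t) ≤ length (expand n A)
expand-length-≥ n t {A} u tt≤ = ≤-trans
  (+-monoʳ-≤ (length A) (*-monoʳ-≤ n (am-gm (rows A) (columns A) t (≤-trans tt≤ (length≤rows*columns u)))))
  (expand-length n A)

length-filter-split : ∀ {a p} {A : Set a} {P : A → Set p} (P? : ∀ x → Dec (P x)) (xs : List A) →
  length (filter P? xs) + length (filter (λ x → ¬? (P? x)) xs) ≡ length xs
length-filter-split P? [] = refl
length-filter-split P? (x ∷ xs) with P? x
... | yes _ = cong suc (length-filter-split P? xs)
... | no  _ = trans (+-suc _ _) (cong suc (length-filter-split P? xs))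

-- The parity of the first coordinate alone separates the two squares of a ball: `displace` keeps it
-- and `diagonal` flips it.
class : Point → ℕ
class (u , v) = u % 2

class-displace : ∀ i j p → class (displace i j p) ≡ class p
class-displace i j (u , v) = [m+kn]%n≡m%n u i 2

class-suc : ∀ u → suc u % 2 ≢ u % 2
class-suc (suc (suc u)) eq = class-suc u (trans (sym ([m+2]%2 (suc u))) (trans eq ([m+2]%2 u)))
  where
  [m+2]%2 : ∀ m → (2 + m) % 2 ≡ m % 2
  [m+2]%2 m = trans (cong (_% 2) (+-comm 2 m)) ([m+kn]%n≡m%n m 1 2)
class-suc zero ()
class-suc (suc zero) ()

diagonal : Point → Point
diagonal (u , v) = suc u , suc v

-- A point of the ball of radius s around p, translated by (s , s): in rotated coordinates the ball is the
-- union of an (s+1)×(s+1) square of one parity class and an s×s square of the other.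
data Near (s : ℕ) (p : Point) : Point → Set where
  same  : ∀ {i j} → i ≤ s → j ≤ s → Near s p (displace i j p)
  other : ∀ {i j} → i < s → j < s → Near s p (displace i j (diagonal p))

Surrounds : ℕ → List Point → List Point → Set
Surrounds s A X = Unique X × (∀ {q} → q ∈ X → ∃[ p ] p ∈ A × Near s p q)

module _ (s : ℕ) .{{_ : NonZero s}} (t : ℕ) where

  -- With this form the two thresholds r - 2 = `suc t` and r + 1 = `4 + t` need no subtraction.
  private r = 3 + t

  Uniform : ℕ → List Point → Set
  Uniform c A = ∀ {p} → p ∈ A → class p ≡ c

  -- Each class is enlarged only by the square that keeps its class, hence the results are disjoint.
  -- The larger class has at least r² points and gains 2sr; the smaller has at least (r - 2)² points
  -- and gains 2s(r - 2). The sum of the gains is 4sr - 4s.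
  balanced : ∀ {A₀ A₁ c₀ c₁} → Unique A₀ → Unique A₁ → Uniform c₀ A₀ → Uniform c₁ A₁ → c₀ ≢ c₁ →
    length A₀ + length A₁ ≡ 2 * (r * r) → length A₁ ≤ length A₀ → suc t * suc t ≤ length A₁ →
    Surrounds s (A₀ ++ A₁) (expand s A₀ ++ expand s A₁) ×
    2 * (r * r) + 4 * s * r ≤ length (expand s A₀ ++ expand s A₁) + 4 * s
  balanced {A₀} {A₁} {c₀} {c₁} u₀ u₁ p₀ p₁ c₀≢c₁ total le big =
    (Unique.++⁺ (expand-unique s u₀) (expand-unique s u₁) disjoint , near) , bound
    where
    class-expand : ∀ {A c} → Uniform c A → Uniform c (expand s A)
    class-expand {A} un q∈ with ∈-expand⁻ s A q∈
    ... | p , i , j , p∈ , _ , _ , refl = trans (class-displace i j p) (un p∈)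
    disjoint : ∀ {q} → ¬ (q ∈ expand s A₀ × q ∈ expand s A₁)
    disjoint (q∈₀ , q∈₁) = c₀≢c₁ (trans (sym (class-expand p₀ q∈₀)) (class-expand p₁ q∈₁))
    near : ∀ {q} → q ∈ expand s A₀ ++ expand s A₁ → ∃[ p ] p ∈ A₀ ++ A₁ × Near s p q
    near q∈ with ∈-++⁻ (expand s A₀) q∈
    ... | inj₁ q∈₀ with ∈-expand⁻ s A₀ q∈₀
    ...   | p , i , j , p∈ , i≤ , j≤ , refl = p , ∈-++⁺ˡ p∈ , same i≤ j≤
    near q∈ | inj₂ q∈₁ with ∈-expand⁻ s A₁ q∈₁
    ...   | p , i , j , p∈ , i≤ , j≤ , refl = p , ∈-++⁺ʳ A₀ p∈ , same i≤ j≤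
    rr≤ : r * r ≤ length A₀
    rr≤ = *-cancelˡ-≤ 2 (≤-cert 0 le (eq (length A₀) (length A₁) total))
      where
      eq : ∀ a b → a + b ≡ 2 * (r * r) → 2 * (r * r) + a + 0 ≡ 2 * a + b
      eq a b tot = trans (cong (λ z → z + a + 0) (sym tot)) (eq′ a b)
        where
        eq′ : ∀ a b → a + b + a + 0 ≡ 2 * a + b
        eq′ = solve-∀
    bound : 2 * (r * r) + 4 * s * r ≤ length (expand s A₀ ++ expand s A₁) + 4 * s
    bound = begin
      2 * (r * r) + 4 * s * r
        ≡⟨ cong (_+ 4 * s * r) (sym total) ⟩
      length A₀ + length A₁ + 4 * s * r
        ≡⟨ (λ a b → eq a b s t) (length A₀) (length A₁) ⟩
      length A₀ + s * (2 * r) + (length A₁ + s * (2 * suc t)) + 4 * s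
        ≤⟨ +-monoˡ-≤ (4 * s) (+-mono-≤ (expand-length-≥ s r u₀ rr≤) (expand-length-≥ s (suc t) u₁ big)) ⟩
      length (expand s A₀) + length (expand s A₁) + 4 * s
        ≡⟨ cong (_+ 4 * s) (length-++ (expand s A₀)) ⟨
      length (expand s A₀ ++ expand s A₁) + 4 * s ∎
      where
      open ≤-Reasoning
      eq : ∀ a b s t → a + b + 4 * s * (3 + t) ≡ a + s * (2 * (3 + t)) + (b + s * (2 * suc t)) + 4 * s
      eq = solve-∀

  -- A single large class is used twice: the second square of the ball moves it into the other
  -- class. This gives at least 2(r + 1)² + (2s - 1) · 2(r + 1) points, which exceeds 2r² + 4sr.
  unbalanced : ∀ {A c} → Unique A → Uniform c A → (4 + t) * (4 + t) ≤ length A →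
    ∃[ X ] Surrounds s A X × 2 * (r * r) + 4 * s * r ≤ length X + 4 * s
  unbalanced {A} {c} u un big = expand s A ++ Y , (Unique.++⁺ (expand-unique s u) Y-unique disjoint , near) , bound s
    where
    Y = map diagonal (expand (pred s) A)
    Y-unique : Unique Y
    Y-unique = Unique.map⁺ (λ where refl → refl) (expand-unique (pred s) u)
    disjoint : ∀ {q} → ¬ (q ∈ expand s A × q ∈ Y)
    disjoint (q∈X , q∈Y) with ∈-expand⁻ s A q∈X | ∈-map⁻ diagonal q∈Y
    ... | p , i , j , p∈ , _ , _ , refl | p′ , p′∈ , eq with ∈-expand⁻ (pred s) A p′∈
    ...   | p″ , i′ , j′ , p″∈ , _ , _ , refl = class-suc (proj₁ p″ + i′ * 2)
      (trans (cong class (sym eq)) (trans (class-displace i j p) (trans (un p∈) (sym (trans (class-displace i′ j′ p″) (un p″∈))))))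
    near : ∀ {q} → q ∈ expand s A ++ Y → ∃[ p ] p ∈ A × Near s p q
    near q∈ with ∈-++⁻ (expand s A) q∈
    ... | inj₁ q∈X with ∈-expand⁻ s A q∈X
    ...   | p , i , j , p∈ , i≤ , j≤ , refl = p , p∈ , same i≤ j≤
    near q∈ | inj₂ q∈Y with ∈-map⁻ diagonal q∈Y
    ...   | p′ , p′∈ , refl with ∈-expand⁻ (pred s) A p′∈
    ...     | p , i , j , p∈ , i≤ , j≤ , refl = p , p∈ , other (m≤pred[n]⇒suc[m]≤n i≤) (m≤pred[n]⇒suc[m]≤n j≤)
    bound : ∀ s .{{_ : NonZero s}} → 2 * (r * r) + 4 * s * r ≤ length (expand s A ++ map diagonal (expand (pred s) A)) + 4 * s
    bound (suc s) = begin
      2 * (r * r) + 4 * suc s * r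
        ≤⟨ m≤m+n _ (10 + 4 * s + 2 * t + 4 * suc s) ⟩
      2 * (r * r) + 4 * suc s * r + (10 + 4 * s + 2 * t + 4 * suc s)
        ≡⟨ (λ s t → eq s t) s t ⟩
      (4 + t) * (4 + t) + suc s * (2 * (4 + t)) + ((4 + t) * (4 + t) + s * (2 * (4 + t))) + 4 * suc s
        ≤⟨ +-monoˡ-≤ (4 * suc s) (+-mono-≤
             (≤-trans (+-monoˡ-≤ _ big) (expand-length-≥ (suc s) (4 + t) u big))
             (≤-trans (+-monoˡ-≤ _ big) (expand-length-≥ s (4 + t) u big))) ⟩
      length (expand (suc s) A) + length (expand s A) + 4 * suc s
        ≡⟨ cong (λ z → length (expand (suc s) A) + z + 4 * suc s) (length-map diagonal (expand s A)) ⟨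
      length (expand (suc s) A) + length (map diagonal (expand s A)) + 4 * suc s
        ≡⟨ cong (_+ 4 * suc s) (length-++ (expand (suc s) A)) ⟨
      length (expand (suc s) A ++ map diagonal (expand s A)) + 4 * suc s ∎
      where
      open ≤-Reasoning
      eq : ∀ s t → 2 * ((3 + t) * (3 + t)) + 4 * suc s * (3 + t) + (10 + 4 * s + 2 * t + 4 * suc s) ≡
        (4 + t) * (4 + t) + suc s * (2 * (4 + t)) + ((4 + t) * (4 + t) + s * (2 * (4 + t))) + 4 * suc s
      eq = solve-∀

  -- When the smaller class has fewer than (r - 2)² points, its own growth is too small for
  -- `balanced`. It can then be dropped: the other class has at least (r + 1)² points, because 2r² -
  -- (r - 2)² ≥ (r + 1)² for r ≥ 3.
  ordered : ∀ {A₀ A₁ c₀ c₁} → Unique A₀ → Unique A₁ → Uniform c₀ A₀ → Uniform c₁ A₁ → c₀ ≢ c₁ →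
    length A₀ + length A₁ ≡ 2 * (r * r) → length A₁ ≤ length A₀ →
    ∃[ X ] Surrounds s (A₀ ++ A₁) X × 2 * (r * r) + 4 * s * r ≤ length X + 4 * s
  ordered {A₀} {A₁} u₀ u₁ p₀ p₁ c₀≢c₁ total le with suc t * suc t ≤? length A₁
  ... | yes big = _ , balanced u₀ u₁ p₀ p₁ c₀≢c₁ total le big
  ... | no ¬big with unbalanced u₀ p₀ (≤-cert (2 + 2 * t) (≰⇒> ¬big) (eq (length A₀) (length A₁) total))
    where
    eq : ∀ a b → a + b ≡ 2 * (r * r) → (4 + t) * (4 + t) + suc t * suc t + (2 + 2 * t) ≡ a + suc b
    eq a b tot = trans (eq′ t) (trans (cong suc (sym tot)) (sym (+-suc a b)))
      where
      eq′ : ∀ t → (4 + t) * (4 + t) + suc t * suc t + (2 + 2 * t) ≡ suc (2 * ((3 + t) * (3 + t)))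
      eq′ = solve-∀
  ...   | X , (uX , near) , bound = X , (uX , λ q∈ → let p , p∈ , n = near q∈ in p , ∈-++⁺ˡ p∈ , n) , bound

  isoperimetry′ : ∀ A → Unique A → length A ≡ 2 * (r * r) →
    ∃[ X ] Surrounds s A X × 2 * (r * r) + 4 * s * r ≤ length X + 4 * s
  isoperimetry′ A u len = case-split
    where
    even? : ∀ p → Dec (class p ≡ 0)
    even? p = class p ≟ 0
    A₀ = filter even? A
    A₁ = filter (λ p → ¬? (even? p)) A
    u₀ : Unique A₀
    u₀ = Unique.filter⁺ even? u
    u₁ : Unique A₁
    u₁ = Unique.filter⁺ (λ p → ¬? (even? p)) u
    p₀ : Uniform 0 A₀
    p₀ p∈ = proj₂ (∈-filter⁻ even? {xs = A} p∈)
    p₁ : Uniform 1 A₁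
    p₁ {p} p∈ = odd (m%n<n (proj₁ p) 2) (proj₂ (∈-filter⁻ (λ p → ¬? (even? p)) {xs = A} p∈))
      where
      odd : ∀ {k} → k < 2 → k ≢ 0 → k ≡ 1
      odd {zero} _ k≢0 = ⊥-elim (k≢0 refl)
      odd {suc zero} _ _ = refl
      odd {suc (suc k)} (s≤s (s≤s ())) _
    total : length A₀ + length A₁ ≡ 2 * (r * r)
    total = trans (length-filter-split even? A) len
    A₀⊆A : A₀ ⊆ A
    A₀⊆A p∈ = proj₁ (∈-filter⁻ even? p∈)
    A₁⊆A : A₁ ⊆ A
    A₁⊆A p∈ = proj₁ (∈-filter⁻ (λ p → ¬? (even? p)) p∈)
    within : ∀ {B C} → B ⊆ A → C ⊆ A → B ++ C ⊆ A
    within {B} B⊆ C⊆ p∈ with ∈-++⁻ B p∈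
    ... | inj₁ p∈B = B⊆ p∈B
    ... | inj₂ p∈C = C⊆ p∈C
    widen : ∀ {A′} → A′ ⊆ A → (∃[ X ] Surrounds s A′ X × 2 * (r * r) + 4 * s * r ≤ length X + 4 * s) →
      ∃[ X ] Surrounds s A X × 2 * (r * r) + 4 * s * r ≤ length X + 4 * s
    widen A′⊆A (X , (uX , near) , bound) = X , (uX , λ q∈ → let p , p∈ , n = near q∈ in p , A′⊆A p∈ , n) , bound
    case-split : ∃[ X ] Surrounds s A X × 2 * (r * r) + 4 * s * r ≤ length X + 4 * s
    case-split with ≤-total (length A₁) (length A₀)
    ... | inj₁ le = widen (within A₀⊆A A₁⊆A) (ordered u₀ u₁ p₀ p₁ (λ ()) total le)
    ... | inj₂ ge = widen (within A₁⊆A A₀⊆A) (ordered u₁ u₀ p₁ p₀ (λ ()) (trans (+-comm (length A₁) _) total) ge)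

-- The result is a set of nearby points, each with a witness `Near`, rather than the whole
-- neighbourhood: only the points that are counted have to be recognized as stencil vertices later.
isoperimetry : ∀ s .{{_ : NonZero s}} r → 3 ≤ r → ∀ A → Unique A → length A ≡ 2 * (r * r) →
  ∃[ X ] Surrounds s A X × 2 * (r * r) + 4 * s * r ≤ length X + 4 * s
isoperimetry s r 3≤r with m≤n⇒∃[o]m+o≡n 3≤r
... | t , refl = isoperimetry′ s t

-- Lower bound: transfers and phases of a run

unique-++⁻ˡ : ∀ {a} {A : Set a} {xs ys : List A} → Unique (xs ++ ys) → Unique xs
unique-++⁻ˡ {xs = []}     _         = []
unique-++⁻ˡ {xs = x ∷ xs} (x∉ ∷ u) = All-++⁻ˡ xs x∉ ∷ unique-++⁻ˡ u

_≟ₗ_ : DecidableEquality Layer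
input  ≟ₗ input  = yes refl
input  ≟ₗ output = no λ ()
output ≟ₗ input  = no λ ()
output ≟ₗ output = yes refl

vertices : ∀ k₁ k₂ → List (Fin k₁ × Fin k₂)
vertices k₁ k₂ = cartesianProduct (allFin k₁) (allFin k₂)

vertices-unique : ∀ k₁ k₂ → Unique (vertices k₁ k₂)
vertices-unique k₁ k₂ = Unique.cartesianProduct⁺ (Unique.allFin⁺ k₁) (Unique.allFin⁺ k₂)

∈-vertices : ∀ {k₁ k₂} (v : Fin k₁ × Fin k₂) → v ∈ vertices k₁ k₂
∈-vertices (x , y) = ∈-cartesianProduct⁺ (∈-allFin x) (∈-allFin y)

length-vertices : ∀ k₁ k₂ → length (vertices k₁ k₂) ≡ k₁ * k₂
length-vertices k₁ k₂ = trans (length-cartesianProduct (allFin k₁) (allFin k₂))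
  (cong₂ _*_ (length-tabulate {n = k₁} (λ i → i)) (length-tabulate {n = k₂} (λ i → i)))

module _ (s k₁ k₂ M B : ℕ) where
  open Grid s k₁ k₂
  open ExternalMemory s k₁ k₂ M B hiding (ComputableWith)

  on : (l : Layer) (x : Element) → Dec (proj₂ x ≡ l)
  on l x = proj₂ x ≟ₗ l

  count : Layer → List Element → ℕ
  count l xs = length (filter (on l) xs)

  count-++ : ∀ l xs ys → count l (xs ++ ys) ≡ count l xs + count l ys
  count-++ l xs ys = trans (cong length (filter-++ (on l) xs ys)) (length-++ (filter (on l) xs))

  count-length : ∀ xs → count input xs + count output xs ≡ length xs
  count-length [] = refl
  count-length ((_ , input)  ∷ xs) = cong suc (count-length xs)
  count-length ((_ , output) ∷ xs) = trans (+-suc _ _) (cong suc (count-length xs))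

  setBlock-here : ∀ b xs ext → setBlock b xs ext b ≡ xs
  setBlock-here b xs ext with b ≟ b
  ... | yes _ = refl
  ... | no b≢b = ⊥-elim (b≢b refl)

  setBlock-other : ∀ {b b′} xs ext → b′ ≢ b → setBlock b xs ext b′ ≡ ext b′
  setBlock-other {b} {b′} xs ext b′≢b with b′ ≟ b
  ... | yes b′≡b = ⊥-elim (b′≢b b′≡b)
  ... | no _ = refl

  -- External memory is an infinite family of blocks, so only the first `K` are counted; `K` is
  -- later taken above every address that the run touches.
  contents : ℕ → External → List Element
  contents zero    ext = []
  contents (suc K) ext = ext K ++ contents K ext

  stored : Layer → ℕ → External → ℕ
  stored l K ext = count l (contents K ext)

  contents-setBlock-≥ : ∀ K {b} xs ext → K ≤ b → contents K (setBlock b xs ext) ≡ contents K ext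
  contents-setBlock-≥ zero    xs ext _   = refl
  contents-setBlock-≥ (suc K) xs ext K<b =
    cong₂ _++_ (setBlock-other xs ext (<⇒≢ K<b)) (contents-setBlock-≥ K xs ext (<⇒≤ K<b))

  stored-setBlock : ∀ l K {b} xs ext → b < K → stored l K (setBlock b xs ext) + count l (ext b) ≡ stored l K ext + count l xs
  stored-setBlock l (suc K) {b} xs ext b<1+K with b ≟ K
  ... | yes refl = begin
    count l (setBlock b xs ext b ++ contents b (setBlock b xs ext)) + count l (ext b)
      ≡⟨ cong (λ ys → count l ys + count l (ext b)) (cong₂ _++_ (setBlock-here b xs ext) (contents-setBlock-≥ b xs ext ≤-refl)) ⟩
    count l (xs ++ contents b ext) + count l (ext b)
      ≡⟨ cong (_+ count l (ext b)) (count-++ l xs _) ⟩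
    count l xs + stored l b ext + count l (ext b)
      ≡⟨ (λ a b c → eq a b c) (count l xs) (stored l b ext) (count l (ext b)) ⟩
    count l (ext b) + stored l b ext + count l xs
      ≡⟨ cong (_+ count l xs) (count-++ l (ext b) _) ⟨
    count l (ext b ++ contents b ext) + count l xs ∎
    where
    open ≡-Reasoning
    eq : ∀ a b c → a + b + c ≡ c + b + a
    eq = solve-∀
  ... | no b≢K = begin
    count l (setBlock b xs ext K ++ contents K (setBlock b xs ext)) + count l (ext b)
      ≡⟨ cong (_+ count l (ext b)) (trans (cong (λ ys → count l (ys ++ contents K (setBlock b xs ext))) (setBlock-other xs ext (b≢K ∘ sym))) (count-++ l (ext K) (contents K (setBlock b xs ext)))) ⟩
    count l (ext K) + stored l K (setBlock b xs ext) + count l (ext b)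
      ≡⟨ +-assoc (count l (ext K)) _ _ ⟩
    count l (ext K) + (stored l K (setBlock b xs ext) + count l (ext b))
      ≡⟨ cong (count l (ext K) +_) (stored-setBlock l K xs ext (≤∧≢⇒< (s≤s⁻¹ b<1+K) b≢K)) ⟩
    count l (ext K) + (stored l K ext + count l xs)
      ≡⟨ +-assoc (count l (ext K)) _ _ ⟨
    count l (ext K) + stored l K ext + count l xs
      ≡⟨ cong (_+ count l xs) (count-++ l (ext K) _) ⟨
    count l (ext K ++ contents K ext) + count l xs ∎
    where open ≡-Reasoning

  ∈-contents⁺ : ∀ {K b x} ext → b < K → x ∈ ext b → x ∈ contents K ext
  ∈-contents⁺ {suc K} {b} ext b<1+K x∈ with b ≟ K
  ... | yes refl = ∈-++⁺ˡ x∈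
  ... | no b≢K  = ∈-++⁺ʳ (ext K) (∈-contents⁺ ext (≤∧≢⇒< (s≤s⁻¹ b<1+K) b≢K) x∈)

  ∈-contents⁻ : ∀ {K x} ext → x ∈ contents K ext → ∃[ b ] b < K × x ∈ ext b
  ∈-contents⁻ {suc K} ext x∈ with ∈-++⁻ (ext K) x∈
  ... | inj₁ x∈K = K , ≤-refl , x∈K
  ... | inj₂ x∈< with ∈-contents⁻ ext x∈<
  ...   | b , b<K , x∈b = b , m≤n⇒m≤1+n b<K , x∈b

  addressBound inputsRead : ∀ {σ i τ} → Run σ i τ → ℕ
  addressBound [] = 0
  addressBound (read b _ ∷ ρ) = suc b ⊔ addressBound ρ
  addressBound (write b _ _ _ ∷ ρ) = suc b ⊔ addressBound ρ
  addressBound (delete _ _ ∷ ρ) = addressBound ρ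
  addressBound (evaluate _ _ _ ∷ ρ) = addressBound ρ

  inputsReadStep : ∀ {σ i τ} → Step σ i τ → ℕ
  inputsReadStep (read {ext = ext} b _) = count input (ext b)
  inputsReadStep (write _ _ _ _)  = 0
  inputsReadStep (delete _ _)     = 0
  inputsReadStep (evaluate _ _ _) = 0

  inputsRead [] = 0
  inputsRead (st ∷ ρ) = inputsReadStep st + inputsRead ρ

  written : Layer → ∀ {σ i τ} → Run σ i τ → ℕ
  written l [] = 0
  written l (write _ xs _ _ ∷ ρ) = count l xs + written l ρ
  written l (read _ _ ∷ ρ)       = written l ρ
  written l (delete _ _ ∷ ρ)     = written l ρ
  written l (evaluate _ _ _ ∷ ρ) = written l ρ

  setBlock-bounded : ∀ {b xs ext} → length xs ≤ B → (∀ b → length (ext b) ≤ B) → ∀ b′ → length (setBlock b xs ext b′) ≤ B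
  setBlock-bounded {b} xs≤B bounded b′ with b′ ≟ b
  ... | yes _ = xs≤B
  ... | no  _ = bounded b′

  -- An I/O moves at most one block. Outputs that are read back are left out of the count, which
  -- only lowers the left side.
  transfers≤ : ∀ {σ i τ} (ρ : Run σ i τ) → (∀ b → length (State.external σ b) ≤ B) →
    inputsRead ρ + (written input ρ + written output ρ) ≤ i * B
  transfers≤ [] bounded = z≤n
  transfers≤ (read {ext = ext} b _ ∷ ρ) bounded = ≤-trans (≤-reflexive (+-assoc (count input (ext b)) _ _))
    (+-mono-≤ (≤-trans (length-filter (on input) (ext b)) (bounded b)) (transfers≤ ρ (setBlock-bounded z≤n bounded)))
  transfers≤ (write b xs _ xs≤B ∷ ρ) bounded = ≤-trans
    (≤-reflexive (trans (eq (inputsRead ρ) (count input xs) (written input ρ) (count output xs) (written output ρ)) (cong (_+ (inputsRead ρ + (written input ρ + written output ρ))) (count-length xs))))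
    (+-mono-≤ xs≤B (transfers≤ ρ (setBlock-bounded xs≤B bounded)))
    where
    eq : ∀ r ci wi co wo → r + (ci + wi + (co + wo)) ≡ ci + co + (r + (wi + wo))
    eq = solve-∀
  transfers≤ (delete _ _ ∷ ρ) bounded = transfers≤ ρ bounded
  transfers≤ (evaluate _ _ _ ∷ ρ) bounded = transfers≤ ρ bounded

  -- Conservation of stored inputs: reading empties a block, so an input that is read was stored
  -- initially or has been written since. Overwriting a block may destroy inputs, whence an
  -- inequality.
  inputsRead≤ : ∀ {σ i τ} (ρ : Run σ i τ) K → addressBound ρ ≤ K →
    inputsRead ρ + stored input K (State.external τ) ≤ stored input K (State.external σ) + written input ρ
  inputsRead≤ [] K _ = ≤-reflexive (sym (+-identityʳ _))
  inputsRead≤ {τ = τ} (read {ext = ext} b _ ∷ ρ) K le = ≤-cert 0 (inputsRead≤ ρ K (m⊔n≤o⇒n≤o (suc b) (addressBound ρ) le))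
    (eq (count input (ext b)) (inputsRead ρ) (stored input K (State.external τ)) (stored input K (setBlock b [] ext)) (written input ρ) (stored input K ext) (stored-setBlock input K [] ext (m⊔n≤o⇒m≤o (suc b) (addressBound ρ) le)))
    where
    eq : ∀ c r t x w y → x + c ≡ y + 0 → c + r + t + (x + w) + 0 ≡ y + w + (r + t)
    eq c r t x w y eq = trans (eq₁ c r t x w) (trans (cong (λ z → z + (r + t + w)) eq) (eq₂ y r t w))
      where
      eq₁ : ∀ c r t x w → c + r + t + (x + w) + 0 ≡ x + c + (r + t + w)
      eq₁ = solve-∀
      eq₂ : ∀ y r t w → y + 0 + (r + t + w) ≡ y + w + (r + t)
      eq₂ = solve-∀
  inputsRead≤ {τ = τ} (write {ext = ext} b xs _ _ ∷ ρ) K le = ≤-cert (count input (ext b)) (inputsRead≤ ρ K (m⊔n≤o⇒n≤o (suc b) (addressBound ρ) le))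
    (eq (count input (ext b)) (inputsRead ρ) (stored input K (State.external τ)) (stored input K (setBlock b xs ext)) (written input ρ) (stored input K ext) (count input xs) (stored-setBlock input K xs ext (m⊔n≤o⇒m≤o (suc b) (addressBound ρ) le)))
    where
    eq : ∀ c r t x w y z → x + c ≡ y + z → r + t + (x + w) + c ≡ y + (z + w) + (r + t)
    eq c r t x w y z eq = trans (eq₁ c r t x w) (trans (cong (λ z → z + (r + t + w)) eq) (eq₂ y r t w z))
      where
      eq₁ : ∀ c r t x w → r + t + (x + w) + c ≡ x + c + (r + t + w)
      eq₁ = solve-∀
      eq₂ : ∀ y r t w z → y + z + (r + t + w) ≡ y + (z + w) + (r + t)
      eq₂ = solve-∀
  inputsRead≤ (delete _ _ ∷ ρ) K le = inputsRead≤ ρ K le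
  inputsRead≤ (evaluate _ _ _ ∷ ρ) K le = inputsRead≤ ρ K le

  stored-output≤ : ∀ {σ i τ} (ρ : Run σ i τ) K → addressBound ρ ≤ K →
    stored output K (State.external τ) ≤ stored output K (State.external σ) + written output ρ
  stored-output≤ [] K _ = ≤-reflexive (sym (+-identityʳ _))
  stored-output≤ (read {ext = ext} b _ ∷ ρ) K le = ≤-trans (stored-output≤ ρ K (m⊔n≤o⇒n≤o (suc b) (addressBound ρ) le))
    (+-monoˡ-≤ (written output ρ) (≤-trans (m≤m+n _ (count output (ext b)))
      (≤-reflexive (trans (stored-setBlock output K [] ext (m⊔n≤o⇒m≤o (suc b) (addressBound ρ) le)) (+-identityʳ _)))))
  stored-output≤ (write {ext = ext} b xs _ _ ∷ ρ) K le = ≤-trans (stored-output≤ ρ K (m⊔n≤o⇒n≤o (suc b) (addressBound ρ) le))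
    (≤-trans (+-monoˡ-≤ (written output ρ) (≤-trans (m≤m+n _ (count output (ext b)))
      (≤-reflexive (stored-setBlock output K xs ext (m⊔n≤o⇒m≤o (suc b) (addressBound ρ) le))))) (≤-reflexive (+-assoc (stored output K ext) (count output xs) _)))
  stored-output≤ (delete _ _ ∷ ρ) K le = stored-output≤ ρ K le
  stored-output≤ (evaluate _ _ _ ∷ ρ) K le = stored-output≤ ρ K le

  stored-input-initial : ∀ {ext} → InputLayout ext → ∀ K → stored input K ext ≤ k₁ * k₂
  stored-input-initial {ext} layout K = begin
    stored input K ext                                ≤⟨ length-filter (on input) (contents K ext) ⟩
    length (contents K ext)                           ≤⟨ unique-⊆⇒length≤ (contents-unique K) contents⊆ ⟩
    length (map (_, input) (vertices k₁ k₂))          ≡⟨ length-map (_, input) (vertices k₁ k₂) ⟩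
    length (vertices k₁ k₂)                           ≡⟨ length-vertices k₁ k₂ ⟩
    k₁ * k₂                                           ∎
    where
    open ≤-Reasoning
    open InputLayout layout
    contents-unique : ∀ K → Unique (contents K ext)
    contents-unique zero = []
    contents-unique (suc K) = Unique.++⁺ (onceBlock K) (contents-unique K) λ (x∈K , x∈<) →
      let b , b<K , x∈b = ∈-contents⁻ ext x∈< in <⇒≢ b<K (oneBlock x∈b x∈K)
    contents⊆ : contents K ext ⊆ map (_, input) (vertices k₁ k₂)
    contents⊆ {v , l} x∈ with ∈-contents⁻ {K} ext x∈
    ... | b , _ , x∈b rewrite inputOnly x∈b = ∈-map⁺ (_, input) (∈-vertices v)

  stored-output-initial : ∀ {ext} → InputLayout ext → ∀ K → stored output K ext ≡ 0
  stored-output-initial {ext} layout K = cong length (filter-none (on output) (All.tabulate λ {(v , l)} x∈ l≡output →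
    let b , _ , x∈b = ∈-contents⁻ {K} ext x∈ in case (trans (sym (InputLayout.inputOnly layout x∈b)) l≡output)))
    where
    case : input ≢ output
    case ()

  -- The initial stock of at most `k₁ * k₂` inputs is matched by the `k₁ * k₂` outputs that have to
  -- be written. Hence no more inputs are read than elements are written, and reads and writes
  -- together are bounded by the transfers.
  2*inputsRead≤ : ∀ {ext i σ} → InputLayout ext → (ρ : Run ⟨ [] , ext ⟩ i σ) → AllOutputsWritten (State.external σ) →
    2 * inputsRead ρ ≤ i * B
  2*inputsRead≤ {ext} {i} {σ} layout ρ outputs = begin
    2 * inputsRead ρ
      ≡⟨ cong (inputsRead ρ +_) (+-identityʳ _) ⟩
    inputsRead ρ + inputsRead ρ
      ≤⟨ +-monoʳ-≤ (inputsRead ρ) (≤-trans (m≤m+n _ (stored input K (State.external σ))) (≤-trans (inputsRead≤ ρ K (m≤m⊔n _ _)) (+-monoˡ-≤ (written input ρ) (stored-input-initial layout K)))) ⟩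
    inputsRead ρ + (k₁ * k₂ + written input ρ)
      ≤⟨ +-monoʳ-≤ (inputsRead ρ) (+-monoˡ-≤ (written input ρ) all-written) ⟩
    inputsRead ρ + (written output ρ + written input ρ)
      ≡⟨ cong (inputsRead ρ +_) (+-comm (written output ρ) _) ⟩
    inputsRead ρ + (written input ρ + written output ρ)
      ≤⟨ transfers≤ ρ (InputLayout.blockSize layout) ⟩
    i * B ∎
    where
    open ≤-Reasoning
    addresses : List ℕ
    addresses = map (suc ∘ proj₁ ∘ outputs) (vertices k₁ k₂)
    -- The second part covers the addresses at which `outputs` finds the results, so that all of
    -- them count as stored.
    K = addressBound ρ ⊔ max 0 addresses
    final⊆ : map (_, output) (vertices k₁ k₂) ⊆ filter (on output) (contents K (State.external σ))
    final⊆ x∈ with ∈-map⁻ (_, output) x∈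
    ... | v , v∈ , refl = ∈-filter⁺ (on output) (∈-contents⁺ {K} (State.external σ)
        (≤-trans (All.lookup (xs≤max 0 addresses) (∈-map⁺ (suc ∘ proj₁ ∘ outputs) v∈)) (m≤n⊔m _ _)) (proj₂ (outputs v))) refl
    all-written : k₁ * k₂ ≤ written output ρ
    all-written = begin
      k₁ * k₂                                    ≡⟨ length-vertices k₁ k₂ ⟨
      length (vertices k₁ k₂)                    ≡⟨ length-map (_, output) (vertices k₁ k₂) ⟨
      length (map (_, output) (vertices k₁ k₂))  ≤⟨ unique-⊆⇒length≤ (Unique.map⁺ (λ where refl → refl) (vertices-unique k₁ k₂)) final⊆ ⟩
      stored output K (State.external σ)         ≤⟨ stored-output≤ ρ K (m≤m⊔n _ _) ⟩
      stored output K ext + written output ρ     ≡⟨ cong (_+ written output ρ) (stored-output-initial layout K) ⟩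
      written output ρ                           ∎

  ∈-setBlock : ∀ b xs ext b′ {x} → x ∈ setBlock b xs ext b′ → x ∈ xs ⊎ x ∈ ext b′
  ∈-setBlock b xs ext b′ x∈ with b′ ≟ b
  ... | yes _ = inj₁ x∈
  ... | no  _ = inj₂ x∈

  _≟ᵥ_ : DecidableEquality V
  _≟ᵥ_ = ≡-dec Fin._≟_ Fin._≟_

  open import Data.List.Membership.DecPropositional _≟ᵥ_ using () renaming (_∈?_ to _∈ᵥ?_)

  -- Phases: the run is cut whenever m new interior vertices have been evaluated.
  module Phases (Interior : V → Set) (interior? : ∀ v → Dec (Interior v)) (m g : ℕ)
    (demand : ∀ A → Unique A → (∀ {v} → v ∈ A → Interior v) → length A ≡ m →
              ∀ src → (∀ {v x} → v ∈ A → Stencil v x → x ∈ src) → g ≤ length src) where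

    -- A transfer never creates an element that was neither inside nor outside, so the set of known
    -- outputs grows only by evaluation.
    data Known (int : List Element) (ext : External) (x : Element) : Set where
      inside  : x ∈ int → Known int ext x
      outside : ∀ b → x ∈ ext b → Known int ext x

    -- `source` collects the internal contents at the start of the current phase and every input
    -- read since. It never forgets, so it contains all stencils evaluated in the phase, although
    -- these need not have been in memory together. `r₀` counts the inputs read in finished phases
    -- and `r₁` those read in the current one.
    record Progress (σ : State) (r : ℕ) : Set where
      open State σ
      field
        phases   : ℕ
        finished : List V
        current  : List V
        source   : List Element
        r₀ r₁    : ℕ
        reads            : r₀ + r₁ ≡ r
        finished-length  : length finished ≡ phases * m
        current-length   : length current < m
        unique           : Unique (current ++ finished)
        interior         : ∀ {v} → v ∈ current → Interior v
        source-length    : length source ≤ M + r₁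
        source-stencils  : ∀ {v x} → v ∈ current → Stencil v x → x ∈ source
        source-internal  : ∀ {v} → (v , input) ∈ internal → (v , input) ∈ source
        internal-length  : length internal ≤ M
        outputs          : ∀ {v} → Interior v → Known internal external (v , output) → v ∈ current ++ finished
        finished-reads   : phases * g ≤ r₀ + phases * M

    open Progress

    initial : ∀ {ext} → 0 < m → InputLayout ext → Progress ⟨ [] , ext ⟩ 0
    initial 0<m layout = record
      { phases = 0 ; finished = [] ; current = [] ; source = [] ; r₀ = 0 ; r₁ = 0
      ; reads = refl ; finished-length = refl ; current-length = 0<m ; unique = [] ; interior = λ ()
      ; source-length = z≤n ; source-stencils = λ () ; source-internal = λ () ; internal-length = z≤n
      ; outputs = λ where _ (inside ())
                          _ (outside b x∈) → ⊥-elim (input≢output (sym (InputLayout.inputOnly layout x∈)))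
      ; finished-reads = z≤n }
      where
      input≢output : input ≢ output
      input≢output ()

    shrink : ∀ {int ext int′ ext′ r} → (∀ {x} → x ∈ int′ → x ∈ int) → length int′ ≤ length int →
      (∀ {x} → Known int′ ext′ x → Known int ext x) → Progress ⟨ int , ext ⟩ r → Progress ⟨ int′ , ext′ ⟩ r
    shrink int′⊆ len known P = record
      { phases = phases P ; finished = finished P ; current = current P ; source = source P ; r₀ = r₀ P ; r₁ = r₁ P
      ; reads = reads P ; finished-length = finished-length P ; current-length = current-length P ; unique = unique P
      ; interior = interior P ; source-length = source-length P ; source-stencils = source-stencils P
      ; source-internal = source-internal P ∘ int′⊆ ; internal-length = ≤-trans len (internal-length P)
      ; outputs = λ i k → outputs P i (known k)
      ; finished-reads = finished-reads P }

    admit : ∀ {int ext r v} → length ((v , output) ∷ int) ≤ M → (P : Progress ⟨ int , ext ⟩ r) →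
      (Interior v → v ∈ current P ++ finished P) → Progress ⟨ (v , output) ∷ int , ext ⟩ r
    admit len P seen = record
      { phases = phases P ; finished = finished P ; current = current P ; source = source P ; r₀ = r₀ P ; r₁ = r₁ P
      ; reads = reads P ; finished-length = finished-length P ; current-length = current-length P ; unique = unique P
      ; interior = interior P ; source-length = source-length P ; source-stencils = source-stencils P
      ; finished-reads = finished-reads P
      ; source-internal = λ { (there x∈) → source-internal P x∈ } ; internal-length = len
      ; outputs = λ { i (inside (here refl)) → seen i ; i (inside (there x∈)) → outputs P i (inside x∈)
                    ; i (outside b x∈) → outputs P i (outside b x∈) } }

    known-setBlock : ∀ {int ext b xs rest x} → int ↭ xs ++ rest → Known rest (setBlock b xs ext) x → Known int ext x
    known-setBlock {xs = xs} p (inside x∈) = inside (∈-resp-↭ (↭-sym p) (∈-++⁺ʳ xs x∈))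
    known-setBlock {ext = ext} {b = b} {xs = xs} p (outside b′ x∈) with ∈-setBlock b xs ext b′ x∈
    ... | inj₁ x∈xs  = inside (∈-resp-↭ (↭-sym p) (∈-++⁺ˡ x∈xs))
    ... | inj₂ x∈ext = outside b′ x∈ext

    removal-length : ∀ {int xs rest : List Element} → int ↭ xs ++ rest → length rest ≤ length int
    removal-length {xs = xs} p = ≤-trans (m≤n+m _ (length xs)) (≤-reflexive (sym (trans (↭-length p) (length-++ xs))))

    advance : ∀ {σ i τ r} (st : Step σ i τ) → Progress σ r → Progress τ (r + inputsReadStep st)
    advance {r = r} (read {int} {ext} b len) P = record
      { phases = phases P ; finished = finished P ; current = current P
      ; source = inputs ++ source P ; r₀ = r₀ P ; r₁ = r₁ P + length inputs
      ; reads = trans (sym (+-assoc (r₀ P) (r₁ P) (length inputs))) (cong (_+ length inputs) (reads P))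
      ; finished-length = finished-length P ; current-length = current-length P ; unique = unique P
      ; interior = interior P
      ; source-length = ≤-trans (≤-reflexive (trans (length-++ inputs) (+-comm (length inputs) _)))
          (≤-trans (+-monoˡ-≤ (length inputs) (source-length P)) (≤-reflexive (+-assoc M _ _)))
      ; source-stencils = λ v∈ st → ∈-++⁺ʳ inputs (source-stencils P v∈ st)
      ; source-internal = source-internal′
      ; internal-length = len
      ; outputs = λ i k → outputs P i (known k)
      ; finished-reads = finished-reads P }
      where
      inputs : List Element
      inputs = filter (on input) (ext b)
      source-internal′ : ∀ {v} → (v , input) ∈ ext b ++ int → (v , input) ∈ inputs ++ source P
      source-internal′ x∈ with ∈-++⁻ (ext b) x∈
      ... | inj₁ x∈b   = ∈-++⁺ˡ (∈-filter⁺ (on input) x∈b refl)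
      ... | inj₂ x∈int = ∈-++⁺ʳ inputs (source-internal P x∈int)
      known : ∀ {x} → Known (ext b ++ int) (setBlock b [] ext) x → Known int ext x
      known (inside x∈) with ∈-++⁻ (ext b) x∈
      ... | inj₁ x∈b   = outside b x∈b
      ... | inj₂ x∈int = inside x∈int
      known (outside b′ x∈) with ∈-setBlock b [] ext b′ x∈
      ... | inj₂ x∈b′ = outside b′ x∈b′
    advance {r = r} (write b xs p _) P rewrite +-identityʳ r =
      shrink (λ x∈ → ∈-resp-↭ (↭-sym p) (∈-++⁺ʳ xs x∈)) (removal-length {xs = xs} p) (known-setBlock p) P
    advance {r = r} (delete x p) P rewrite +-identityʳ r =
      shrink (λ x∈ → ∈-resp-↭ (↭-sym p) (there x∈)) (removal-length {xs = [ x ]} p)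
        (λ { (inside x∈) → inside (∈-resp-↭ (↭-sym p) (there x∈)) ; (outside b x∈) → outside b x∈ }) P
    -- Only the first evaluation of an interior vertex counts; repeated evaluations and boundary
    -- vertices leave the phase as it is.
    advance {r = r} (evaluate {int} {ext} v stencil len) P rewrite +-identityʳ r with interior? v | v ∈ᵥ? (current P ++ finished P)
    ... | no ¬i | _      = admit len P (λ i → ⊥-elim (¬i i))
    ... | yes _ | yes v∈ = admit len P (λ _ → v∈)
    ... | yes i | no v∉ = evaluated (suc (length (current P)) ≟ m)
      where
      int′ : List Element
      int′ = (v , output) ∷ int
      unique′ : Unique (v ∷ current P ++ finished P)
      unique′ = ¬Any⇒All¬ _ v∉ ∷ unique P
      interior′ : ∀ {w} → w ∈ v ∷ current P → Interior w
      interior′ (here refl) = i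
      interior′ (there w∈) = interior P w∈
      stencil⊆source : ∀ {w x} → w ∈ v ∷ current P → Stencil w x → x ∈ source P
      stencil⊆source (here refl) st@(within _) = source-internal P (stencil st)
      stencil⊆source (there w∈) st = source-stencils P w∈ st
      outputs′ : ∀ {w} → Interior w → Known int′ ext (w , output) → w ∈ v ∷ current P ++ finished P
      outputs′ _ (inside (here refl)) = here refl
      outputs′ i (inside (there x∈)) = there (outputs P i (inside x∈))
      outputs′ i (outside b x∈) = there (outputs P i (outside b x∈))
      evaluated : Dec (suc (length (current P)) ≡ m) → Progress ⟨ int′ , ext ⟩ r
      evaluated (no not-full) = record
        { phases = phases P ; finished = finished P ; current = v ∷ current P ; source = source P ; r₀ = r₀ P ; r₁ = r₁ P
        ; reads = reads P ; finished-length = finished-length P ; current-length = ≤∧≢⇒< (current-length P) not-full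
        ; unique = unique′ ; interior = interior′ ; source-length = source-length P ; source-stencils = stencil⊆source
        ; finished-reads = finished-reads P
        ; source-internal = λ { (there x∈) → source-internal P x∈ } ; internal-length = len
        ; outputs = outputs′ }
      -- The new phase starts with the contents of internal memory right after this evaluation;
      -- these are the at most `M` elements that it obtains without reading.
      evaluated (yes full) = record
        { phases = suc (phases P) ; finished = v ∷ current P ++ finished P ; current = [] ; source = int′
        ; r₀ = r₀ P + r₁ P ; r₁ = 0
        ; reads = trans (+-identityʳ _) (reads P)
        ; finished-length = trans (cong suc (length-++ (current P))) (cong₂ _+_ full (finished-length P))
        ; current-length = ≤-trans (s≤s z≤n) (current-length P) ; unique = unique′ ; interior = λ ()
        ; source-length = ≤-trans len (≤-reflexive (sym (+-identityʳ M))) ; source-stencils = λ ()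
        ; source-internal = λ x∈ → x∈ ; internal-length = len ; outputs = outputs′
        ; finished-reads = begin
            g + phases P * g
              ≤⟨ +-mono-≤ (≤-trans enough (source-length P)) (finished-reads P) ⟩
            M + r₁ P + (r₀ P + phases P * M)
              ≡⟨ eq M (r₁ P) (r₀ P) (phases P * M) ⟩
            r₀ P + r₁ P + (M + phases P * M) ∎ }
        where
        open ≤-Reasoning
        enough : g ≤ length (source P)
        enough = demand (v ∷ current P) (unique-++⁻ˡ unique′) interior′ full (source P) stencil⊆source
        eq : ∀ a b c d → a + b + (c + d) ≡ c + b + (a + d)
        eq = solve-∀

    progress : ∀ {σ i τ r} (ρ : Run σ i τ) → Progress σ r → Progress τ (r + inputsRead ρ)
    progress {r = r} [] P rewrite +-identityʳ r = P
    progress {r = r} (st ∷ ρ) P rewrite sym (+-assoc r (inputsReadStep st) (inputsRead ρ)) = progress ρ (advance st P)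

    self∈stencil : ∀ v → Stencil v (v , input)
    self∈stencil (x , y) = within (≤-trans (≤-reflexive (cong₂ _+_ (∣n-n∣≡0 (toℕ x)) (∣n-n∣≡0 (toℕ y)))) z≤n)

    phase-bound : ∀ {ext i σ} → 0 < m → InputLayout ext → (ρ : Run ⟨ [] , ext ⟩ i σ) → AllOutputsWritten (State.external σ) →
      ∃[ j ] ∃[ a ] a < m × j * m ≤ k₁ * k₂ ×
        length (filter interior? (vertices k₁ k₂)) ≤ a + j * m ×
        j * g + a ≤ inputsRead ρ + (M + j * M)
    phase-bound {σ = σ} 0<m layout ρ written-out = phases P , length (current P) , current-length P , finished≤ , covered , bound
      where
      open ≤-Reasoning
      P : Progress σ (inputsRead ρ)
      P = progress ρ (initial 0<m layout)
      finished≤ : phases P * m ≤ k₁ * k₂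
      finished≤ = begin
        phases P * m                       ≡⟨ finished-length P ⟨
        length (finished P)                ≤⟨ m≤n+m _ (length (current P)) ⟩
        length (current P) + length (finished P) ≡⟨ length-++ (current P) ⟨
        length (current P ++ finished P)   ≤⟨ unique-⊆⇒length≤ (unique P) (λ _ → ∈-vertices _) ⟩
        length (vertices k₁ k₂)            ≡⟨ length-vertices k₁ k₂ ⟩
        k₁ * k₂                            ∎
      covered : length (filter interior? (vertices k₁ k₂)) ≤ length (current P) + phases P * m
      covered = begin
        length (filter interior? (vertices k₁ k₂)) ≤⟨ unique-⊆⇒length≤ (Unique.filter⁺ interior? (vertices-unique k₁ k₂)) (λ v∈ →
            outputs P (proj₂ (∈-filter⁻ interior? {xs = vertices k₁ k₂} v∈)) (let b , x∈ = written-out _ in outside b x∈)) ⟩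
        length (current P ++ finished P)          ≡⟨ length-++ (current P) ⟩
        length (current P) + length (finished P)  ≡⟨ cong (length (current P) +_) (finished-length P) ⟩
        length (current P) + phases P * m         ∎
      -- The unfinished last phase is too short for `demand`, but each of its vertices still needs
      -- at least the input at the centre of its stencil.
      current≤ : length (current P) ≤ M + r₁ P
      current≤ = ≤-trans (≤-reflexive (sym (length-map (_, input) (current P)))) (≤-trans
        (unique-⊆⇒length≤ (Unique.map⁺ (λ where refl → refl) (unique-++⁻ˡ (unique P))) sub) (source-length P))
        where
        sub : map (_, input) (current P) ⊆ source P
        sub x∈ with ∈-map⁻ (_, input) x∈
        ... | v , v∈ , refl = source-stencils P v∈ (self∈stencil v)
      bound : phases P * g + length (current P) ≤ inputsRead ρ + (M + phases P * M)
      bound = begin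
        phases P * g + length (current P)        ≤⟨ +-mono-≤ (finished-reads P) current≤ ⟩
        r₀ P + phases P * M + (M + r₁ P)         ≡⟨ eq (r₀ P) (phases P * M) M (r₁ P) ⟩
        r₀ P + r₁ P + (M + phases P * M)         ≡⟨ cong (_+ (M + phases P * M)) (reads P) ⟩
        inputsRead ρ + (M + phases P * M)        ∎
        where
        eq : ∀ a b c d → a + b + (c + d) ≡ a + d + (c + b)
        eq = solve-∀

-- Lower bound: stencils of interior vertices

-- There is one linear inequality for each pair of signs; the orders of `a`, `b` and of `c`, `d`
-- select the matching one.
∣-∣+∣-∣≤ : ∀ {a b c d n} → a + c ≤ n + (b + d) → a + d ≤ n + (b + c) → b + c ≤ n + (a + d) → b + d ≤ n + (a + c) →
  ∣ a - b ∣ + ∣ c - d ∣ ≤ n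
∣-∣+∣-∣≤ {a} {b} {c} {d} {n} h₁ h₂ h₃ h₄ with ≤-total a b | ≤-total c d
... | inj₁ a≤b | inj₁ c≤d with m≤n⇒∃[o]m+o≡n a≤b | m≤n⇒∃[o]m+o≡n c≤d
...   | e , refl | f , refl rewrite ∣m-m+n∣≡n a e | ∣m-m+n∣≡n c f = ≤-cert 0 h₄ (eq a c e f n)
  where
  eq : ∀ a c e f n → e + f + (n + (a + c)) + 0 ≡ n + (a + e + (c + f))
  eq = solve-∀
∣-∣+∣-∣≤ {a} {b} {c} {d} {n} h₁ h₂ h₃ h₄ | inj₁ a≤b | inj₂ d≤c with m≤n⇒∃[o]m+o≡n a≤b | m≤n⇒∃[o]m+o≡n d≤c
...   | e , refl | f , refl rewrite ∣m-m+n∣≡n a e | ∣-∣-comm (d + f) d | ∣m-m+n∣≡n d f = ≤-cert 0 h₃ (eq a d e f n)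
  where
  eq : ∀ a c e f n → e + f + (n + (a + c)) + 0 ≡ n + (a + e + (c + f))
  eq = solve-∀
∣-∣+∣-∣≤ {a} {b} {c} {d} {n} h₁ h₂ h₃ h₄ | inj₂ b≤a | inj₁ c≤d with m≤n⇒∃[o]m+o≡n b≤a | m≤n⇒∃[o]m+o≡n c≤d
...   | e , refl | f , refl rewrite ∣-∣-comm (b + e) b | ∣m-m+n∣≡n b e | ∣m-m+n∣≡n c f = ≤-cert 0 h₂ (eq b c e f n)
  where
  eq : ∀ a c e f n → e + f + (n + (a + c)) + 0 ≡ n + (a + e + (c + f))
  eq = solve-∀
∣-∣+∣-∣≤ {a} {b} {c} {d} {n} h₁ h₂ h₃ h₄ | inj₂ b≤a | inj₂ d≤c with m≤n⇒∃[o]m+o≡n b≤a | m≤n⇒∃[o]m+o≡n d≤c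
...   | e , refl | f , refl rewrite ∣-∣-comm (b + e) b | ∣m-m+n∣≡n b e | ∣-∣-comm (d + f) d | ∣m-m+n∣≡n d f = ≤-cert 0 h₁ (eq b d e f n)
  where
  eq : ∀ a c e f n → e + f + (n + (a + c)) + 0 ≡ n + (a + e + (c + f))
  eq = solve-∀

module _ (s k₁ k₂ : ℕ) where
  open Grid s k₁ k₂

  Interior : V → Set
  Interior (x , y) = (s ≤ toℕ x × toℕ x + s < k₁) × (s ≤ toℕ y × toℕ y + s < k₂)

  interior? : ∀ v → Dec (Interior v)
  interior? (x , y) = (s ≤? toℕ x ×-dec toℕ x + s <? k₁) ×-dec (s ≤? toℕ y ×-dec toℕ y + s <? k₂)

  -- Up to a constant these are the coordinates x + y and x - y; adding `k₂` keeps the second one a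
  -- natural number.
  rotate : V → Point
  rotate (x , y) = toℕ x + toℕ y , toℕ x + (k₂ ∸ toℕ y)

  rotate-injective : ∀ {v w} → rotate v ≡ rotate w → v ≡ w
  rotate-injective {x , y} {x′ , y′} eq = cong₂ _,_ (toℕ-injective x≡) (toℕ-injective y≡)
    where
    twice : ∀ x y → y ≤ k₂ → (x + y) + (x + (k₂ ∸ y)) ≡ 2 * x + k₂
    twice x y y≤ = trans (eq′ x y (k₂ ∸ y)) (cong (2 * x +_) (m+[n∸m]≡n y≤))
      where
      eq′ : ∀ x y c → x + y + (x + c) ≡ 2 * x + (y + c)
      eq′ = solve-∀
    x≡ : toℕ x ≡ toℕ x′
    x≡ = *-cancelˡ-≡ _ _ 2 (+-cancelʳ-≡ k₂ _ _ (trans (sym (twice (toℕ x) (toℕ y) (<⇒≤ (toℕ<n y))))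
      (trans (cong₂ _+_ (cong proj₁ eq) (cong proj₂ eq)) (twice (toℕ x′) (toℕ y′) (<⇒≤ (toℕ<n y′))))))
    y≡ : toℕ y ≡ toℕ y′
    y≡ = +-cancelˡ-≡ (toℕ x) _ _ (trans (cong proj₁ eq) (cong (_+ toℕ y′) (sym x≡)))

  -- This is the shift built into `Near`, by which the corner of a ball, and not its centre, becomes
  -- the origin.
  translate : Point → Point
  translate (u , v) = u + s , v + s

  -- The stencil vertex reached from an interior vertex (x , y) by (e - s , i - j).
  displaced : ∀ {x : Fin k₁} {y : Fin k₂} e i j → Interior (x , y) →
    e ≤ 2 * s → i ≤ s → j ≤ s → e + i ≤ 2 * s + j → e + j ≤ 2 * s + i → i ≤ e + j → j ≤ e + i →
    ∃[ w ] Stencil (x , y) (w , input) ×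
      translate (rotate w) ≡ (toℕ x + toℕ y + (e + i ∸ j) , toℕ x + (k₂ ∸ toℕ y) + (e + j ∸ i))
  displaced {x} {y} e i j ((s≤x , x+s<) , (s≤y , y+s<)) e≤ i≤ j≤ h₁ h₂ h₃ h₄ = (x′ , y′) , within dist , cong₂ _,_ fst≡ snd≡
    where
    open ≡-Reasoning
    X Y : ℕ
    X = toℕ x
    Y = toℕ y
    X′< : X + e ∸ s < k₁
    X′< = ≤-<-trans (m≤n+o⇒m∸n≤o (X + e) s (≤-trans (+-monoʳ-≤ X e≤) (≤-reflexive (eq X s)))) x+s<
      where
      eq : ∀ X s → X + 2 * s ≡ s + (X + s)
      eq = solve-∀
    Y′< : Y + i ∸ j < k₂
    Y′< = ≤-<-trans (m∸n≤m (Y + i) j) (≤-<-trans (+-monoʳ-≤ Y i≤) y+s<)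
    x′ = fromℕ< X′<
    y′ = fromℕ< Y′<
    x′+s : toℕ x′ + s ≡ X + e
    x′+s = trans (cong (_+ s) (toℕ-fromℕ< X′<)) (m∸n+n≡m (≤-trans s≤x (m≤m+n X e)))
    y′+j : toℕ y′ + j ≡ Y + i
    y′+j = trans (cong (_+ j) (toℕ-fromℕ< Y′<)) (m∸n+n≡m (≤-trans j≤ (≤-trans s≤y (m≤m+n Y i))))
    shifted-difference : ∀ a b c d → a + b ≡ c + d → ∣ a - c ∣ ≡ ∣ d - b ∣
    shifted-difference a b c d eq = trans (sym (∣m+n-m+o∣≡∣n-o∣ b a c)) (trans
      (cong₂ ∣_-_∣ (trans (+-comm b a) eq) (+-comm b c)) (∣m+n-m+o∣≡∣n-o∣ c d b))
    dist : dist₁ (x′ , y′) (x , y) ≤ s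
    dist rewrite shifted-difference (toℕ x′) s X e x′+s | shifted-difference (toℕ y′) j Y i y′+j = ∣-∣+∣-∣≤ {e} {s} {i} {j}
      (subst (e + i ≤_) (eq s j) h₁) (subst (e + j ≤_) (eq s i) h₂) (+-monoʳ-≤ s h₃) (+-monoʳ-≤ s h₄)
      where
      eq : ∀ s j → 2 * s + j ≡ s + (s + j)
      eq = solve-∀
    fst≡ : toℕ x′ + toℕ y′ + s ≡ X + Y + (e + i ∸ j)
    fst≡ = +-cancelʳ-≡ j _ _ (begin
      toℕ x′ + toℕ y′ + s + j      ≡⟨ eq₁ (toℕ x′) (toℕ y′) s j ⟩
      toℕ x′ + s + (toℕ y′ + j)    ≡⟨ cong₂ _+_ x′+s y′+j ⟩
      X + e + (Y + i)              ≡⟨ eq₂ X e Y i ⟩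
      X + Y + (e + i)              ≡⟨ cong (X + Y +_) (m∸n+n≡m h₄) ⟨
      X + Y + (e + i ∸ j + j)      ≡⟨ +-assoc (X + Y) _ j ⟨
      X + Y + (e + i ∸ j) + j      ∎)
      where
      eq₁ : ∀ a b c d → a + b + c + d ≡ a + c + (b + d)
      eq₁ = solve-∀
      eq₂ : ∀ a b c d → a + b + (c + d) ≡ a + c + (b + d)
      eq₂ = solve-∀
    snd≡ : toℕ x′ + (k₂ ∸ toℕ y′) + s ≡ X + (k₂ ∸ Y) + (e + j ∸ i)
    snd≡ = +-cancelʳ-≡ (Y + i) _ _ (begin
      toℕ x′ + (k₂ ∸ toℕ y′) + s + (Y + i)          ≡⟨ cong (toℕ x′ + (k₂ ∸ toℕ y′) + s +_) y′+j ⟨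
      toℕ x′ + (k₂ ∸ toℕ y′) + s + (toℕ y′ + j)     ≡⟨ eq₁ (toℕ x′) (k₂ ∸ toℕ y′) s (toℕ y′) j ⟩
      toℕ x′ + s + (k₂ ∸ toℕ y′ + toℕ y′) + j       ≡⟨ cong₂ (λ a b → a + b + j) x′+s (m∸n+n≡m (<⇒≤ (toℕ<n y′))) ⟩
      X + e + k₂ + j                                ≡⟨ cong (λ z → X + e + z + j) (m∸n+n≡m (<⇒≤ (toℕ<n y))) ⟨
      X + e + (k₂ ∸ Y + Y) + j                      ≡⟨ eq₂ X e (k₂ ∸ Y) Y j ⟩
      X + (k₂ ∸ Y) + (e + j) + Y                    ≡⟨ cong (λ z → X + (k₂ ∸ Y) + z + Y) (m∸n+n≡m h₃) ⟨
      X + (k₂ ∸ Y) + (e + j ∸ i + i) + Y            ≡⟨ eq₃ (X + (k₂ ∸ Y)) (e + j ∸ i) i Y ⟩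
      X + (k₂ ∸ Y) + (e + j ∸ i) + (Y + i)          ∎)
      where
      eq₁ : ∀ a b c d e → a + b + c + (d + e) ≡ a + c + (b + d) + e
      eq₁ = solve-∀
      eq₂ : ∀ a b c d e → a + b + (c + d) + e ≡ a + c + (b + e) + d
      eq₂ = solve-∀
      eq₃ : ∀ a b c d → a + (b + c) + d ≡ a + b + (d + c)
      eq₃ = solve-∀

  -- In rotated coordinates, measured from the corner of the ball, `displaced` reaches (e + i - j ,
  -- e + j - i). Thus e = i + j gives (2i , 2j), and e = i + j + 1 gives (2i + 1 , 2j + 1).
  near⇒stencil : ∀ {v q} → Interior v → Near s (rotate v) q → ∃[ w ] Stencil v (w , input) × translate (rotate w) ≡ q
  near⇒stencil {x , y} int (same {i} {j} i≤s j≤s) =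
    let w , st , w≡ = displaced (i + j) i j int e≤ i≤s j≤s (h i j i≤s) (subst (λ z → z + j ≤ 2 * s + i) (+-comm j i) (h j i j≤s))
          (≤-trans (m≤m+n i j) (m≤m+n (i + j) j)) (≤-trans (m≤n+m j i) (m≤m+n (i + j) i))
    in w , st , trans w≡ (cong₂ _,_ (cong (toℕ x + toℕ y +_) (cancel i j))
         (cong (toℕ x + (k₂ ∸ toℕ y) +_) (trans (cong (λ z → z + j ∸ i) (+-comm i j)) (cancel j i))))
    where
    e≤ : i + j ≤ 2 * s
    e≤ = ≤-trans (+-mono-≤ i≤s j≤s) (≤-reflexive (cong (s +_) (sym (+-identityʳ s))))
    h : ∀ i j → i ≤ s → i + j + i ≤ 2 * s + j
    h i j i≤s = ≤-cert 0 (+-mono-≤ i≤s i≤s) (eq i j s)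
      where
      eq : ∀ i j s → i + j + i + (s + s) + 0 ≡ 2 * s + j + (i + i)
      eq = solve-∀
    cancel : ∀ i j → i + j + i ∸ j ≡ i * 2
    cancel i j = trans (cong (_∸ j) (eq i j)) (m+n∸n≡m (i * 2) j)
      where
      eq : ∀ i j → i + j + i ≡ i * 2 + j
      eq = solve-∀
  near⇒stencil {x , y} int (other {i} {j} i<s j<s) =
    let w , st , w≡ = displaced (suc (i + j)) i j int e≤ (<⇒≤ i<s) (<⇒≤ j<s) (h i j i<s)
          (subst (λ z → suc z + j ≤ 2 * s + i) (+-comm j i) (h j i j<s))
          (≤-trans (m≤m+n i j) (m≤n⇒m≤1+n (m≤m+n (i + j) j))) (≤-trans (m≤n+m j i) (m≤n⇒m≤1+n (m≤m+n (i + j) i)))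
    in w , st , trans w≡ (cong₂ _,_
         (trans (cong (toℕ x + toℕ y +_) (cancel i j)) (+-suc (toℕ x + toℕ y) (i * 2)))
         (trans (cong (toℕ x + (k₂ ∸ toℕ y) +_) (trans (cong (λ z → suc z + j ∸ i) (+-comm i j)) (cancel j i)))
                (+-suc (toℕ x + (k₂ ∸ toℕ y)) (j * 2))))
    where
    e≤ : suc (i + j) ≤ 2 * s
    e≤ = ≤-trans (+-mono-≤ i<s (<⇒≤ j<s)) (≤-reflexive (cong (s +_) (sym (+-identityʳ s))))
    h : ∀ i j → i < s → suc (i + j) + i ≤ 2 * s + j
    h i j i<s = ≤-cert 1 (+-mono-≤ i<s i<s) (eq i j s)
      where
      eq : ∀ i j s → suc (i + j) + i + (s + s) + 1 ≡ 2 * s + j + (suc i + suc i)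
      eq = solve-∀
    cancel : ∀ i j → suc (i + j) + i ∸ j ≡ suc (i * 2)
    cancel i j = trans (cong (_∸ j) (eq i j)) (m+n∸n≡m (suc (i * 2)) j)
      where
      eq : ∀ i j → suc (i + j) + i ≡ suc (i * 2) + j
      eq = solve-∀

  -- The count takes place in the rotated plane: mapping `src` there preserves its length, and a
  -- duplicate-free `X` inside the image is no longer than it.
  stencil-demand : .{{_ : NonZero s}} → ∀ r → 3 ≤ r → ∀ A → Unique A → (∀ {v} → v ∈ A → Interior v) → length A ≡ 2 * (r * r) →
    ∀ src → (∀ {v x} → v ∈ A → Stencil v x → x ∈ src) → 2 * (r * r) + 4 * s * r ∸ 4 * s ≤ length src
  stencil-demand r 3≤r A u int len src stencils =
    let X , (uX , near) , bound = isoperimetry s r 3≤r (map rotate A) (Unique.map⁺ rotate-injective u) (trans (length-map rotate A) len)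
    in ≤-trans (m≤n+o⇒m∸n≤o (2 * (r * r) + 4 * s * r) (4 * s) (≤-trans bound (≤-reflexive (+-comm (length X) (4 * s)))))
         (≤-trans (unique-⊆⇒length≤ uX (sub near)) (≤-reflexive (length-map (translate ∘ rotate ∘ proj₁) src)))
    where
    sub : ∀ {X} → (∀ {q} → q ∈ X → ∃[ p ] p ∈ map rotate A × Near s p q) → X ⊆ map (translate ∘ rotate ∘ proj₁) src
    sub near q∈ with near q∈
    ... | p , p∈ , n with ∈-map⁻ rotate p∈
    ...   | v , v∈ , refl =
      let w , st , w≡ = near⇒stencil (int v∈) n
      in subst (_∈ map (translate ∘ rotate ∘ proj₁) src) w≡ (∈-map⁺ (translate ∘ rotate ∘ proj₁) (stencils v∈ st))

  interior-length : (k₁ ∸ 2 * s) * (k₂ ∸ 2 * s) ≤ length (filter interior? (vertices k₁ k₂))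
  interior-length = begin
    (k₁ ∸ 2 * s) * (k₂ ∸ 2 * s)                          ≡⟨ length-vertices (k₁ ∸ 2 * s) (k₂ ∸ 2 * s) ⟨
    length (vertices (k₁ ∸ 2 * s) (k₂ ∸ 2 * s))          ≡⟨ length-map inner (vertices (k₁ ∸ 2 * s) (k₂ ∸ 2 * s)) ⟨
    length (map inner (vertices (k₁ ∸ 2 * s) (k₂ ∸ 2 * s))) ≤⟨ unique-⊆⇒length≤ (Unique.map⁺ inner-injective (vertices-unique _ _)) sub ⟩
    length (filter interior? (vertices k₁ k₂))           ∎
    where
    open ≤-Reasoning
    shifted : ∀ k (i : Fin (k ∸ 2 * s)) → s + toℕ i + s < k
    shifted k i = subst (_< k) (eq s (toℕ i)) (m≤o∸n⇒m+n≤o (suc (toℕ i)) (<⇒≤ (m∸n≢0⇒n<m (m<n⇒n≢0 (toℕ<n i)))) (toℕ<n i))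
      where
      eq : ∀ s i → i + 2 * s ≡ s + i + s
      eq = solve-∀
    in-range : ∀ k (i : Fin (k ∸ 2 * s)) → s + toℕ i < k
    in-range k i = ≤-<-trans (m≤m+n _ s) (shifted k i)
    inner : Fin (k₁ ∸ 2 * s) × Fin (k₂ ∸ 2 * s) → V
    inner (i , j) = fromℕ< (in-range k₁ i) , fromℕ< (in-range k₂ j)
    from-injective : ∀ k {i j : Fin (k ∸ 2 * s)} → fromℕ< (in-range k i) ≡ fromℕ< (in-range k j) → i ≡ j
    from-injective k {i} {j} eq = toℕ-injective (+-cancelˡ-≡ s _ _
      (trans (sym (toℕ-fromℕ< (in-range k i))) (trans (cong toℕ eq) (toℕ-fromℕ< (in-range k j)))))
    inner-injective : ∀ {p q} → inner p ≡ inner q → p ≡ q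
    inner-injective eq = cong₂ _,_ (from-injective k₁ (cong proj₁ eq)) (from-injective k₂ (cong proj₂ eq))
    inside : ∀ k i → s ≤ toℕ (fromℕ< (in-range k i)) × toℕ (fromℕ< (in-range k i)) + s < k
    inside k i rewrite toℕ-fromℕ< (in-range k i) = m≤m+n s _ , shifted k i
    sub : map inner (vertices (k₁ ∸ 2 * s) (k₂ ∸ 2 * s)) ⊆ filter interior? (vertices k₁ k₂)
    sub x∈ with ∈-map⁻ inner x∈
    ... | (i , j) , _ , refl = ∈-filter⁺ interior? (∈-vertices _) (inside k₁ i , inside k₂ j)

  io-lower-bound : .{{_ : NonZero s}} → ∀ {M B i} r → 3 ≤ r → ComputableWith s k₁ k₂ M B i →
    let m = 2 * (r * r) in
    ∃[ j ] ∃[ a ] ∃[ reads ] a < m × j * m ≤ k₁ * k₂ × (k₁ ∸ 2 * s) * (k₂ ∸ 2 * s) ≤ a + j * m ×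
      j * (m + 4 * s * r ∸ 4 * s) + a ≤ reads + (M + j * M) × 2 * reads ≤ i * B
  io-lower-bound {M} {B} r 3≤r (ext , σ , layout , ρ , outputs) =
    let j , a , a<m , jm≤ , covered , reads = Phases.phase-bound s k₁ k₂ M B Interior interior? (2 * (r * r))
          (2 * (r * r) + 4 * s * r ∸ 4 * s) (stencil-demand r 3≤r) 0<m layout ρ outputs
    in j , a , inputsRead s k₁ k₂ M B ρ , a<m , jm≤ , ≤-trans interior-length covered , reads ,
       2*inputsRead≤ s k₁ k₂ M B layout ρ outputs
    where
    0<m : 0 < 2 * (r * r)
    0<m = ≤-trans (s≤s z≤n) (*-monoʳ-≤ 2 (*-mono-≤ 3≤r 3≤r))

-- Upper bound: buffered streams

-- Internal memory is five lists concatenated up to order, so each move of data between them is an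
-- identity in a commutative monoid; a single element is treated as a one-element list.
module Rearrange {A : Set} where

  private
    open CommutativeMonoidSolver (++-commutativeMonoid {A = A})
    F G H W O X : Expr 6
    F = var (Fin.# 0)
    G = var (Fin.# 1)
    H = var (Fin.# 2)
    W = var (Fin.# 3)
    O = var (Fin.# 4)
    X = var (Fin.# 5)

  module _ (f g h w o : List A) where

    private
      env : List A → Vec (List A) 6
      env x = f ∷ g ∷ h ∷ w ∷ o ∷ x ∷ []

    f⇒w : ∀ x → (x ∷ f ++ g ++ h ++ w) ++ o ↭ (f ++ g ++ h ++ x ∷ w) ++ o
    f⇒w x = prove 6 ((X ⊕ (F ⊕ (G ⊕ (H ⊕ W)))) ⊕ O) ((F ⊕ (G ⊕ (H ⊕ (X ⊕ W)))) ⊕ O) (env [ x ])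

    g⇒w : ∀ x → (f ++ (x ∷ g) ++ h ++ w) ++ o ↭ (f ++ g ++ h ++ x ∷ w) ++ o
    g⇒w x = prove 6 ((F ⊕ ((X ⊕ G) ⊕ (H ⊕ W))) ⊕ O) ((F ⊕ (G ⊕ (H ⊕ (X ⊕ W)))) ⊕ O) (env [ x ])

    w⇒h : ∀ x → (f ++ g ++ h ++ x ∷ w) ++ o ↭ (f ++ g ++ (h ∷ʳ x) ++ w) ++ o
    w⇒h x = prove 6 ((F ⊕ (G ⊕ (H ⊕ (X ⊕ W)))) ⊕ O) ((F ⊕ (G ⊕ ((H ⊕ X) ⊕ W))) ⊕ O) (env [ x ])

    take-f : f ++ ((g ++ h ++ w) ++ o) ↭ (f ++ g ++ h ++ w) ++ o
    take-f = prove 6 (F ⊕ ((G ⊕ (H ⊕ W)) ⊕ O)) ((F ⊕ (G ⊕ (H ⊕ W))) ⊕ O) (env [])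

    take-g : g ++ ((f ++ h ++ w) ++ o) ↭ (f ++ g ++ h ++ w) ++ o
    take-g = prove 6 (G ⊕ ((F ⊕ (H ⊕ W)) ⊕ O)) ((F ⊕ (G ⊕ (H ⊕ W))) ⊕ O) (env [])

    give-h : (f ++ g ++ h ++ w) ++ o ↭ h ++ ((f ++ g ++ w) ++ o)
    give-h = prove 6 ((F ⊕ (G ⊕ (H ⊕ W))) ⊕ O) (H ⊕ ((F ⊕ (G ⊕ W)) ⊕ O)) (env [])

    give-w : ∀ x → (f ++ g ++ h ++ x ∷ w) ++ o ↭ x ∷ ((f ++ g ++ h ++ w) ++ o)
    give-w x = prove 6 ((F ⊕ (G ⊕ (H ⊕ (X ⊕ W)))) ⊕ O) (X ⊕ ((F ⊕ (G ⊕ (H ⊕ W))) ⊕ O)) (env [ x ])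

module Machines (s k₁ k₂ M B : ℕ) .{{_ : NonZero B}} where
  open Grid s k₁ k₂
  open Rearrange
  open ExternalMemory s k₁ k₂ M B hiding (ComputableWith)

  data Stream : Set where
    inputs ghosts outputs : Stream

  index : Stream → ℕ
  index inputs  = 0
  index ghosts  = 1
  index outputs = 2

  -- The three streams occupy the residue classes modulo 3, so each has unboundedly many blocks and
  -- none overwrites another.
  address : Stream → ℕ → ℕ
  address a j = index a + j * 3

  index-injective : ∀ a a′ → index a % 3 ≡ index a′ % 3 → a ≡ a′
  index-injective inputs  inputs  _ = refl
  index-injective ghosts  ghosts  _ = refl
  index-injective outputs outputs _ = refl

  address-stream : ∀ a j a′ j′ → address a j ≡ address a′ j′ → a ≡ a′
  address-stream a j a′ j′ eq = index-injective a a′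
    (trans (sym ([m+kn]%n≡m%n (index a) j 3)) (trans (cong (_% 3) eq) ([m+kn]%n≡m%n (index a′) j′ 3)))

  address-injective : ∀ a j j′ → address a j ≡ address a j′ → j ≡ j′
  address-injective a j j′ eq = *-cancelʳ-≡ j j′ 3 (+-cancelˡ-≡ (index a) (j * 3) (j′ * 3) eq)

  -- A block is nonempty by construction, so a single read always supplies the next element.
  Block : Set
  Block = V × List V

  cells : Block → List V
  cells (v , vs) = v ∷ vs

  unblock : List Block → List V
  unblock = concatMap cells

  I O : List V → List Element
  I = map (_, input)
  O = map (_, output)

  Stored : Stream → ℕ → List Block → External → Set
  Stored a j []       ext = ⊤
  Stored a j (b ∷ bs) ext = (ext (address a j) ≡ I (cells b) × length (cells b) ≤ B) × Stored a (suc j) bs ext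

  Stored-setBlock : ∀ {a} j bs {c xs ext} → (∀ {i} → j ≤ i → i < j + length bs → address a i ≢ c) →
    Stored a j bs ext → Stored a j bs (setBlock c xs ext)
  Stored-setBlock j [] _ _ = tt
  Stored-setBlock {a} j (b ∷ bs) {c} {xs} {ext} apart ((b≡ , b≤) , st) =
    (trans (setBlock-other s k₁ k₂ M B xs ext (apart ≤-refl (m<m+n j z<s))) b≡ , b≤) ,
    Stored-setBlock (suc j) bs (λ {i} j<i i< → apart (<⇒≤ j<i) (subst (i <_) (sym (+-suc j (length bs))) i<)) st

  Stored-snoc : ∀ {a} j bs {b ext} → Stored a j bs ext → ext (address a (j + length bs)) ≡ I (cells b) → length (cells b) ≤ B →
    Stored a j (bs ∷ʳ b) ext
  Stored-snoc {a} j [] {b} {ext} _ b≡ b≤ = (subst (λ i → ext (address a i) ≡ I (cells b)) (+-identityʳ j) b≡ , b≤) , tt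
  Stored-snoc {a} j (_ ∷ bs) {b} {ext} (st₁ , st) b≡ b≤ =
    st₁ , Stored-snoc (suc j) bs st (subst (λ i → ext (address a i) ≡ I (cells b)) (+-suc j (length bs)) b≡) b≤

  _++ᵣ_ : ∀ {σ τ υ i j} → Run σ i τ → Run τ j υ → Run σ (i + j) υ
  [] ++ᵣ ρ′ = ρ′
  _++ᵣ_ {σ} {υ = υ} {j = j} (_∷_ {i = i} {j = i′} st ρ) ρ′ = subst (λ n → Run σ n υ) (sym (+-assoc i i′ j)) (st ∷ (ρ ++ᵣ ρ′))

  snoc : ∀ {σ τ υ i j} → Run σ i τ → Step τ j υ → Run σ (i + j) υ
  snoc {σ} {υ = υ} {i} {j} ρ st = subst (λ n → Run σ (i + n) υ) (+-identityʳ j) (ρ ++ᵣ (st ∷ []))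

  -- A run reaching a state in which F is still to be read, G is the queue of elements waiting for the next strip,
  -- W is the window, and D and P list what has been evaluated and what has been queued so far.  Internal memory
  -- holds W and four buffers: the part f of F and g of G already read, and the parts h of G and o of the outputs
  -- not yet written.
  record Machine (ext₀ : External) (n₀ : ℕ) (F G W D P : List V) : Set where
    field
      {int}   : List Element
      {ext}   : External
      {ios}   : ℕ
      run     : Run ⟨ [] , ext₀ ⟩ ios ⟨ int , ext ⟩
      f g h o : List V
      fs gs   : List Block
      cf cg co : ℕ
      internal : int ↭ (I f ++ I g ++ I h ++ I W) ++ O o
      f≤ : length f ≤ B
      g≤ : length g ≤ B
      h≤ : length h ≤ B
      o≤ : length o ≤ B
      fs-stored : Stored inputs cf fs ext
      gs-stored : Stored ghosts cg gs ext
      F≡ : F ≡ f ++ unblock fs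
      G≡ : G ≡ g ++ unblock gs ++ h
      evaluated : ∀ {v} → v ∈ D → v ∈ o ⊎ ∃[ j ] j < co × (v , output) ∈ ext (address outputs j)
      -- Amortized cost in units of one element: an unread block of either stream still owes a read,
      -- an element of `h` owes a write and a later read, and an element of `o` owes a write. The
      -- right side grants two units per queued element and one per evaluation.
      cost : B * ios + (B * length fs + B * length gs + 2 * length h + length o) ≤ B * n₀ + 2 * length P + length D

  open Machine

  module _ {ext₀ : External} {n₀ : ℕ} where

    private Mach = Machine ext₀ n₀

    internal-length : ∀ {F G W D P} (m : Mach F G W D P) →
      length (int m) ≡ (length (f m) + (length (g m) + (length (h m) + length W))) + length (o m)
    internal-length {W = W} m = trans (↭-length (internal m)) (trans (length-++ (I (f m) ++ _))
      (cong₂ _+_ (trans (length-++ (I (f m))) (cong₂ _+_ (length-map _ (f m)) (trans (length-++ (I (g m)))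
        (cong₂ _+_ (length-map _ (g m)) (trans (length-++ (I (h m))) (cong₂ _+_ (length-map _ (h m)) (length-map _ W)))))))
      (length-map _ (o m))))

    permute : ∀ {F G W W′ D P} → W ↭ W′ → Mach F G W D P → Mach F G W′ D P
    permute W↭W′ m = record
      { run = run m ; f = f m ; g = g m ; h = h m ; o = o m ; fs = fs m ; gs = gs m ; cf = cf m ; cg = cg m ; co = co m
      ; internal = ↭-trans (internal m) (++⁺ʳ (O (o m)) (++⁺ˡ (I (f m)) (++⁺ˡ (I (g m)) (++⁺ˡ (I (h m)) (map⁺ _ W↭W′)))))
      ; f≤ = f≤ m ; g≤ = g≤ m ; h≤ = h≤ m ; o≤ = o≤ m ; fs-stored = fs-stored m ; gs-stored = gs-stored m
      ; F≡ = F≡ m ; G≡ = G≡ m ; evaluated = evaluated m ; cost = cost m }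

    evaluated-read : ∀ {D o co} ext a j → a ≢ outputs →
      (∀ {v} → v ∈ D → v ∈ o ⊎ ∃[ i ] i < co × (v , output) ∈ ext (address outputs i)) →
      ∀ {xs v} → v ∈ D → v ∈ o ⊎ ∃[ i ] i < co × (v , output) ∈ setBlock (address a j) xs ext (address outputs i)
    evaluated-read ext a j a≢ ev {xs} {v} v∈ with ev v∈
    ... | inj₁ v∈o = inj₁ v∈o
    ... | inj₂ (i , i< , v∈e) = inj₂ (i , i< , subst ((v , output) ∈_)
            (sym (setBlock-other s k₁ k₂ M B xs ext (λ eq → a≢ (sym (address-stream outputs i a j eq))))) v∈e)

    popF : ∀ {v F G W D P} → length W + 4 * B ≤ M → Mach (v ∷ F) G W D P → Mach F G (v ∷ W) D P
    popF {v} {W = W} fits m@record { f = x ∷ f′ ; F≡ = refl } = record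
      { run = run m ; f = f′ ; g = g m ; h = h m ; o = o m ; fs = fs m ; gs = gs m ; cf = cf m ; cg = cg m ; co = co m
      ; internal = ↭-trans (internal m) (f⇒w (I f′) (I (g m)) (I (h m)) (I W) (O (o m)) (v , input))
      ; f≤ = <⇒≤ (f≤ m) ; g≤ = g≤ m ; h≤ = h≤ m ; o≤ = o≤ m ; fs-stored = fs-stored m ; gs-stored = gs-stored m
      ; F≡ = refl ; G≡ = G≡ m ; evaluated = evaluated m ; cost = cost m }
    popF fits record { f = [] ; fs = [] ; F≡ = () }
    popF {v} {W = W} fits m@record { int = int₀ ; ext = ext₁ ; ios = ios₀ ; f = [] ; fs = (x , xs) ∷ fs′ ; F≡ = refl ; fs-stored = (b≡ , b≤) , fs-st } = record
      { run = snoc (run m) (read (address inputs (cf m)) len)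
      ; f = xs ; g = g m ; h = h m ; o = o m ; fs = fs′ ; gs = gs m ; cf = suc (cf m) ; cg = cg m ; co = co m
      ; internal = ↭-trans (↭-reflexive (cong (_++ int₀) b≡)) (↭-trans (++⁺ˡ (I (x ∷ xs)) (internal m))
          (↭-trans (take-f (I (x ∷ xs)) (I (g m)) (I (h m)) (I W) (O (o m)))
                   (f⇒w (I xs) (I (g m)) (I (h m)) (I W) (O (o m)) (v , input))))
      ; f≤ = <⇒≤ b≤ ; g≤ = g≤ m ; h≤ = h≤ m ; o≤ = o≤ m
      ; fs-stored = Stored-setBlock (suc (cf m)) fs′ (λ {i} j<i _ eq → <⇒≢ j<i (sym (address-injective inputs i (cf m) eq))) fs-st
      ; gs-stored = Stored-setBlock (cg m) (gs m) (λ {i} _ _ eq → case (address-stream ghosts i inputs (cf m) eq)) (gs-stored m)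
      ; F≡ = refl ; G≡ = G≡ m ; evaluated = evaluated-read ext₁ inputs (cf m) (λ ()) (evaluated m)
      ; cost = ≤-trans (≤-reflexive (eq B ios₀ (length fs′) (B * length (gs m)) (2 * length (h m)) (length (o m)))) (cost m) }
      where
      case : ghosts ≢ inputs
      case ()
      len : length (ext₁ (address inputs (cf m)) ++ int₀) ≤ M
      len = begin
        length (ext₁ (address inputs (cf m)) ++ int₀)                    ≡⟨ length-++ (ext₁ (address inputs (cf m))) ⟩
        length (ext₁ (address inputs (cf m))) + length int₀              ≡⟨ cong₂ _+_ (trans (cong length b≡) (length-map _ (x ∷ xs))) (internal-length m) ⟩
        suc (length xs) + (length (g m) + (length (h m) + length W) + length (o m)) ≤⟨ +-mono-≤ b≤ (+-mono-≤ (+-mono-≤ (g≤ m) (+-monoˡ-≤ (length W) (h≤ m))) (o≤ m)) ⟩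
        B + (B + (B + length W) + B)                                     ≡⟨ eq′ B (length W) ⟩
        length W + 4 * B                                                 ≤⟨ fits ⟩
        M                                                                ∎
        where
        open ≤-Reasoning
        eq′ : ∀ b w → b + (b + (b + w) + b) ≡ w + 4 * b
        eq′ = solve-∀
      eq : ∀ b i n x y z → b * (i + 1) + (b * n + x + y + z) ≡ b * i + (b * suc n + x + y + z)
      eq = solve-∀

    popG : ∀ {v F G W D P} → length W + 4 * B ≤ M → Mach F (v ∷ G) W D P → Mach F G (v ∷ W) D P
    popG {v} {W = W} fits m@record { g = x ∷ g′ ; G≡ = refl } = record
      { run = run m ; f = f m ; g = g′ ; h = h m ; o = o m ; fs = fs m ; gs = gs m ; cf = cf m ; cg = cg m ; co = co m
      ; internal = ↭-trans (internal m) (g⇒w (I (f m)) (I g′) (I (h m)) (I W) (O (o m)) (v , input))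
      ; f≤ = f≤ m ; g≤ = <⇒≤ (g≤ m) ; h≤ = h≤ m ; o≤ = o≤ m ; fs-stored = fs-stored m ; gs-stored = gs-stored m
      ; F≡ = F≡ m ; G≡ = refl ; evaluated = evaluated m ; cost = cost m }
    popG fits record { g = [] ; gs = [] ; h = [] ; G≡ = () }
    -- With no stored block left, the tail buffer of the queue becomes its head: no I/O takes place,
    -- and the credit of its elements is given up.
    popG {v} {W = W} {P = P} fits m@record { g = [] ; gs = [] ; h = x ∷ h′ ; G≡ = refl } = record
      { run = run m ; f = f m ; g = h′ ; h = [] ; o = o m ; fs = fs m ; gs = [] ; cf = cf m ; cg = cg m ; co = co m
      ; internal = ↭-trans (internal m) (g⇒w (I (f m)) (I h′) [] (I W) (O (o m)) (v , input))
      ; f≤ = f≤ m ; g≤ = <⇒≤ (h≤ m) ; h≤ = z≤n ; o≤ = o≤ m ; fs-stored = fs-stored m ; gs-stored = tt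
      ; F≡ = F≡ m ; G≡ = sym (++-identityʳ h′) ; evaluated = evaluated m
      ; cost = ≤-trans (+-monoʳ-≤ (B * ios m) (+-monoˡ-≤ (length (o m)) (+-monoʳ-≤ (B * length (fs m) + B * 0) z≤n))) (cost m) }
    popG {v} {W = W} fits m@record { int = int₀ ; ext = ext₁ ; ios = ios₀ ; g = [] ; gs = (x , xs) ∷ gs′ ; G≡ = refl ; gs-stored = (b≡ , b≤) , gs-st } = record
      { run = snoc (run m) (read (address ghosts (cg m)) len)
      ; f = f m ; g = xs ; h = h m ; o = o m ; fs = fs m ; gs = gs′ ; cf = cf m ; cg = suc (cg m) ; co = co m
      ; internal = ↭-trans (↭-reflexive (cong (_++ int₀) b≡)) (↭-trans (++⁺ˡ (I (x ∷ xs)) (internal m))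
          (↭-trans (take-g (I (f m)) (I (x ∷ xs)) (I (h m)) (I W) (O (o m)))
                   (g⇒w (I (f m)) (I xs) (I (h m)) (I W) (O (o m)) (v , input))))
      ; f≤ = f≤ m ; g≤ = <⇒≤ b≤ ; h≤ = h≤ m ; o≤ = o≤ m
      ; fs-stored = Stored-setBlock (cf m) (fs m) (λ {i} _ _ eq → case (address-stream inputs i ghosts (cg m) eq)) (fs-stored m)
      ; gs-stored = Stored-setBlock (suc (cg m)) gs′ (λ {i} j<i _ eq → <⇒≢ j<i (sym (address-injective ghosts i (cg m) eq))) gs-st
      ; F≡ = F≡ m ; G≡ = ++-assoc xs (unblock gs′) (h m) ; evaluated = evaluated-read ext₁ ghosts (cg m) (λ ()) (evaluated m)
      ; cost = ≤-trans (≤-reflexive (eq B ios₀ (length gs′) (B * length (fs m)) (2 * length (h m)) (length (o m)))) (cost m) }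
      where
      case : inputs ≢ ghosts
      case ()
      len : length (ext₁ (address ghosts (cg m)) ++ int₀) ≤ M
      len = begin
        length (ext₁ (address ghosts (cg m)) ++ int₀)                    ≡⟨ length-++ (ext₁ (address ghosts (cg m))) ⟩
        length (ext₁ (address ghosts (cg m))) + length int₀              ≡⟨ cong₂ _+_ (trans (cong length b≡) (length-map _ (x ∷ xs))) (internal-length m) ⟩
        suc (length xs) + (length (f m) + (length (h m) + length W) + length (o m)) ≤⟨ +-mono-≤ b≤ (+-mono-≤ (+-mono-≤ (f≤ m) (+-monoˡ-≤ (length W) (h≤ m))) (o≤ m)) ⟩
        B + (B + (B + length W) + B)                                     ≡⟨ eq′ B (length W) ⟩
        length W + 4 * B                                                 ≤⟨ fits ⟩
        M                                                                ∎
        where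
        open ≤-Reasoning
        eq′ : ∀ b w → b + (b + (b + w) + b) ≡ w + 4 * b
        eq′ = solve-∀
      eq : ∀ b i n x y z → b * (i + 1) + (x + b * n + y + z) ≡ b * i + (x + b * suc n + y + z)
      eq = solve-∀

    private
      enqueue : ∀ {v F G W D P} (m : Mach F G (v ∷ W) D P) → length (h m) < B → Mach F (G ∷ʳ v) W D (v ∷ P)
      enqueue {v} {W = W} {P = P} m h< = record
        { run = run m ; f = f m ; g = g m ; h = h m ∷ʳ v ; o = o m ; fs = fs m ; gs = gs m ; cf = cf m ; cg = cg m ; co = co m
        ; internal = ↭-trans (internal m) (↭-trans (w⇒h (I (f m)) (I (g m)) (I (h m)) (I W) (O (o m)) (v , input))
            (↭-reflexive (cong (λ z → (I (f m) ++ I (g m) ++ z ++ I W) ++ O (o m)) (sym (map-++ _ (h m) [ v ])))))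
        ; f≤ = f≤ m ; g≤ = g≤ m ; h≤ = ≤-trans (≤-reflexive len) h< ; o≤ = o≤ m ; fs-stored = fs-stored m ; gs-stored = gs-stored m
        ; F≡ = F≡ m ; G≡ = trans (cong (_∷ʳ v) (G≡ m)) (trans (++-assoc (g m) _ [ v ]) (cong (g m ++_) (++-assoc (unblock (gs m)) (h m) [ v ])))
        ; evaluated = evaluated m
        ; cost = ≤-trans (≤-reflexive (trans (cong (λ z → B * ios m + (B * length (fs m) + B * length (gs m) + 2 * z + length (o m))) len)
              (eq₁ (B * ios m) (B * length (fs m) + B * length (gs m)) (length (h m)) (length (o m)))))
            (≤-trans (+-monoˡ-≤ 2 (cost m)) (≤-reflexive (eq₂ (B * n₀) (length P) _))) }
        where
        len : length (h m ∷ʳ v) ≡ suc (length (h m))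
        len = trans (length-++ (h m)) (+-comm (length (h m)) 1)
        eq₁ : ∀ a b c d → a + (b + 2 * suc c + d) ≡ a + (b + 2 * c + d) + 2
        eq₁ = solve-∀
        eq₂ : ∀ a b c → a + 2 * b + c + 2 ≡ a + 2 * suc b + c
        eq₂ = solve-∀

      -- This write and the later read of the same block cost 2B, exactly the credit of the `B`
      -- elements of a full buffer.
      flushH : ∀ {F G W D P} (m : Mach F G W D P) → length (h m) ≡ B → Σ[ m′ ∈ Mach F G W D P ] length (h m′) < B
      flushH record { h = [] } h≡B = ⊥-elim (≢-nonZero⁻¹ B (sym h≡B))
      flushH {G = G} {W = W} m@record { ext = ext₁ ; ios = ios₀ ; h = x ∷ h′ ; G≡ = G≡ } h≡B = record
        { run = snoc (run m) (write a (I (x ∷ h′)) (↭-trans (internal m) (give-h (I (f m)) (I (g m)) (I (x ∷ h′)) (I W) (O (o m))))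
                                (≤-trans (≤-reflexive (length-map _ (x ∷ h′))) (h≤ m)))
        ; f = f m ; g = g m ; h = [] ; o = o m ; fs = fs m ; gs = gs m ∷ʳ (x , h′) ; cf = cf m ; cg = cg m ; co = co m
        ; internal = ↭-refl
        ; f≤ = f≤ m ; g≤ = g≤ m ; h≤ = z≤n ; o≤ = o≤ m
        ; fs-stored = Stored-setBlock (cf m) (fs m) (λ {i} _ _ eq → case (address-stream inputs i ghosts (cg m + length (gs m)) eq)) (fs-stored m)
        ; gs-stored = Stored-snoc (cg m) (gs m) (Stored-setBlock (cg m) (gs m) (λ {i} _ i< eq → <⇒≢ i< (address-injective ghosts i (cg m + length (gs m)) eq)) (gs-stored m))
            (setBlock-here s k₁ k₂ M B a (I (x ∷ h′)) ext₁) (h≤ m)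
        ; F≡ = F≡ m ; G≡ = trans G≡ (cong (g m ++_) (trans (cong (unblock (gs m) ++_) (sym (++-identityʳ (x ∷ h′))))
            (trans (sym (concatMap-++ cells (gs m) [ x , h′ ])) (sym (++-identityʳ _)))))
        ; evaluated = evaluated-read ext₁ ghosts (cg m + length (gs m)) (λ ()) (evaluated m)
        ; cost = ≤-trans (≤-reflexive (trans (cong (λ z → B * (ios₀ + 1) + (B * length (fs m) + B * z + 0 + length (o m))) (trans (length-++ (gs m)) (+-comm _ 1)))
            (trans (eq B ios₀ (length (gs m)) (B * length (fs m)) (length (o m)))
                   (cong (λ z → B * ios₀ + (B * length (fs m) + B * length (gs m) + 2 * z + length (o m))) (sym h≡B))))) (cost m) } , >-nonZero⁻¹ B
        where
        a : ℕ
        a = address ghosts (cg m + length (gs m))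
        case : inputs ≢ ghosts
        case ()
        eq : ∀ b i n x z → b * (i + 1) + (x + b * suc n + 0 + z) ≡ b * i + (x + b * n + 2 * b + z)
        eq = solve-∀

    pushG : ∀ {v F G W D P} → Mach F G (v ∷ W) D P → Mach F (G ∷ʳ v) W D (v ∷ P)
    pushG m with length (h m) <? B
    ... | yes h< = enqueue m h<
    ... | no ¬h< = let m′ , h< = flushH m (≤-antisym (h≤ m) (≮⇒≥ ¬h<)) in enqueue m′ h<

    discard : ∀ {v F G W D P} → Mach F G (v ∷ W) D P → Mach F G W D P
    discard {v} {W = W} m = record
      { run = subst (λ n → Run _ n _) (+-identityʳ (ios m)) (snoc (run m) (delete (v , input)
          (↭-trans (internal m) (give-w (I (f m)) (I (g m)) (I (h m)) (I W) (O (o m)) (v , input)))))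
      ; f = f m ; g = g m ; h = h m ; o = o m ; fs = fs m ; gs = gs m ; cf = cf m ; cg = cg m ; co = co m
      ; internal = ↭-refl
      ; f≤ = f≤ m ; g≤ = g≤ m ; h≤ = h≤ m ; o≤ = o≤ m ; fs-stored = fs-stored m ; gs-stored = gs-stored m
      ; F≡ = F≡ m ; G≡ = G≡ m ; evaluated = evaluated m ; cost = cost m }

    private
      evaluate′ : ∀ {v F G W D P} (m : Mach F G W D P) → length W + 4 * B ≤ M → (∀ {w} → Stencil v (w , input) → w ∈ W) →
        length (o m) < B → Mach F G W (v ∷ D) P
      evaluate′ {v} {F} {G} {W} {D} {P} m fits stencil o< = record
        { run = subst (λ n → Run _ n _) (+-identityʳ (ios m)) (snoc (run m) (evaluate v stencil′ len))
        ; f = f m ; g = g m ; h = h m ; o = v ∷ o m ; fs = fs m ; gs = gs m ; cf = cf m ; cg = cg m ; co = co m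
        ; internal = ↭-trans (prep (v , output) (internal m)) (↭-sym (shift (v , output) (I (f m) ++ I (g m) ++ I (h m) ++ I W) (O (o m))))
        ; f≤ = f≤ m ; g≤ = g≤ m ; h≤ = h≤ m ; o≤ = o< ; fs-stored = fs-stored m ; gs-stored = gs-stored m
        ; F≡ = F≡ m ; G≡ = G≡ m ; evaluated = evaluated′
        ; cost = ≤-trans (≤-reflexive (eq (B * ios m) (B * length (fs m) + B * length (gs m) + 2 * length (h m)) (length (o m))))
            (≤-trans (s≤s (cost m)) (≤-reflexive (sym (+-suc (B * n₀ + 2 * length P) (length D))))) }
        where
        stencil′ : ∀ {x} → Stencil v x → x ∈ int m
        stencil′ st@(within _) = ∈-resp-↭ (↭-sym (internal m)) (∈-++⁺ˡ (∈-++⁺ʳ (I (f m)) (∈-++⁺ʳ (I (g m)) (∈-++⁺ʳ (I (h m)) (∈-map⁺ _ (stencil st))))))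
        evaluated′ : ∀ {w} → w ∈ v ∷ D → w ∈ v ∷ o m ⊎ ∃[ j ] j < co m × (w , output) ∈ ext m (address outputs j)
        evaluated′ (here w≡) = inj₁ (here w≡)
        evaluated′ (there w∈) with evaluated m w∈
        ... | inj₁ w∈o = inj₁ (there w∈o)
        ... | inj₂ w∈e = inj₂ w∈e
        len : length ((v , output) ∷ int m) ≤ M
        len = begin
          suc (length (int m)) ≡⟨ cong suc (internal-length m) ⟩
          suc (length (f m) + (length (g m) + (length (h m) + length W)) + length (o m)) ≡⟨ +-suc _ (length (o m)) ⟨
          length (f m) + (length (g m) + (length (h m) + length W)) + suc (length (o m)) ≤⟨ +-mono-≤ (+-mono-≤ (f≤ m) (+-mono-≤ (g≤ m) (+-monoˡ-≤ (length W) (h≤ m)))) o< ⟩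
          B + (B + (B + length W)) + B ≡⟨ eq′ B (length W) ⟩
          length W + 4 * B ≤⟨ fits ⟩
          M ∎
          where
          open ≤-Reasoning
          eq′ : ∀ b w → b + (b + (b + w)) + b ≡ w + 4 * b
          eq′ = solve-∀
        eq : ∀ a b c → a + (b + suc c) ≡ suc (a + (b + c))
        eq = solve-∀

    -- `paid` covers two situations: a full buffer pays for its own write, with n₁ = n₀, and the
    -- last flush, possibly of a partial buffer, raises the budget by one block.
    flushO : ∀ {F G W D P} (m : Mach F G W D P) n₁ → B + B * n₀ ≤ length (o m) + B * n₁ →
      Σ[ m′ ∈ Machine ext₀ n₁ F G W D P ] o m′ ≡ []
    flushO {W = W} {D = D} {P = P} m@record { ext = ext₁ } n₁ paid = record
      { run = snoc (run m) (write a (O (o m)) (↭-trans (internal m) (give-o (I (f m) ++ I (g m) ++ I (h m) ++ I W)))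
                              (≤-trans (≤-reflexive (length-map _ (o m))) (o≤ m)))
      ; f = f m ; g = g m ; h = h m ; o = [] ; fs = fs m ; gs = gs m ; cf = cf m ; cg = cg m ; co = suc (co m)
      ; internal = ↭-refl
      ; f≤ = f≤ m ; g≤ = g≤ m ; h≤ = h≤ m ; o≤ = z≤n
      ; fs-stored = Stored-setBlock (cf m) (fs m) (λ {i} _ _ eq → case₁ (address-stream inputs i outputs (co m) eq)) (fs-stored m)
      ; gs-stored = Stored-setBlock (cg m) (gs m) (λ {i} _ _ eq → case₂ (address-stream ghosts i outputs (co m) eq)) (gs-stored m)
      ; F≡ = F≡ m ; G≡ = G≡ m ; evaluated = λ v∈ → inj₂ (evaluated′ v∈)
      ; cost = ≤-cert 0 (+-mono-≤ (cost m) paid)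
          (eq B (ios m) (B * length (fs m) + B * length (gs m) + 2 * length (h m)) (length (o m)) (B * n₀) (B * n₁) (2 * length P) (length D)) } , refl
      where
      a : ℕ
      a = address outputs (co m)
      give-o : ∀ xs → xs ++ O (o m) ↭ O (o m) ++ xs ++ []
      give-o xs = ↭-trans (++-comm xs (O (o m))) (++⁺ˡ (O (o m)) (↭-reflexive (sym (++-identityʳ xs))))
      case₁ : inputs ≢ outputs
      case₁ ()
      case₂ : ghosts ≢ outputs
      case₂ ()
      evaluated′ : ∀ {v} → v ∈ D → ∃[ j ] j < suc (co m) × (v , output) ∈ setBlock a (O (o m)) ext₁ (address outputs j)
      evaluated′ {v} v∈ with evaluated m v∈
      ... | inj₁ v∈o = co m , ≤-refl , subst ((v , output) ∈_) (sym (setBlock-here s k₁ k₂ M B a (O (o m)) ext₁)) (∈-map⁺ _ v∈o)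
      ... | inj₂ (j , j< , v∈e) = j , m≤n⇒m≤1+n j< , subst ((v , output) ∈_)
              (sym (setBlock-other s k₁ k₂ M B (O (o m)) ext₁ (λ eq → <⇒≢ j< (address-injective outputs j (co m) eq)))) v∈e
      eq : ∀ b i x l c d p q → b * (i + 1) + (x + 0) + (c + p + q + (l + d)) + 0 ≡ d + p + q + (b * i + (x + l) + (b + c))
      eq = solve-∀

    evaluateNext : ∀ {v F G W D P} → length W + 4 * B ≤ M → (∀ {w} → Stencil v (w , input) → w ∈ W) →
      Mach F G W D P → Mach F G W (v ∷ D) P
    evaluateNext fits stencil m with length (o m) <? B
    ... | yes o< = evaluate′ m fits stencil o<
    ... | no ¬o< = let m′ , o≡[] = flushO m n₀ (+-monoˡ-≤ (B * n₀) (≮⇒≥ ¬o<))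
                   in evaluate′ m′ fits stencil (subst (λ z → length z < B) (sym o≡[]) (>-nonZero⁻¹ B))

    popFs : ∀ xs {F G W D P} → length xs + length W + 4 * B ≤ M → Mach (xs ++ F) G W D P → Mach F G (xs ++ W) D P
    popFs [] _ m = m
    popFs (x ∷ xs) {W = W} fits m = permute (shift x xs W)
      (popFs xs (≤-trans (≤-reflexive (cong (_+ 4 * B) (+-suc (length xs) (length W)))) fits)
        (popF (≤-trans (+-monoˡ-≤ (4 * B) (m≤n+m (length W) (suc (length xs)))) fits) m))

    popGs : ∀ xs {F G W D P} → length xs + length W + 4 * B ≤ M → Mach F (xs ++ G) W D P → Mach F G (xs ++ W) D P
    popGs [] _ m = m
    popGs (x ∷ xs) {W = W} fits m = permute (shift x xs W)
      (popGs xs (≤-trans (≤-reflexive (cong (_+ 4 * B) (+-suc (length xs) (length W)))) fits)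
        (popG (≤-trans (+-monoˡ-≤ (4 * B) (m≤n+m (length W) (suc (length xs)))) fits) m))

    evaluates : ∀ xs {F G W D P} → length W + 4 * B ≤ M → (∀ {v w} → v ∈ xs → Stencil v (w , input) → w ∈ W) →
      Mach F G W D P → Mach F G W (xs ++ D) P
    evaluates [] _ _ m = m
    evaluates (x ∷ xs) fits stencils m = evaluateNext fits (stencils (here refl)) (evaluates xs fits (stencils ∘ there) m)

    relabel : ∀ {F G W D D′ P P′} → D ↭ D′ → P ↭ P′ → Mach F G W D P → Mach F G W D′ P′
    relabel {D = D} D↭ P↭ m = record
      { run = run m ; f = f m ; g = g m ; h = h m ; o = o m ; fs = fs m ; gs = gs m ; cf = cf m ; cg = cg m ; co = co m
      ; internal = internal m ; f≤ = f≤ m ; g≤ = g≤ m ; h≤ = h≤ m ; o≤ = o≤ m ; fs-stored = fs-stored m ; gs-stored = gs-stored m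
      ; F≡ = F≡ m ; G≡ = G≡ m ; evaluated = evaluated m ∘ ∈-resp-↭ (↭-sym D↭)
      ; cost = subst₂ (λ p d → _ ≤ B * n₀ + 2 * p + d) (↭-length P↭) (↭-length D↭) (cost m) }

    pushGs : ∀ xs {F G W D P} → Mach F G (xs ++ W) D P → Mach F (G ++ xs) W D (xs ++ P)
    pushGs [] {G = G} m rewrite ++-identityʳ G = m
    pushGs (x ∷ xs) {G = G} {P = P} m with pushGs xs (pushG m)
    ... | m′ rewrite ++-assoc G [ x ] xs = relabel ↭-refl (shift x xs P) m′

    discards : ∀ xs {F G W D P} → Mach F G (xs ++ W) D P → Mach F G W D P
    discards [] m = m
    discards (x ∷ xs) m = discards xs (discard m)

-- Upper bound: sweeping the strips

from : ∀ {A : Set} → (ℕ → List A) → ℕ → ℕ → List A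
from g k zero    = []
from g k (suc n) = g k ++ from g (suc k) n

module _ {A : Set} where

  ∈-from⁻ : ∀ (g : ℕ → List A) k n {x} → x ∈ from g k n → ∃[ j ] k ≤ j × x ∈ g j
  ∈-from⁻ g k (suc n) x∈ with ∈-++⁻ (g k) x∈
  ... | inj₁ x∈k = k , ≤-refl , x∈k
  ... | inj₂ x∈> = let j , k<j , x∈j = ∈-from⁻ g (suc k) n x∈> in j , <⇒≤ k<j , x∈j

  ∈-from⁺ : ∀ (g : ℕ → List A) k n {x j} → k ≤ j → j < k + n → x ∈ g j → x ∈ from g k n
  ∈-from⁺ g k zero    k≤j j<k x∈ = ⊥-elim (<⇒≱ j<k (≤-trans (≤-reflexive (+-identityʳ k)) k≤j))
  ∈-from⁺ g k (suc n) {j = j} k≤j j< x∈ with k ≟ j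
  ... | yes refl = ∈-++⁺ˡ x∈
  ... | no k≢j  = ∈-++⁺ʳ (g k) (∈-from⁺ g (suc k) n (≤∧≢⇒< k≤j k≢j) (subst (j <_) (+-suc k n) j<) x∈)

  from-unique : ∀ (g : ℕ → List A) k n → (∀ j → Unique (g j)) → (∀ {i j x} → x ∈ g i → x ∈ g j → i ≡ j) → Unique (from g k n)
  from-unique g k zero    _  _   = []
  from-unique g k (suc n) us one = Unique.++⁺ (us k) (from-unique g (suc k) n us one) λ (x∈k , x∈>) →
    let j , k<j , x∈j = ∈-from⁻ g (suc k) n x∈> in <⇒≢ k<j (one x∈k x∈j)

  from-empty : ∀ (g : ℕ → List A) k n → (∀ j → k ≤ j → j < k + n → g j ≡ []) → from g k n ≡ []
  from-empty g k zero    _ = refl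
  from-empty g k (suc n) e = cong₂ _++_ (e k ≤-refl (m<m+n k z<s))
    (from-empty g (suc k) n λ j k<j j< → e j (<⇒≤ k<j) (subst (j <_) (sym (+-suc k n)) j<))

  from-+ : ∀ (g : ℕ → List A) k m n → from g k (m + n) ≡ from g k m ++ from g (m + k) n
  from-+ g k zero    n = refl
  from-+ g k (suc m) n = trans (cong (g k ++_) (trans (from-+ g (suc k) m n) (cong (λ i → from g (suc k) m ++ from g i n) (+-suc m k))))
    (sym (++-assoc (g k) _ _))

  from-cong : ∀ (g g′ : ℕ → List A) r k n → (∀ j → g (r + j) ≡ g′ j) → from g (r + k) n ≡ from g′ k n
  from-cong g g′ r k zero    _ = refl
  from-cong g g′ r k (suc n) e = cong₂ _++_ (e k) (trans (cong (λ i → from g i n) (sym (+-suc r k))) (from-cong g g′ r (suc k) n e))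

unique-++⁻ʳ : ∀ {A : Set} (xs : List A) {ys} → Unique (xs ++ ys) → Unique ys
unique-++⁻ʳ []       u       = u
unique-++⁻ʳ (x ∷ xs) (_ ∷ u) = unique-++⁻ʳ xs u

unique-++⇒∉ : ∀ {A : Set} (xs : List A) {ys} → Unique (xs ++ ys) → ∀ {x} → x ∈ xs → x ∉ ys
unique-++⇒∉ (x ∷ xs) u       (here refl) x∈ys = Unique.Unique[x∷xs]⇒x∉xs u (∈-++⁺ʳ xs x∈ys)
unique-++⇒∉ (x ∷ xs) (_ ∷ u) (there x∈)  x∈ys = unique-++⇒∉ xs u x∈ x∈ys

-- At one element, `S` is the disjoint union of `P`, `Q` and `T`. The refutations are carried along
-- so that `filter-split` can compute all four filters.
data Split (S P Q T : Set) : Set where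
  none   : ¬ S → ¬ P → ¬ Q → ¬ T → Split S P Q T
  first  : S → P → ¬ Q → ¬ T → Split S P Q T
  second : S → ¬ P → Q → ¬ T → Split S P Q T
  third  : S → ¬ P → ¬ Q → T → Split S P Q T

filter-split : ∀ {A : Set} {S P Q T : A → Set} (S? : ∀ x → Dec (S x)) (P? : ∀ x → Dec (P x)) (Q? : ∀ x → Dec (Q x)) (T? : ∀ x → Dec (T x)) →
  (∀ x → Split (S x) (P x) (Q x) (T x)) → ∀ xs → filter S? xs ↭ filter P? xs ++ filter Q? xs ++ filter T? xs
filter-split S? P? Q? T? split [] = ↭-refl
filter-split S? P? Q? T? split (x ∷ xs) with filter-split S? P? Q? T? split xs | split x
... | rec | none ¬s ¬p ¬q ¬t
  rewrite filter-reject S? {xs = xs} ¬s | filter-reject P? {xs = xs} ¬p | filter-reject Q? {xs = xs} ¬q | filter-reject T? {xs = xs} ¬t = rec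
... | rec | first s p ¬q ¬t
  rewrite filter-accept S? {xs = xs} s | filter-accept P? {xs = xs} p | filter-reject Q? {xs = xs} ¬q | filter-reject T? {xs = xs} ¬t = prep x rec
... | rec | second s ¬p q ¬t
  rewrite filter-accept S? {xs = xs} s | filter-reject P? {xs = xs} ¬p | filter-accept Q? {xs = xs} q | filter-reject T? {xs = xs} ¬t =
  ↭-trans (prep x rec) (↭-sym (shift x (filter P? xs) (filter Q? xs ++ filter T? xs)))
... | rec | third s ¬p ¬q t
  rewrite filter-accept S? {xs = xs} s | filter-reject P? {xs = xs} ¬p | filter-reject Q? {xs = xs} ¬q | filter-accept T? {xs = xs} t =
  ↭-trans (prep x rec) (↭-trans (↭-sym (shift x (filter P? xs) (filter Q? xs ++ filter T? xs)))
    (++⁺ˡ (filter P? xs) (↭-sym (shift x (filter Q? xs) (filter T? xs)))))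

-- The sweep without its geometry: `α` and `ω` are the first and last strip of a vertex, `ε` is the
-- strip in which it is evaluated, and `κ` is its time within a strip. `R` will bound the spread of
-- a stencil in time; `L` and `C` bound the times and the strips.
module Schedule (s k₁ k₂ M B : ℕ) .{{_ : NonZero B}}
  (α ω ε κ : Fin k₁ × Fin k₂ → ℕ) (R L C : ℕ)
  (α≤ω : ∀ v → α v ≤ ω v) (ω≤α+1 : ∀ v → ω v ≤ suc (α v)) (ε<C : ∀ v → ε v < C) (α<C : ∀ v → α v < C) (κ<L : ∀ v → κ v < L)
  where

  open Grid s k₁ k₂
  open ExternalMemory s k₁ k₂ M B hiding (ComputableWith)
  open Machines s k₁ k₂ M B
  open Machine

  vs : List V
  vs = vertices k₁ k₂

  Strip : ℕ → V → Set
  Strip c v = α v ≤ c × c ≤ ω v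

  strip? : ∀ c v → Dec (Strip c v)
  strip? c v = α v ≤? c ×-dec c ≤? ω v

  -- These vertices of strip `c` come from the preceding strip. Accordingly `Ghost (suc c)`
  -- describes what strip `c` has to pass on.
  Ghost : ℕ → V → Set
  Ghost c v = α v < c × c ≤ ω v

  ghost? : ∀ c v → Dec (Ghost c v)
  ghost? c v = α v <? c ×-dec c ≤? ω v

  -- A vertex is held from time κ to time κ + 2R and evaluated halfway, at κ + R. A stencil vertex,
  -- whose time differs by at most `R`, has entered by then and has not yet left.
  window? : ∀ c k v → Dec (Strip c v × (κ v ≤ k × k ≤ κ v + 2 * R))
  window? c k v = strip? c v ×-dec (κ v ≤? k ×-dec k ≤? κ v + 2 * R)

  waiting? : ∀ c k v → Dec (Strip c v × (κ v < k × k ≤ κ v + 2 * R))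
  waiting? c k v = strip? c v ×-dec (κ v <? k ×-dec k ≤? κ v + 2 * R)

  fresh? : ∀ c k v → Dec (α v ≡ c × κ v ≡ k)
  fresh? c k v = α v ≟ c ×-dec κ v ≟ k

  returning? : ∀ c k v → Dec (Ghost c v × κ v ≡ k)
  returning? c k v = ghost? c v ×-dec κ v ≟ k

  leaving? : ∀ c k v → Dec (Ghost (suc c) v × κ v + 2 * R ≡ k)
  leaving? c k v = ghost? (suc c) v ×-dec κ v + 2 * R ≟ k

  finished? : ∀ c k v → Dec ((α v ≤ c × ω v ≡ c) × κ v + 2 * R ≡ k)
  finished? c k v = (α v ≤? c ×-dec ω v ≟ c) ×-dec κ v + 2 * R ≟ k

  evaluating? : ∀ c k v → Dec (ε v ≡ c × κ v + R ≡ k)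
  evaluating? c k v = ε v ≟ c ×-dec κ v + R ≟ k

  window waiting fresh returning leaving finished evaluating : ℕ → ℕ → List V
  window     c k = filter (window? c k) vs
  waiting    c k = filter (waiting? c k) vs
  fresh      c k = filter (fresh? c k) vs
  returning  c k = filter (returning? c k) vs
  leaving    c k = filter (leaving? c k) vs
  finished   c k = filter (finished? c k) vs
  evaluating c k = filter (evaluating? c k) vs

  entering : ∀ c k → window c k ↭ fresh c k ++ returning c k ++ waiting c k
  entering c k = filter-split (window? c k) (fresh? c k) (returning? c k) (waiting? c k) split vs
    where
    split : ∀ v → Split (Strip c v × (κ v ≤ k × k ≤ κ v + 2 * R)) (α v ≡ c × κ v ≡ k) (Ghost c v × κ v ≡ k) (Strip c v × (κ v < k × k ≤ κ v + 2 * R))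
    split v with window? c k v
    ... | no ¬w = none ¬w
      (λ { (refl , refl) → ¬w ((≤-refl , α≤ω v) , ≤-refl , m≤m+n (κ v) _) })
      (λ { ((α<c , c≤ω) , refl) → ¬w ((<⇒≤ α<c , c≤ω) , ≤-refl , m≤m+n (κ v) _) })
      (λ { (st , κ<k , k≤) → ¬w (st , <⇒≤ κ<k , k≤) })
    ... | yes w@((α≤c , c≤ω) , κ≤k , k≤) with κ v ≟ k | α v ≟ c
    ...   | no κ≢k | _ = third w (λ (_ , κ≡k) → κ≢k κ≡k) (λ (_ , κ≡k) → κ≢k κ≡k) ((α≤c , c≤ω) , ≤∧≢⇒< κ≤k κ≢k , k≤)
    ...   | yes κ≡k | yes α≡c = first w (α≡c , κ≡k) (λ ((α<c , _) , _) → <⇒≢ α<c α≡c) (λ (_ , κ<k , _) → <⇒≢ κ<k κ≡k)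
    ...   | yes κ≡k | no α≢c = second w (λ (α≡c , _) → α≢c α≡c) ((≤∧≢⇒< α≤c α≢c , c≤ω) , κ≡k) (λ (_ , κ<k , _) → <⇒≢ κ<k κ≡k)

  exiting : ∀ c k → window c k ↭ leaving c k ++ finished c k ++ waiting c (suc k)
  exiting c k = filter-split (window? c k) (leaving? c k) (finished? c k) (waiting? c (suc k)) split vs
    where
    split : ∀ v → Split (Strip c v × (κ v ≤ k × k ≤ κ v + 2 * R)) (Ghost (suc c) v × κ v + 2 * R ≡ k)
      ((α v ≤ c × ω v ≡ c) × κ v + 2 * R ≡ k) (Strip c v × (κ v < suc k × suc k ≤ κ v + 2 * R))
    split v with window? c k v
    ... | no ¬w = none ¬w
      (λ { ((α≤c , c<ω) , refl) → ¬w ((s≤s⁻¹ α≤c , <⇒≤ c<ω) , m≤m+n (κ v) _ , ≤-refl) })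
      (λ { ((α≤c , refl) , refl) → ¬w ((α≤c , ≤-refl) , m≤m+n (κ v) _ , ≤-refl) })
      (λ { (st , κ≤k , k<) → ¬w (st , s≤s⁻¹ κ≤k , <⇒≤ k<) })
    ... | yes w@((α≤c , c≤ω) , κ≤k , k≤) with κ v + 2 * R ≟ k | ω v ≟ c
    ...   | no κ≢k | _ = third w (λ (_ , eq) → κ≢k eq) (λ (_ , eq) → κ≢k eq) ((α≤c , c≤ω) , s≤s κ≤k , ≤∧≢⇒< k≤ (κ≢k ∘ sym))
    ...   | yes eq | yes ω≡c = second w (λ ((_ , c<ω) , _) → <⇒≢ c<ω (sym ω≡c)) ((α≤c , ω≡c) , eq) (λ (_ , _ , k<) → <⇒≢ k< (sym eq))
    ...   | yes eq | no ω≢c = first w ((s≤s α≤c , ≤∧≢⇒< c≤ω (ω≢c ∘ sym)) , eq) (λ ((_ , ω≡c) , _) → ω≢c ω≡c) (λ (_ , _ , k<) → <⇒≢ k< (sym eq))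

  append : ∀ (xs ys zs : List V) → ys ++ xs ++ zs ↭ (xs ++ ys) ++ zs
  append xs ys zs = ↭-trans (↭-reflexive (sym (++-assoc ys xs zs))) (++⁺ʳ zs (++-comm ys xs))

  -- All vertices enter before time `L`, and each stays for another `2 * R` steps.
  T : ℕ
  T = 2 * R + L

  strip-fresh strip-returning strip-leaving strip-evaluating : ℕ → List V
  strip-fresh      c = from (fresh c) 0 T
  strip-returning  c = from (returning c) 0 T
  strip-leaving    c = from (leaving c) 0 T
  strip-evaluating c = from (evaluating c) 0 T

  filter-empty : ∀ {P : V → Set} (P? : ∀ v → Dec (P v)) → (∀ v → ¬ P v) → filter P? vs ≡ []
  filter-empty P? ¬P = filter-none P? {xs = vs} (All.tabulate λ {v} _ → ¬P v)

  waiting-start : ∀ c → waiting c 0 ≡ []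
  waiting-start c = filter-empty (waiting? c 0) λ v ()

  waiting-end : ∀ c → waiting c (T + 0) ≡ []
  waiting-end c = filter-empty (waiting? c (T + 0)) λ v (_ , _ , T≤) → <⇒≱ (+-monoˡ-< (2 * R) (κ<L v))
    (≤-trans (≤-reflexive (trans (+-comm L (2 * R)) (sym (+-identityʳ T)))) T≤)

  -- Both lists run through the same vertices by increasing κ, the first with a delay of 2R, and
  -- both filter `vs`, which fixes the order among equal κ. The idle times at the start of one and
  -- at the end of the other contribute nothing.
  leaving≡returning : ∀ c → strip-leaving c ≡ strip-returning (suc c)
  leaving≡returning c = begin
    from (leaving c) 0 T                                             ≡⟨ from-+ (leaving c) 0 (2 * R) L ⟩
    from (leaving c) 0 (2 * R) ++ from (leaving c) (2 * R + 0) L     ≡⟨ cong (_++ from (leaving c) (2 * R + 0) L) (from-empty (leaving c) 0 (2 * R) λ j _ j< →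
        filter-empty (leaving? c j) λ v (_ , eq) → <⇒≱ j< (≤-trans (m≤n+m (2 * R) (κ v)) (≤-reflexive eq))) ⟩
    from (leaving c) (2 * R + 0) L                                   ≡⟨ from-cong (leaving c) (returning (suc c)) (2 * R) 0 L shifted ⟩
    from (returning (suc c)) 0 L                                     ≡⟨ ++-identityʳ _ ⟨
    from (returning (suc c)) 0 L ++ []                               ≡⟨ cong (from (returning (suc c)) 0 L ++_) (from-empty (returning (suc c)) (L + 0) (2 * R) λ j L≤j _ →
        filter-empty (returning? (suc c) j) λ v (_ , eq) → <⇒≱ (κ<L v) (≤-trans (≤-reflexive (sym (+-identityʳ L))) (≤-trans L≤j (≤-reflexive (sym eq))))) ⟨
    from (returning (suc c)) 0 L ++ from (returning (suc c)) (L + 0) (2 * R) ≡⟨ from-+ (returning (suc c)) 0 L (2 * R) ⟨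
    from (returning (suc c)) 0 (L + 2 * R)                           ≡⟨ cong (from (returning (suc c)) 0) (+-comm L (2 * R)) ⟩
    from (returning (suc c)) 0 T                                     ∎
    where
    open ≡-Reasoning
    shifted : ∀ j → leaving c (2 * R + j) ≡ returning (suc c) j
    shifted j = filter-≐ (leaving? c (2 * R + j)) (returning? (suc c) j)
      ((λ {v} (g , eq) → g , +-cancelˡ-≡ (2 * R) (κ v) j (trans (+-comm (2 * R) (κ v)) eq)) ,
       (λ {v} (g , eq) → g , trans (+-comm (κ v) (2 * R)) (cong (2 * R +_) eq))) vs

  all-fresh all-evaluating all-leaving : List V
  all-fresh      = from strip-fresh 0 C
  all-evaluating = from strip-evaluating 0 C
  all-leaving    = from strip-leaving 0 C

  buckets-unique : ∀ {Q : ℕ → ℕ → V → Set} (Q? : ∀ c k v → Dec (Q c k v)) →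
    (∀ {c c′ k k′ v} → Q c k v → Q c′ k′ v → c ≡ c′ × k ≡ k′) → ∀ n m →
    Unique (from (λ c → from (λ k → filter (Q? c k) vs) 0 n) 0 m)
  buckets-unique {Q} Q? keys n m = from-unique (λ c → from (bucket c) 0 n) 0 m
    (λ c → from-unique (bucket c) 0 n (λ k → Unique.filter⁺ (Q? c k) (vertices-unique k₁ k₂))
      (λ v∈ v∈′ → proj₂ (keys (in-bucket v∈) (in-bucket v∈′))))
    (λ {c} {c′} v∈ v∈′ →
      let _ , _ , v∈k = ∈-from⁻ (bucket c) 0 n v∈
          _ , _ , v∈k′ = ∈-from⁻ (bucket c′) 0 n v∈′
      in proj₁ (keys (in-bucket v∈k) (in-bucket v∈k′)))
    where
    bucket : ℕ → ℕ → List V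
    bucket c k = filter (Q? c k) vs
    in-bucket : ∀ {c k v} → v ∈ bucket c k → Q c k v
    in-bucket {c} {k} v∈ = proj₂ (∈-filter⁻ (Q? c k) {xs = vs} v∈)

  all-fresh-unique : Unique all-fresh
  all-fresh-unique = buckets-unique fresh? (λ { (refl , refl) (refl , refl) → refl , refl }) T C

  all-fresh-complete : ∀ v → v ∈ all-fresh
  all-fresh-complete v = ∈-from⁺ strip-fresh 0 C z≤n (α<C v) (∈-from⁺ (fresh (α v)) 0 T z≤n
    (≤-trans (κ<L v) (m≤n+m L (2 * R))) (∈-filter⁺ (fresh? (α v) (κ v)) (∈-vertices v) (refl , refl)))

  all-evaluating-unique : Unique all-evaluating
  all-evaluating-unique = buckets-unique evaluating? (λ { (refl , refl) (refl , refl) → refl , refl }) T C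

  all-evaluating-complete : ∀ v → v ∈ all-evaluating
  all-evaluating-complete v = ∈-from⁺ strip-evaluating 0 C z≤n (ε<C v) (∈-from⁺ (evaluating (ε v)) 0 T z≤n
    (≤-trans (+-mono-<-≤ (κ<L v) (m≤m+n R (1 * R))) (≤-reflexive (+-comm L (2 * R))))
    (∈-filter⁺ (evaluating? (ε v) (κ v + R)) (∈-vertices v) (refl , refl)))

  -- Because ω ≤ α + 1, a vertex is passed on at most once, from strip `α v`; the traffic of the
  -- queue is therefore bounded by the number of shared vertices.
  all-leaving-unique : Unique all-leaving
  all-leaving-unique = buckets-unique leaving? (λ { {c} {c′} {v = v} ((α≤c , c<ω) , refl) ((α≤c′ , c′<ω) , refl) →
    trans (at-α {v} α≤c c<ω) (sym (at-α {v} α≤c′ c′<ω)) , refl }) T C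
    where
    at-α : ∀ {v c} → α v < suc c → c < ω v → c ≡ α v
    at-α {v} α≤c c<ω = ≤-antisym (s≤s⁻¹ (≤-trans c<ω (ω≤α+1 v))) (s≤s⁻¹ α≤c)

  shared? : ∀ v → Dec (α v < ω v)
  shared? v = α v <? ω v

  all-leaving⊆ : all-leaving ⊆ filter shared? vs
  all-leaving⊆ {v} v∈ with ∈-from⁻ strip-leaving 0 C v∈
  ... | c , _ , v∈c with ∈-from⁻ (leaving c) 0 T v∈c
  ...   | k , _ , v∈k with ∈-filter⁻ (leaving? c k) {xs = vs} v∈k
  ...     | v∈vs , (α≤c , c<ω) , _ = ∈-filter⁺ shared? v∈vs (≤-trans α≤c c<ω)

  module _ (fits : ∀ c k → length (window c k) + 4 * B ≤ M)
    (reach : ∀ {v w} → dist₁ w v ≤ s → (α w ≤ ε v × ε v ≤ ω w) × κ w ≤ κ v + R × κ v ≤ κ w + R)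
    {ext₀ : External} {n₀ : ℕ} where

    private Mach = Machine ext₀ n₀

    -- `waiting` is what stays in memory between two time steps. The number of input elements
    -- outside the buffers peaks when the window is complete, between loading and unloading, so a
    -- bound on the windows bounds the memory throughout.
    step : ∀ c k {F G D P} → Mach (fresh c k ++ F) (returning c k ++ G) (waiting c k) D P →
      Mach F (G ++ leaving c k) (waiting c (suc k)) (evaluating c k ++ D) (leaving c k ++ P)
    step c k m = discards (finished c k) (pushGs (leaving c k) (permute (exiting c k)
      (evaluates (evaluating c k) (fits c k) in-window
        (permute (↭-sym (entering c k)) (popFs (fresh c k) fits₁ (popGs (returning c k) fits₂ m))))))
      where
      fits₁ : length (fresh c k) + length (returning c k ++ waiting c k) + 4 * B ≤ M
      fits₁ = ≤-trans (≤-reflexive (cong (_+ 4 * B) (sym (trans (↭-length (entering c k)) (length-++ (fresh c k)))))) (fits c k)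
      fits₂ : length (returning c k) + length (waiting c k) + 4 * B ≤ M
      fits₂ = ≤-trans (+-monoˡ-≤ (4 * B) (≤-trans (≤-reflexive (sym (length-++ (returning c k)))) (m≤n+m _ (length (fresh c k))))) fits₁
      in-window : ∀ {v w} → v ∈ evaluating c k → Stencil v (w , input) → w ∈ window c k
      in-window {v} {w} v∈ (within d) with ∈-filter⁻ (evaluating? c k) {xs = vs} v∈ | reach {v} {w} d
      ... | _ , refl , refl | strip , κw≤ , κv≤ = ∈-filter⁺ (window? c k) (∈-vertices w)
              (strip , κw≤ , ≤-trans (+-monoˡ-≤ R κv≤) (≤-reflexive (eq (κ w) R)))
        where
        eq : ∀ a r → a + r + r ≡ a + 2 * r
        eq = solve-∀

    sweep : ∀ c n k {F G D P} → Mach (from (fresh c) k n ++ F) (from (returning c) k n ++ G) (waiting c k) D P →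
      Mach F (G ++ from (leaving c) k n) (waiting c (n + k)) (from (evaluating c) k n ++ D) (from (leaving c) k n ++ P)
    sweep c zero k {G = G} m = subst (λ z → Mach _ z _ _ _) (sym (++-identityʳ G)) m
    sweep c (suc n) k {F} {G} {D} {P} m =
      relabel (append (evaluating c k) (from (evaluating c) (suc k) n) D) (append (leaving c k) (from (leaving c) (suc k) n) P)
        (subst₂ (λ a b → Mach F a (waiting c b) D₂ P₂) (++-assoc G (leaving c k) (from (leaving c) (suc k) n)) (+-suc n k)
          (sweep c n (suc k) (subst (λ z → Mach (from (fresh c) (suc k) n ++ F) z (waiting c (suc k)) D₁ P₁)
            (++-assoc (from (returning c) (suc k) n) G (leaving c k)) (step c k m₀))))
      where
      D₁ P₁ D₂ P₂ : List V
      D₁ = evaluating c k ++ D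
      P₁ = leaving c k ++ P
      D₂ = from (evaluating c) (suc k) n ++ D₁
      P₂ = from (leaving c) (suc k) n ++ P₁
      m₀ : Mach (fresh c k ++ (from (fresh c) (suc k) n ++ F)) (returning c k ++ (from (returning c) (suc k) n ++ G)) (waiting c k) D P
      m₀ = subst₂ (λ a b → Mach a b (waiting c k) D P) (++-assoc (fresh c k) _ F) (++-assoc (returning c k) _ G) m

    strips : ∀ n c {D P} → Mach (from strip-fresh c n) (strip-returning c) [] D P →
      Mach [] (strip-returning (n + c)) [] (from strip-evaluating c n ++ D) (from strip-leaving c n ++ P)
    strips zero    c m = m
    strips (suc n) c {D} {P} m =
      relabel (append (strip-evaluating c) (from strip-evaluating (suc c) n) D) (append (strip-leaving c) (from strip-leaving (suc c) n) P)
        (subst (λ z → Mach [] (strip-returning z) [] (from strip-evaluating (suc c) n ++ D₁) (from strip-leaving (suc c) n ++ P₁)) (+-suc n c)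
          (strips n (suc c) (subst₂ (λ a b → Mach (from strip-fresh (suc c) n) a b D₁ P₁) (leaving≡returning c) (waiting-end c) (sweep c T 0 m₀))))
      where
      D₁ P₁ : List V
      D₁ = strip-evaluating c ++ D
      P₁ = strip-leaving c ++ P
      m₀ : Mach (strip-fresh c ++ from strip-fresh (suc c) n) (strip-returning c ++ []) (waiting c 0) D P
      m₀ = subst₂ (λ a b → Mach (strip-fresh c ++ from strip-fresh (suc c) n) a b D P) (sym (++-identityʳ (strip-returning c))) (sym (waiting-start c)) m

  insert : V → List Block → List Block
  insert v [] = [ v , [] ]
  insert v ((w , ws) ∷ bs) with suc (length ws) <? B
  ... | yes _ = (v , w ∷ ws) ∷ bs
  ... | no  _ = (v , []) ∷ (w , ws) ∷ bs

  chop : List V → List Block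
  chop = foldr insert []

  unblock-chop : ∀ xs → unblock (chop xs) ≡ xs
  unblock-chop [] = refl
  unblock-chop (x ∷ xs) = trans (unblock-insert (chop xs)) (cong (x ∷_) (unblock-chop xs))
    where
    unblock-insert : ∀ bs → unblock (insert x bs) ≡ x ∷ unblock bs
    unblock-insert [] = refl
    unblock-insert ((w , ws) ∷ bs) with suc (length ws) <? B
    ... | yes _ = refl
    ... | no  _ = refl

  -- All blocks but the first are full.
  Chopped : List V → List Block → Set
  Chopped xs []             = ⊤
  Chopped xs ((w , ws) ∷ bs) = suc (length ws) ≤ B × suc (length ws) + B * length bs ≡ length xs × All (λ b → length (cells b) ≤ B) bs

  chop-chopped : ∀ xs → Chopped xs (chop xs)
  chop-chopped [] = tt
  chop-chopped (x ∷ xs) = lemma (chop xs) refl (chop-chopped xs)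
    where
    lemma : ∀ bs → chop xs ≡ bs → Chopped xs bs → Chopped (x ∷ xs) (insert x bs)
    lemma [] eq _ = >-nonZero⁻¹ B , cong suc (trans (*-zeroʳ B) (cong length (trans (cong unblock (sym eq)) (unblock-chop xs)))) , []
    lemma ((w , ws) ∷ bs) _ (w≤ , total , ok) with suc (length ws) <? B
    ... | yes w< = w< , cong suc total , ok
    ... | no ¬w< = >-nonZero⁻¹ B , cong suc (trans (trans (*-suc B (length bs)) (cong (_+ B * length bs) (≤-antisym (≮⇒≥ ¬w<) w≤))) total) , w≤ ∷ ok

  chop-count : ∀ xs → B * length (chop xs) ≤ length xs + B
  chop-count xs = go (chop xs) (chop-chopped xs)
    where
    go : ∀ bs → Chopped xs bs → B * length bs ≤ length xs + B
    go [] _ = ≤-trans (≤-reflexive (*-zeroʳ B)) z≤n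
    go ((w , ws) ∷ bs) (_ , total , _) = begin
      B * suc (length bs)       ≡⟨ *-suc B (length bs) ⟩
      B + B * length bs         ≤⟨ +-monoʳ-≤ B (≤-trans (m≤n+m _ (suc (length ws))) (≤-reflexive total)) ⟩
      B + length xs             ≡⟨ +-comm B _ ⟩
      length xs + B             ∎
      where open ≤-Reasoning

  chop-sizes : ∀ xs → All (λ b → length (cells b) ≤ B) (chop xs)
  chop-sizes xs = sizes (chop xs) (chop-chopped xs)
    where
    sizes : ∀ bs → Chopped xs bs → All (λ b → length (cells b) ≤ B) bs
    sizes [] _ = []
    sizes (b ∷ bs) (b≤ , _ , ok) = b≤ ∷ ok

  load : List Block → ℕ → External
  load []       j = λ _ → []
  load (b ∷ bs) j = setBlock (address inputs j) (I (cells b)) (load bs (suc j))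

  load-Stored : ∀ bs j → All (λ b → length (cells b) ≤ B) bs → Stored inputs j bs (load bs j)
  load-Stored [] j _ = tt
  load-Stored (b ∷ bs) j (b≤ ∷ ok) = (setBlock-here s k₁ k₂ M B (address inputs j) (I (cells b)) (load bs (suc j)) , b≤) ,
    Stored-setBlock (suc j) bs (λ {i} j<i _ eq → <⇒≢ j<i (sym (address-injective inputs i j eq))) (load-Stored bs (suc j) ok)

  load-size : ∀ bs j → All (λ b → length (cells b) ≤ B) bs → ∀ a → length (load bs j a) ≤ B
  load-size [] j _ a = z≤n
  load-size (b ∷ bs) j (b≤ ∷ ok) = setBlock-bounded s k₁ k₂ M B {address inputs j}
    (≤-trans (≤-reflexive (length-map _ (cells b))) b≤) (load-size bs (suc j) ok)

  ∈-load⁻ : ∀ bs j {a x} → x ∈ load bs j a → ∃[ v ] ∃[ i ] v ∈ unblock bs × x ≡ (v , input) × j ≤ i × a ≡ address inputs i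
  ∈-load⁻ (b ∷ bs) j {a} x∈ with a ≟ address inputs j
  ... | yes a≡ = let v , v∈ , x≡ = ∈-map⁻ _ x∈ in v , j , ∈-++⁺ˡ v∈ , x≡ , ≤-refl , a≡
  ... | no _ = let v , i , v∈ , x≡ , j<i , a≡ = ∈-load⁻ bs (suc j) x∈ in v , i , ∈-++⁺ʳ (cells b) v∈ , x≡ , <⇒≤ j<i , a≡

  ∈-load⁺ : ∀ bs j {v} → v ∈ unblock bs → ∃[ a ] (v , input) ∈ load bs j a
  ∈-load⁺ (b ∷ bs) j {v} v∈ with ∈-++⁻ (cells b) v∈
  ... | inj₁ v∈b = address inputs j , subst ((v , input) ∈_) (sym (setBlock-here s k₁ k₂ M B (address inputs j) (I (cells b)) (load bs (suc j)))) (∈-map⁺ _ v∈b)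
  ... | inj₂ v∈bs = let a , v∈a = ∈-load⁺ bs (suc j) v∈bs
                        _ , i , _ , _ , j<i , a≡ = ∈-load⁻ bs (suc j) v∈a
    in a , subst ((v , input) ∈_) (sym (setBlock-other s k₁ k₂ M B (I (cells b)) (load bs (suc j))
             (λ a≡′ → <⇒≢ j<i (sym (address-injective inputs i j (trans (sym a≡) a≡′)))))) v∈a

  load-unique : ∀ bs j → Unique (unblock bs) → ∀ a → Unique (load bs j a)
  load-unique [] j _ a = []
  load-unique (b ∷ bs) j u a with a ≟ address inputs j
  ... | yes _ = Unique.map⁺ (λ where refl → refl) (unique-++⁻ˡ u)
  ... | no _  = load-unique bs (suc j) (unique-++⁻ʳ (cells b) u) a

  load-head-tail : ∀ b bs j → Unique (unblock (b ∷ bs)) → ∀ {x a} → x ∈ I (cells b) → x ∉ load bs (suc j) a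
  load-head-tail b bs j u x∈b x∈bs with ∈-map⁻ _ x∈b | ∈-load⁻ bs (suc j) x∈bs
  ... | v , v∈b , refl | _ , _ , v∈bs , refl , _ = unique-++⇒∉ (cells b) u v∈b v∈bs

  load-once : ∀ bs j → Unique (unblock bs) → ∀ {x a a′} → x ∈ load bs j a → x ∈ load bs j a′ → a ≡ a′
  load-once (b ∷ bs) j u {x} {a} {a′} x∈ x∈′ with a ≟ address inputs j | a′ ≟ address inputs j
  ... | yes a≡ | yes a′≡ = trans a≡ (sym a′≡)
  ... | no _   | no _    = load-once bs (suc j) (unique-++⁻ʳ (cells b) u) x∈ x∈′
  ... | yes _  | no _    = ⊥-elim (load-head-tail b bs j u x∈ x∈′)
  ... | no _   | yes _   = ⊥-elim (load-head-tail b bs j u x∈′ x∈)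

  -- The input layout follows the order in which the sweep first needs the elements, so the input
  -- stream is read sequentially.
  blocks : List Block
  blocks = chop all-fresh

  blocks-unique : Unique (unblock blocks)
  blocks-unique = subst Unique (sym (unblock-chop all-fresh)) all-fresh-unique

  layout : InputLayout (load blocks 0)
  layout = record
    { blockSize = load-size blocks 0 (chop-sizes all-fresh)
    ; inputOnly = λ x∈ → let _ , _ , _ , x≡ , _ = ∈-load⁻ blocks 0 x∈ in cong proj₂ x≡
    ; complete  = λ v → ∈-load⁺ blocks 0 (subst (v ∈_) (sym (unblock-chop all-fresh)) (all-fresh-complete v))
    ; onceBlock = load-unique blocks 0 blocks-unique
    ; oneBlock  = load-once blocks 0 blocks-unique }

  ready : Machine (load blocks 0) (length blocks) all-fresh (strip-returning 0) [] [] []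
  ready = record
    { run = [] ; f = [] ; g = [] ; h = [] ; o = [] ; fs = blocks ; gs = [] ; cf = 0 ; cg = 0 ; co = 0
    ; internal = ↭-refl ; f≤ = z≤n ; g≤ = z≤n ; h≤ = z≤n ; o≤ = z≤n
    ; fs-stored = load-Stored blocks 0 (chop-sizes all-fresh) ; gs-stored = tt
    ; F≡ = sym (unblock-chop all-fresh)
    ; G≡ = from-empty (returning 0) 0 T (λ k _ _ → filter-empty (returning? 0 k) λ v ())
    ; evaluated = λ ()
    ; cost = ≤-reflexive (eq B (length blocks)) }
    where
    eq : ∀ b n → b * 0 + (b * n + b * 0 + 0 + 0) ≡ b * n + 0 + 0
    eq = solve-∀

  -- Reading inputs and writing outputs accounts for `2 * (k₁ * k₂)`, and a shared vertex costs two
  -- more units. The term `2 * B` pays for one partial input block and for the final flush.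
  schedule : (∀ c k → length (window c k) + 4 * B ≤ M) →
    (∀ {v w} → dist₁ w v ≤ s → (α w ≤ ε v × ε v ≤ ω w) × κ w ≤ κ v + R × κ v ≤ κ w + R) →
    ∃[ i ] ComputableWith s k₁ k₂ M B i × i * B ≤ 2 * (k₁ * k₂) + 2 * length (filter shared? vs) + 2 * B
  schedule fits reach =
    let n = length blocks
        m = strips fits reach C 0 ready
        m′ , o≡ = flushO m (suc n) (≤-trans (≤-reflexive (sym (*-suc B n))) (m≤n+m _ (length (o m))))
    in ios m′ , (_ , _ , layout , run m′ , all-written m′ o≡) , bound m′
    where
    D P : List V
    D = all-evaluating ++ []
    P = all-leaving ++ []
    all-written : ∀ {n₁ G} (m′ : Machine (load blocks 0) n₁ [] G [] D P) → o m′ ≡ [] → AllOutputsWritten (ext m′)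
    all-written m′ o≡ v with evaluated m′ (∈-++⁺ˡ {ys = []} (all-evaluating-complete v))
    ... | inj₁ v∈o = ⊥-elim (case (subst (v ∈_) o≡ v∈o))
      where
      case : v ∉ []
      case ()
    ... | inj₂ (j , _ , v∈) = address outputs j , v∈
    D≤ : length D ≤ k₁ * k₂
    D≤ = ≤-trans (≤-reflexive (cong length (++-identityʳ all-evaluating))) (≤-trans
      (unique-⊆⇒length≤ all-evaluating-unique λ _ → ∈-vertices _) (≤-reflexive (length-vertices k₁ k₂)))
    P≤ : length P ≤ length (filter shared? vs)
    P≤ = ≤-trans (≤-reflexive (cong length (++-identityʳ all-leaving))) (unique-⊆⇒length≤ all-leaving-unique all-leaving⊆)
    blocks≤ : B * length blocks ≤ k₁ * k₂ + B
    blocks≤ = ≤-trans (chop-count all-fresh) (+-monoˡ-≤ B (≤-trans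
      (unique-⊆⇒length≤ all-fresh-unique λ _ → ∈-vertices _) (≤-reflexive (length-vertices k₁ k₂))))
    bound : ∀ {G} (m′ : Machine (load blocks 0) (suc (length blocks)) [] G [] D P) →
      ios m′ * B ≤ 2 * (k₁ * k₂) + 2 * length (filter shared? vs) + 2 * B
    bound m′ = begin
      ios m′ * B                                               ≡⟨ *-comm (ios m′) B ⟩
      B * ios m′                                               ≤⟨ m≤m+n _ _ ⟩
      B * ios m′ + _                                           ≤⟨ cost m′ ⟩
      B * suc (length blocks) + 2 * length P + length D        ≤⟨ +-mono-≤ (+-mono-≤ (≤-trans (≤-reflexive (*-suc B _)) (+-monoʳ-≤ B blocks≤)) (*-monoʳ-≤ 2 P≤)) D≤ ⟩
      B + (k₁ * k₂ + B) + 2 * length (filter shared? vs) + k₁ * k₂ ≡⟨ eq B (k₁ * k₂) (length (filter shared? vs)) ⟩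
      2 * (k₁ * k₂) + 2 * length (filter shared? vs) + 2 * B   ∎
      where
      open ≤-Reasoning
      eq : ∀ b n p → b + (n + b) + 2 * p + n ≡ 2 * n + 2 * p + 2 * b
      eq = solve-∀

-- Upper bound: diagonal strips

map-unique : ∀ {A B : Set} {f : A → B} {xs} → (∀ {x y} → x ∈ xs → y ∈ xs → f x ≡ f y → x ≡ y) → Unique xs → Unique (map f xs)
map-unique {xs = []} _ _ = []
map-unique {f = f} {xs = x ∷ xs} inj u@(_ ∷ u′) = ¬Any⇒All¬ _ fx∉ ∷ map-unique (λ x∈ y∈ → inj (there x∈) (there y∈)) u′
  where
  fx∉ : f x ∉ map f xs
  fx∉ fx∈ with ∈-map⁻ f fx∈
  ... | y , y∈ , eq = Unique.Unique[x∷xs]⇒x∉xs u (subst (_∈ xs) (sym (inj (here refl) (there y∈) eq)) y∈)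

m*n≤o⇒m≤o/n : ∀ {m n o} .{{_ : NonZero n}} → m * n ≤ o → m ≤ o / n
m*n≤o⇒m≤o/n {m} {n} le = ≤-trans (≤-reflexive (sym (m*n/n≡m m n))) (/-monoˡ-≤ n le)

m<[1+m/n]*n : ∀ m n .{{_ : NonZero n}} → m < suc (m / n) * n
m<[1+m/n]*n m n = ≤-<-trans (≤-reflexive (m≡m%n+[m/n]*n m n)) (+-monoˡ-< (m / n * n) (m%n<n m n))

[m+n]/o≤1+m/o+n/o : ∀ m n o .{{_ : NonZero o}} → (m + n) / o ≤ suc (m / o + n / o)
[m+n]/o≤1+m/o+n/o m n o = s≤s⁻¹ (m<n*o⇒m/o<n (begin-strict
  m + n                                     <⟨ +-mono-< (m<[1+m/n]*n m o) (m<[1+m/n]*n n o) ⟩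
  suc (m / o) * o + suc (n / o) * o         ≡⟨ eq (m / o) (n / o) o ⟩
  suc (suc (m / o + n / o)) * o             ∎))
  where
  open ≤-Reasoning
  eq : ∀ a b o → suc a * o + suc b * o ≡ suc (suc (a + b)) * o
  eq = solve-∀

-- Diagonal strips of width W: a vertex belongs to the strips meeting [x + y , x + y + 2s] and is evaluated in the
-- strip of x + y + s.  Within a strip, which spans W + 2s = 2h′ + 1 diagonals, κ orders the vertices along the
-- strip and is injective, and stencils have κ-radius at most (1 + h′) s.
module Diagonal (s k₁ k₂ M B W h′ : ℕ) .{{_ : NonZero B}} .{{_ : NonZero W}}
  (W+2s : W + 2 * s ≡ suc (2 * h′)) (2s≤W : 2 * s ≤ W) where

  open Grid s k₁ k₂

  z α ω ε κ : V → ℕ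
  z (x , y) = toℕ x + toℕ y
  α v = z v / W
  ω v = (z v + 2 * s) / W
  ε v = (z v + s) / W
  κ (x , y) = suc h′ * toℕ x + h′ * (k₂ ∸ toℕ y)

  R L C : ℕ
  R = suc h′ * s
  L = suc (suc h′ * k₁ + h′ * k₂)
  C = suc (k₁ + k₂ + s)

  α≤ω : ∀ v → α v ≤ ω v
  α≤ω v = /-monoˡ-≤ W (m≤m+n (z v) (2 * s))

  ω≤α+1 : ∀ v → ω v ≤ suc (α v)
  ω≤α+1 v = s≤s⁻¹ (m<n*o⇒m/o<n (begin-strict
    z v + 2 * s              <⟨ +-mono-<-≤ (m<[1+m/n]*n (z v) W) 2s≤W ⟩
    suc (α v) * W + W        ≡⟨ +-comm (suc (α v) * W) W ⟩
    suc (suc (α v)) * W      ∎))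
    where open ≤-Reasoning

  z≤ : ∀ v → z v ≤ k₁ + k₂
  z≤ (x , y) = +-mono-≤ (<⇒≤ (toℕ<n x)) (<⇒≤ (toℕ<n y))

  ε<C : ∀ v → ε v < C
  ε<C v = s≤s (≤-trans (m/n≤m (z v + s) W) (+-monoˡ-≤ s (z≤ v)))

  α<C : ∀ v → α v < C
  α<C v = s≤s (≤-trans (m/n≤m (z v) W) (≤-trans (z≤ v) (m≤m+n (k₁ + k₂) s)))

  κ<L : ∀ v → κ v < L
  κ<L (x , y) = s≤s (+-mono-≤ (*-monoʳ-≤ (suc h′) (<⇒≤ (toℕ<n x))) (*-monoʳ-≤ h′ (m∸n≤m k₂ (toℕ y))))

  open Schedule s k₁ k₂ M B α ω ε κ R L C α≤ω ω≤α+1 ε<C α<C κ<L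

  dist-sym : ∀ v w → dist₁ v w ≡ dist₁ w v
  dist-sym (x , y) (x′ , y′) = cong₂ _+_ (∣-∣-comm (toℕ x) (toℕ x′)) (∣-∣-comm (toℕ y) (toℕ y′))

  z-near : ∀ {v w} → dist₁ w v ≤ s → z w ≤ z v + s
  z-near {x , y} {x′ , y′} d = begin
    toℕ x′ + toℕ y′                                                          ≤⟨ +-mono-≤ (m≤n+∣m-n∣ (toℕ x′) (toℕ x)) (m≤n+∣m-n∣ (toℕ y′) (toℕ y)) ⟩
    toℕ x + ∣ toℕ x′ - toℕ x ∣ + (toℕ y + ∣ toℕ y′ - toℕ y ∣)                ≡⟨ eq (toℕ x) _ (toℕ y) _ ⟩
    toℕ x + toℕ y + dist₁ (x′ , y′) (x , y)                                  ≤⟨ +-monoʳ-≤ (toℕ x + toℕ y) d ⟩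
    toℕ x + toℕ y + s                                                        ∎
    where
    open ≤-Reasoning
    eq : ∀ a b c d → a + b + (c + d) ≡ a + c + (b + d)
    eq = solve-∀

  -- A unit step along the first axis changes κ by h′ + 1 and one along the second by h′; the larger
  -- weight bounds both.
  κ-near : ∀ {v w} → dist₁ w v ≤ s → κ w ≤ κ v + R
  κ-near {x , y} {x′ , y′} d = begin
    suc h′ * toℕ x′ + h′ * (k₂ ∸ toℕ y′)
      ≤⟨ +-mono-≤ (*-monoʳ-≤ (suc h′) (m≤n+∣m-n∣ (toℕ x′) (toℕ x))) (*-monoʳ-≤ h′ flip) ⟩
    suc h′ * (toℕ x + a) + h′ * (k₂ ∸ toℕ y + b)
      ≤⟨ m≤m+n _ b ⟩
    suc h′ * (toℕ x + a) + h′ * (k₂ ∸ toℕ y + b) + b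
      ≡⟨ eq h′ (toℕ x) a (k₂ ∸ toℕ y) b ⟩
    suc h′ * toℕ x + h′ * (k₂ ∸ toℕ y) + suc h′ * (a + b)
      ≤⟨ +-monoʳ-≤ (κ (x , y)) (*-monoʳ-≤ (suc h′) d) ⟩
    suc h′ * toℕ x + h′ * (k₂ ∸ toℕ y) + suc h′ * s ∎
    where
    open ≤-Reasoning
    a b : ℕ
    a = ∣ toℕ x′ - toℕ x ∣
    b = ∣ toℕ y′ - toℕ y ∣
    flip : k₂ ∸ toℕ y′ ≤ k₂ ∸ toℕ y + b
    flip = m≤n+o⇒m∸n≤o k₂ (toℕ y′) (begin
      k₂                              ≤⟨ m≤n+m∸n k₂ (toℕ y) ⟩
      toℕ y + (k₂ ∸ toℕ y)            ≤⟨ +-monoˡ-≤ (k₂ ∸ toℕ y) (m≤n+∣n-m∣ (toℕ y) (toℕ y′)) ⟩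
      toℕ y′ + b + (k₂ ∸ toℕ y)       ≡⟨ eq′ (toℕ y′) b (k₂ ∸ toℕ y) ⟩
      toℕ y′ + (k₂ ∸ toℕ y + b)       ∎)
      where
      eq′ : ∀ a b c → a + b + c ≡ a + (c + b)
      eq′ = solve-∀
    eq : ∀ h x a c b → suc h * (x + a) + h * (c + b) + b ≡ suc h * x + h * c + suc h * (a + b)
    eq = solve-∀

  -- Coordinate sums change by at most `s` within a stencil, so z v + s lies between z w and z w +
  -- 2s. This is why evaluation is assigned by z v + s.
  reach : ∀ {v w} → dist₁ w v ≤ s → (α w ≤ ε v × ε v ≤ ω w) × κ w ≤ κ v + R × κ v ≤ κ w + R
  reach {v} {w} d = (/-monoˡ-≤ W (z-near {v} {w} d) , /-monoˡ-≤ W ε≤) , κ-near {v} {w} d , κ-near {w} {v} d′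
    where
    d′ : dist₁ v w ≤ s
    d′ = ≤-trans (≤-reflexive (dist-sym v w)) d
    ε≤ : z v + s ≤ z w + 2 * s
    ε≤ = ≤-trans (+-monoˡ-≤ s (z-near {w} {v} d′)) (≤-reflexive (eq (z w) s))
      where
      eq : ∀ a s → a + s + s ≡ a + 2 * s
      eq = solve-∀

  -- Strip `c` consists of the diagonals with cW - 2s ≤ z < (c + 1)W.
  strip-span : ∀ {c v w} → Strip c v → Strip c w → z w < z v + suc (2 * h′)
  strip-span {c} {v} {w} (_ , c≤ω) (α≤c , _) = begin-strict
    z w                    <⟨ m<[1+m/n]*n (z w) W ⟩
    suc (α w) * W          ≤⟨ *-monoˡ-≤ W (s≤s α≤c) ⟩
    W + c * W              ≤⟨ +-monoʳ-≤ W (≤-trans (*-monoˡ-≤ W c≤ω) (m/n*n≤m (z v + 2 * s) W)) ⟩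
    W + (z v + 2 * s)      ≡⟨ eq W (z v) (2 * s) ⟩
    z v + (W + 2 * s)      ≡⟨ cong (z v +_) W+2s ⟩
    z v + suc (2 * h′)     ∎
    where
    open ≤-Reasoning
    eq : ∀ a b c → a + (b + c) ≡ b + (a + c)
    eq = solve-∀

  -- κ-equal vertices differ by a multiple q of (h′ , h′ + 1), which crosses 2h′ + 1 diagonals.
  κ-injective-≤ : ∀ {c v w} → Strip c v → Strip c w → toℕ (proj₂ v) ≤ toℕ (proj₂ w) → κ v ≡ κ w → v ≡ w
  κ-injective-≤ {c} {v@(x , y)} {w@(x′ , y′)} sv sw y≤y′ κ≡ = cong₂ _,_ (toℕ-injective x≡) (toℕ-injective y≡)
    where
    e c′ : ℕ
    e  = toℕ y′ ∸ toℕ y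
    c′ = k₂ ∸ toℕ y′
    y+e : toℕ y + e ≡ toℕ y′
    y+e = m+[n∸m]≡n y≤y′
    flip : k₂ ∸ toℕ y ≡ e + c′
    flip = +-cancelˡ-≡ (toℕ y) _ _ (trans (m+[n∸m]≡n (<⇒≤ (toℕ<n y))) (sym (trans (sym (+-assoc (toℕ y) e c′))
      (trans (cong (_+ c′) y+e) (m+[n∸m]≡n (<⇒≤ (toℕ<n y′)))))))
    balance : suc h′ * toℕ x + h′ * e ≡ suc h′ * toℕ x′
    balance = +-cancelʳ-≡ (h′ * c′) _ _ (trans (trans (eq (suc h′ * toℕ x) h′ e c′) (cong (λ t → suc h′ * toℕ x + h′ * t) (sym flip))) κ≡)
      where
      eq : ∀ a h e c → a + h * e + h * c ≡ a + h * (e + c)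
      eq = solve-∀
    x≤x′ : toℕ x ≤ toℕ x′
    x≤x′ = *-cancelˡ-≤ (suc h′) (≤-trans (m≤m+n _ (h′ * e)) (≤-reflexive balance))
    d : ℕ
    d = toℕ x′ ∸ toℕ x
    x+d : toℕ x + d ≡ toℕ x′
    x+d = m+[n∸m]≡n x≤x′
    h′e : h′ * e ≡ suc h′ * d
    h′e = +-cancelˡ-≡ (suc h′ * toℕ x) _ _ (trans balance (trans (cong (suc h′ *_) (sym x+d)) (*-distribˡ-+ (suc h′) (toℕ x) d)))
    -- The weights h′ and h′ + 1 are coprime: subtracting h′d from both sides leaves h′(e - d) = d.
    multiple : ∀ e → h′ * e ≡ suc h′ * d → ∃[ q ] e ≡ d + q × h′ * q ≡ d
    multiple e h′e≡ with d ≤? e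
    ... | yes d≤e = e ∸ d , sym (m+[n∸m]≡n d≤e) , +-cancelˡ-≡ (h′ * d) _ _
            (trans (sym (*-distribˡ-+ h′ d (e ∸ d))) (trans (cong (h′ *_) (m+[n∸m]≡n d≤e)) (trans h′e≡ (+-comm d (h′ * d)))))
    ... | no d≰e = ⊥-elim (<⇒≢ (≤-<-trans (*-monoʳ-≤ h′ (<⇒≤ (≰⇒> d≰e))) (m<n+m (h′ * d) (≤-<-trans z≤n (≰⇒> d≰e)))) h′e≡)
    no-crossing : ∀ q → e ≡ d + q → h′ * q ≡ d → e ≡ 0 × d ≡ 0
    no-crossing zero e≡ h′q = trans e≡ (trans (+-identityʳ d) d≡0) , d≡0
      where
      d≡0 : d ≡ 0
      d≡0 = trans (sym h′q) (*-zeroʳ h′)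
    no-crossing (suc q) e≡ h′q = ⊥-elim (<⇒≱ (strip-span {v = v} {w} sv sw) (begin
      toℕ x + toℕ y + suc (2 * h′)              ≤⟨ m≤m+n _ (2 * (h′ * q) + q) ⟩
      toℕ x + toℕ y + suc (2 * h′) + (2 * (h′ * q) + q) ≡⟨ eq (toℕ x) (toℕ y) h′ q ⟩
      toℕ x + h′ * suc q + (toℕ y + (h′ * suc q + suc q)) ≡⟨ cong (λ t → toℕ x + t + (toℕ y + (t + suc q))) h′q ⟩
      toℕ x + d + (toℕ y + (d + suc q))         ≡⟨ cong₂ (λ a b → a + (toℕ y + b)) x+d (sym e≡) ⟩
      toℕ x′ + (toℕ y + e)                      ≡⟨ cong (toℕ x′ +_) y+e ⟩
      toℕ x′ + toℕ y′                           ∎))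
      where
      open ≤-Reasoning
      eq : ∀ x y h q → x + y + suc (2 * h) + (2 * (h * q) + q) ≡ x + h * suc q + (y + (h * suc q + suc q))
      eq = solve-∀
    zeros : e ≡ 0 × d ≡ 0
    zeros = let q , e≡ , h′q = multiple e h′e in no-crossing q e≡ h′q
    x≡ : toℕ x ≡ toℕ x′
    x≡ = trans (sym (+-identityʳ _)) (trans (cong (toℕ x +_) (sym (proj₂ zeros))) x+d)
    y≡ : toℕ y ≡ toℕ y′
    y≡ = trans (sym (+-identityʳ _)) (trans (cong (toℕ y +_) (sym (proj₁ zeros))) y+e)

  κ-injective : ∀ {c v w} → Strip c v → Strip c w → κ v ≡ κ w → v ≡ w
  κ-injective {v = v} {w} sv sw κ≡ with ≤-total (toℕ (proj₂ v)) (toℕ (proj₂ w))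
  ... | inj₁ le = κ-injective-≤ {v = v} {w} sv sw le κ≡
  ... | inj₂ ge = sym (κ-injective-≤ {v = w} {v} sw sv ge (sym κ≡))

  -- κ is injective on the strip, so the window is no larger than the set of values that κ can take
  -- on it. Adding 2R to κ avoids the subtraction k - 2R, since `k` may be small.
  window-length : ∀ c k → length (window c k) ≤ suc (2 * R)
  window-length c k = begin
    length (window c k)                              ≡⟨ length-map (λ v → κ v + 2 * R) (window c k) ⟨
    length (map (λ v → κ v + 2 * R) (window c k))    ≤⟨ unique-⊆⇒length≤ (map-unique inj (Unique.filter⁺ (window? c k) (vertices-unique k₁ k₂))) sub ⟩
    length (map (k +_) (upTo (suc (2 * R))))         ≡⟨ length-map (k +_) (upTo (suc (2 * R))) ⟩
    length (upTo (suc (2 * R)))                      ≡⟨ length-upTo (suc (2 * R)) ⟩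
    suc (2 * R)                                      ∎
    where
    open ≤-Reasoning
    in-window : ∀ {v} → v ∈ window c k → Strip c v × (κ v ≤ k × k ≤ κ v + 2 * R)
    in-window v∈ = proj₂ (∈-filter⁻ (window? c k) {xs = vs} v∈)
    inj : ∀ {v w} → v ∈ window c k → w ∈ window c k → κ v + 2 * R ≡ κ w + 2 * R → v ≡ w
    inj {v} {w} v∈ w∈ eq = κ-injective {v = v} {w} (proj₁ (in-window v∈)) (proj₁ (in-window w∈)) (+-cancelʳ-≡ (2 * R) _ _ eq)
    sub : map (λ v → κ v + 2 * R) (window c k) ⊆ map (k +_) (upTo (suc (2 * R)))
    sub x∈ with ∈-map⁻ _ x∈
    ... | v , v∈ , refl with in-window v∈
    ...   | _ , κ≤k , k≤ = subst (_∈ map (k +_) (upTo (suc (2 * R)))) (m+[n∸m]≡n k≤)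
            (∈-map⁺ (k +_) (∈-upTo⁺ (s≤s (m≤n+o⇒m∸n≤o (κ v + 2 * R) k (+-monoˡ-≤ (2 * R) κ≤k)))))

  -- A shared vertex is determined by y, by its strip counted from the first strip of its row, and by the residue.
  shared-length : length (filter shared? vs) ≤ k₂ * ((2 + k₁ / W) * (2 * s))
  shared-length = begin
    length (filter shared? vs)                ≡⟨ length-map code (filter shared? vs) ⟨
    length (map code (filter shared? vs))     ≤⟨ unique-⊆⇒length≤ (Unique.map⁺ code-injective (Unique.filter⁺ shared? (vertices-unique k₁ k₂))) sub ⟩
    length codes                              ≡⟨ trans (length-cartesianProduct (allFin k₂) _) (cong₂ _*_ (length-tabulate {n = k₂} (λ i → i))
                                                   (trans (length-cartesianProduct (upTo (2 + k₁ / W)) (upTo (2 * s))) (cong₂ _*_ (length-upTo (2 + k₁ / W)) (length-upTo (2 * s))))) ⟩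
    k₂ * ((2 + k₁ / W) * (2 * s))             ∎
    where
    open ≤-Reasoning
    codes : List (Fin k₂ × ℕ × ℕ)
    codes = cartesianProduct (allFin k₂) (cartesianProduct (upTo (2 + k₁ / W)) (upTo (2 * s)))
    base : Fin k₂ → ℕ
    base y = (toℕ y + 2 * s) / W
    code : V → Fin k₂ × ℕ × ℕ
    code v@(x , y) = y , ω v ∸ base y , (z v + 2 * s) % W
    base≤ω : ∀ x y → base y ≤ ω (x , y)
    base≤ω x y = /-monoˡ-≤ W (+-monoˡ-≤ (2 * s) (m≤n+m (toℕ y) (toℕ x)))
    code-injective : ∀ {v w} → code v ≡ code w → v ≡ w
    code-injective {x , y} {x′ , y′} eq with cong proj₁ eq
    ... | refl = cong (_, y) (toℕ-injective (+-cancelʳ-≡ (toℕ y) _ _ (+-cancelʳ-≡ (2 * s) _ _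
          (trans (m≡m%n+[m/n]*n _ W) (trans (cong₂ (λ r q → r + q * W) (cong (proj₂ ∘ proj₂) eq)
            (∸-cancelʳ-≡ (base≤ω x y) (base≤ω x′ y) (cong (proj₁ ∘ proj₂) eq))) (sym (m≡m%n+[m/n]*n _ W)))))))
    strip<  : ∀ x y → ω (x , y) ∸ base y < 2 + k₁ / W
    strip< x y = s≤s (m≤n+o⇒m∸n≤o (ω (x , y)) (base y) (begin
      ω (x , y)                              ≡⟨ cong (_/ W) (+-assoc (toℕ x) (toℕ y) (2 * s)) ⟩
      (toℕ x + (toℕ y + 2 * s)) / W          ≤⟨ [m+n]/o≤1+m/o+n/o (toℕ x) (toℕ y + 2 * s) W ⟩
      suc (toℕ x / W + base y)               ≤⟨ s≤s (+-monoˡ-≤ (base y) (/-monoˡ-≤ W (<⇒≤ (toℕ<n x)))) ⟩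
      suc (k₁ / W + base y)                  ≡⟨ +-comm (suc (k₁ / W)) (base y) ⟩
      base y + suc (k₁ / W)                  ∎))
    -- If the residue were at least 2s, subtracting 2s would not pass below a multiple of `W`, and
    -- the first and last strips would coincide.
    residue< : ∀ v → α v < ω v → (z v + 2 * s) % W < 2 * s
    residue< v α<ω with (z v + 2 * s) % W <? 2 * s
    ... | yes r< = r<
    ... | no ¬r< = ⊥-elim (<⇒≱ α<ω (m*n≤o⇒m≤o/n (+-cancelʳ-≤ (2 * s) _ _ (begin
      ω v * W + 2 * s                        ≤⟨ +-monoʳ-≤ (ω v * W) (≮⇒≥ ¬r<) ⟩
      ω v * W + (z v + 2 * s) % W            ≡⟨ +-comm (ω v * W) _ ⟩
      (z v + 2 * s) % W + ω v * W            ≡⟨ m≡m%n+[m/n]*n (z v + 2 * s) W ⟨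
      z v + 2 * s                            ∎))))
    sub : map code (filter shared? vs) ⊆ codes
    sub c∈ with ∈-map⁻ code c∈
    ... | v@(x , y) , v∈ , refl = ∈-cartesianProduct⁺ (∈-allFin y) (∈-cartesianProduct⁺ (∈-upTo⁺ (strip< x y))
            (∈-upTo⁺ (residue< v (proj₂ (∈-filter⁻ shared? {xs = vs} v∈)))))

  io-upper-bound : 2 * (suc h′ * s) + 1 + 4 * B ≤ M →
    ∃[ i ] ComputableWith s k₁ k₂ M B i × i * B ≤ 2 * (k₁ * k₂) + 2 * (k₂ * ((2 + k₁ / W) * (2 * s))) + 2 * B
  io-upper-bound memory =
    let i , computable , bound = schedule (λ c k → ≤-trans (+-monoˡ-≤ (4 * B) (≤-trans (window-length c k) (≤-reflexive (+-comm 1 _)))) memory) (λ {v} {w} → reach {v} {w})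
    in i , computable , ≤-trans bound (+-monoˡ-≤ (2 * B) (+-monoʳ-≤ (2 * (k₁ * k₂)) (*-monoʳ-≤ 2 shared-length)))

-- Asymptotics

_/ᵘ_ : (a b : ℕ) .{{_ : NonZero b}} → ℚᵘ
a /ᵘ suc b = mkℚᵘ (ℤ.+ a) b

-- `÷` reduces fractions by their gcd; identities are therefore checked on unnormalised rationals,
-- where equality is cross-multiplication.
toℚᵘ-÷ : ∀ a b .{{_ : NonZero b}} → toℚᵘ (a ÷ b) ℚᵘ.≃ a /ᵘ b
toℚᵘ-÷ a (suc b) = ℚ.toℚᵘ-fromℚᵘ (mkℚᵘ (ℤ.+ a) b)

⟨_⟩ : ℕ → ℚ
⟨ n ⟩ = n ÷ 1

⟨⟩-+ : ∀ m n → ⟨ m ⟩ ℚ.+ ⟨ n ⟩ ≡ ⟨ m + n ⟩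
⟨⟩-+ m n = ℚ.toℚᵘ-injective (ℚᵘ.≃-trans (ℚ.toℚᵘ-homo-+ ⟨ m ⟩ ⟨ n ⟩) (ℚᵘ.≃-trans (ℚᵘ.+-cong (toℚᵘ-÷ m 1) (toℚᵘ-÷ n 1))
  (ℚᵘ.≃-trans (*≡* (cong (ℤ._* ℤ.+ 1) (cong₂ ℤ._+_ (ℤ.*-identityʳ (ℤ.+ m)) (ℤ.*-identityʳ (ℤ.+ n))))) (ℚᵘ.≃-sym (toℚᵘ-÷ (m + n) 1)))))

÷-* : ∀ a b c .{{_ : NonZero b}} → (a ÷ b) ℚ.* ⟨ c ⟩ ≡ (a * c) ÷ b
÷-* a (suc b) c = ℚ.toℚᵘ-injective (ℚᵘ.≃-trans (ℚ.toℚᵘ-homo-* (a ÷ suc b) ⟨ c ⟩) (ℚᵘ.≃-trans (ℚᵘ.*-cong (toℚᵘ-÷ a (suc b)) (toℚᵘ-÷ c 1))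
  (ℚᵘ.≃-trans (*≡* (cong₂ ℤ._*_ (sym (ℤ.pos-* a c)) (cong ℤ.+_ (sym (*-identityʳ (suc b)))))) (ℚᵘ.≃-sym (toℚᵘ-÷ (a * c) (suc b))))))

⟨⟩-* : ∀ m n → ⟨ m ⟩ ℚ.* ⟨ n ⟩ ≡ ⟨ m * n ⟩
⟨⟩-* m n = ÷-* m 1 n

÷-cancel : ∀ a b .{{_ : NonZero b}} → (a ÷ b) ℚ.* ⟨ b ⟩ ≡ ⟨ a ⟩
÷-cancel a b@(suc b′) = trans (÷-* a b b) (ℚ.toℚᵘ-injective (ℚᵘ.≃-trans (toℚᵘ-÷ (a * b) b)
  (ℚᵘ.≃-trans (*≡* (trans (ℤ.*-identityʳ (ℤ.+ (a * b))) (ℤ.pos-* a b))) (ℚᵘ.≃-sym (toℚᵘ-÷ a 1)))))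

⟨⟩-mono-≤ : ∀ {m n} → m ≤ n → ⟨ m ⟩ ℚ.≤ ⟨ n ⟩
⟨⟩-mono-≤ {m} {n} m≤n = ℚ.toℚᵘ-cancel-≤ (ℚᵘ.≤-respʳ-≃ (ℚᵘ.≃-sym (toℚᵘ-÷ n 1)) (ℚᵘ.≤-respˡ-≃ (ℚᵘ.≃-sym (toℚᵘ-÷ m 1))
  (*≤* (subst₂ ℤ._≤_ (sym (ℤ.*-identityʳ (ℤ.+ m))) (sym (ℤ.*-identityʳ (ℤ.+ n))) (ℤ.+≤+ m≤n)))))

⟨⟩-cancel-< : ∀ {m n} → ⟨ m ⟩ ℚ.< ⟨ n ⟩ → m < n
⟨⟩-cancel-< {m} {n} m<n = ≰⇒> λ n≤m → ℚ.<-irrefl refl (ℚ.<-≤-trans m<n (⟨⟩-mono-≤ n≤m))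

÷-positive : ∀ a b .{{_ : NonZero a}} .{{_ : NonZero b}} → ℚ.Positive (a ÷ b)
÷-positive a b = ℚ.normalize-pos a b

÷-nonNegative : ∀ a b .{{_ : NonZero b}} → 0ℚ ℚ.≤ a ÷ b
÷-nonNegative zero    (suc b) = ℚ.≤-reflexive (sym (ℚ.0/n≡0 (suc b)))
÷-nonNegative a@(suc _) b = ℚ.<⇒≤ (ℚ.positive⁻¹ (a ÷ b) {{÷-positive a b}})

-- The intended values are F = f/m, G = n/b, u = x/m and w = m/K, for which the factor bm²K clears
-- every denominator. The solver proves a polynomial identity in which the product wK is still
-- visible; it is replaced by `m` at the end.
clear-denominators-+ : ∀ t c F G u w {f n x} m b K → F ℚ.* m ≡ f → G ℚ.* b ≡ n → u ℚ.* m ≡ x → w ℚ.* K ≡ m →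
  (t ℚ.+ F ℚ.* (1ℚ ℚ.+ c ℚ.* (u ℚ.+ w))) ℚ.* G ℚ.* (b ℚ.* (m ℚ.* (m ℚ.* K))) ≡
  (t ℚ.* (m ℚ.* (m ℚ.* K)) ℚ.+ f ℚ.* (m ℚ.* K)) ℚ.* n ℚ.+ f ℚ.* (c ℚ.* (x ℚ.* K ℚ.+ m ℚ.* m)) ℚ.* n
clear-denominators-+ t c F G u w m b K refl refl refl wK = trans
  (solve 9 (λ t c F G u w m b K → (t :+ F :* (con 1ℚ :+ c :* (u :+ w))) :* G :* (b :* (m :* (m :* K))) :=
    (t :* (m :* (m :* K)) :+ F :* m :* (m :* K)) :* (G :* b) :+ F :* m :* (c :* (u :* m :* K :+ m :* (w :* K))) :* (G :* b)) refl t c F G u w m b K)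
  (cong (λ z → (t ℚ.* (m ℚ.* (m ℚ.* K)) ℚ.+ F ℚ.* m ℚ.* (m ℚ.* K)) ℚ.* (G ℚ.* b) ℚ.+ F ℚ.* m ℚ.* (c ℚ.* (u ℚ.* m ℚ.* K ℚ.+ m ℚ.* z)) ℚ.* (G ℚ.* b)) wK)
  where open +-*-Solver

clear-denominators-− : ∀ t c F G u w {f n x} m b K → F ℚ.* m ≡ f → G ℚ.* b ≡ n → u ℚ.* m ≡ x → w ℚ.* K ≡ m →
  (t ℚ.+ F ℚ.* (1ℚ ℚ.- c ℚ.* (u ℚ.+ w))) ℚ.* G ℚ.* (b ℚ.* (m ℚ.* (m ℚ.* K))) ≡
  (t ℚ.* (m ℚ.* (m ℚ.* K)) ℚ.+ f ℚ.* (m ℚ.* K)) ℚ.* n ℚ.- f ℚ.* (c ℚ.* (x ℚ.* K ℚ.+ m ℚ.* m)) ℚ.* n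
clear-denominators-− t c F G u w m b K refl refl refl wK = trans
  (solve 9 (λ t c F G u w m b K → (t :+ F :* (con 1ℚ :- c :* (u :+ w))) :* G :* (b :* (m :* (m :* K))) :=
    (t :* (m :* (m :* K)) :+ F :* m :* (m :* K)) :* (G :* b) :- F :* m :* (c :* (u :* m :* K :+ m :* (w :* K))) :* (G :* b)) refl t c F G u w m b K)
  (cong (λ z → (t ℚ.* (m ℚ.* (m ℚ.* K)) ℚ.+ F ℚ.* m ℚ.* (m ℚ.* K)) ℚ.* (G ℚ.* b) ℚ.- F ℚ.* m ℚ.* (c ℚ.* (u ℚ.* m ℚ.* K ℚ.+ m ℚ.* z)) ℚ.* (G ℚ.* b)) wK)
  where open +-*-Solver

module _ (M B k : ℕ) .{{_ : NonZero M}} .{{_ : NonZero B}} .{{_ : NonZero k}} (f n c x : ℕ) where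

  private
    main error D : ℕ
    main  = (2 * (M * (M * k)) + f * (M * k)) * n
    error = f * (c * (x * k + M * M)) * n
    D     = B * (M * (M * k))

    m b K : ℚ
    m = ⟨ M ⟩
    b = ⟨ B ⟩
    K = ⟨ k ⟩

    ⟨D⟩-positive : ℚ.Positive ⟨ D ⟩
    ⟨D⟩-positive = ÷-positive D 1
      where
      instance
        Mk≢0 : NonZero (M * k)
        Mk≢0 = m*n≢0 M k
        MMk≢0 : NonZero (M * (M * k))
        MMk≢0 = m*n≢0 M (M * k)
        D≢0 : NonZero D
        D≢0 = m*n≢0 B (M * (M * k))

    ⟨MMk⟩ : m ℚ.* (m ℚ.* K) ≡ ⟨ M * (M * k) ⟩
    ⟨MMk⟩ = trans (cong (m ℚ.*_) (⟨⟩-* M k)) (⟨⟩-* M (M * k))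

    ⟨D⟩ : b ℚ.* (m ℚ.* (m ℚ.* K)) ≡ ⟨ D ⟩
    ⟨D⟩ = trans (cong (b ℚ.*_) ⟨MMk⟩) (⟨⟩-* B (M * (M * k)))

    ⟨main⟩ : (⟨ 2 ⟩ ℚ.* (m ℚ.* (m ℚ.* K)) ℚ.+ ⟨ f ⟩ ℚ.* (m ℚ.* K)) ℚ.* ⟨ n ⟩ ≡ ⟨ main ⟩
    ⟨main⟩ = begin
      (⟨ 2 ⟩ ℚ.* (m ℚ.* (m ℚ.* K)) ℚ.+ ⟨ f ⟩ ℚ.* (m ℚ.* K)) ℚ.* ⟨ n ⟩
        ≡⟨ cong₂ (λ p q → (⟨ 2 ⟩ ℚ.* p ℚ.+ ⟨ f ⟩ ℚ.* q) ℚ.* ⟨ n ⟩) ⟨MMk⟩ (⟨⟩-* M k) ⟩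
      (⟨ 2 ⟩ ℚ.* ⟨ M * (M * k) ⟩ ℚ.+ ⟨ f ⟩ ℚ.* ⟨ M * k ⟩) ℚ.* ⟨ n ⟩
        ≡⟨ cong₂ (λ p q → (p ℚ.+ q) ℚ.* ⟨ n ⟩) (⟨⟩-* 2 (M * (M * k))) (⟨⟩-* f (M * k)) ⟩
      (⟨ 2 * (M * (M * k)) ⟩ ℚ.+ ⟨ f * (M * k) ⟩) ℚ.* ⟨ n ⟩
        ≡⟨ cong (ℚ._* ⟨ n ⟩) (⟨⟩-+ (2 * (M * (M * k))) (f * (M * k))) ⟩
      ⟨ 2 * (M * (M * k)) + f * (M * k) ⟩ ℚ.* ⟨ n ⟩
        ≡⟨ ⟨⟩-* (2 * (M * (M * k)) + f * (M * k)) n ⟩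
      ⟨ main ⟩ ∎
      where open ≡-Reasoning

    ⟨error⟩ : ⟨ f ⟩ ℚ.* (⟨ c ⟩ ℚ.* (⟨ x ⟩ ℚ.* K ℚ.+ m ℚ.* m)) ℚ.* ⟨ n ⟩ ≡ ⟨ error ⟩
    ⟨error⟩ = begin
      ⟨ f ⟩ ℚ.* (⟨ c ⟩ ℚ.* (⟨ x ⟩ ℚ.* K ℚ.+ m ℚ.* m)) ℚ.* ⟨ n ⟩
        ≡⟨ cong (λ p → ⟨ f ⟩ ℚ.* (⟨ c ⟩ ℚ.* p) ℚ.* ⟨ n ⟩) (trans (cong₂ ℚ._+_ (⟨⟩-* x k) (⟨⟩-* M M)) (⟨⟩-+ (x * k) (M * M))) ⟩
      ⟨ f ⟩ ℚ.* (⟨ c ⟩ ℚ.* ⟨ x * k + M * M ⟩) ℚ.* ⟨ n ⟩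
        ≡⟨ cong (λ p → ⟨ f ⟩ ℚ.* p ℚ.* ⟨ n ⟩) (⟨⟩-* c (x * k + M * M)) ⟩
      ⟨ f ⟩ ℚ.* ⟨ c * (x * k + M * M) ⟩ ℚ.* ⟨ n ⟩
        ≡⟨ cong (ℚ._* ⟨ n ⟩) (⟨⟩-* f (c * (x * k + M * M))) ⟩
      ⟨ f * (c * (x * k + M * M)) ⟩ ℚ.* ⟨ n ⟩
        ≡⟨ ⟨⟩-* (f * (c * (x * k + M * M))) n ⟩
      ⟨ error ⟩ ∎
      where open ≡-Reasoning

  upper-bound-÷ : ∀ C → C * (B * (M * (M * k))) ≤
      (2 * (M * (M * k)) + f * (M * k)) * n + f * (c * (x * k + M * M)) * n →
    C ÷ 1 ℚ.≤ (2 ÷ 1 ℚ.+ f ÷ M ℚ.* (1ℚ ℚ.+ c ÷ 1 ℚ.* (x ÷ M ℚ.+ M ÷ k))) ℚ.* (n ÷ B)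
  upper-bound-÷ C le = ℚ.*-cancelʳ-≤-pos ⟨ D ⟩ {{⟨D⟩-positive}} (subst₂ ℚ._≤_ (sym (⟨⟩-* C D)) (sym cleared) (⟨⟩-mono-≤ le))
    where
    cleared : (⟨ 2 ⟩ ℚ.+ (f ÷ M) ℚ.* (1ℚ ℚ.+ ⟨ c ⟩ ℚ.* (x ÷ M ℚ.+ M ÷ k))) ℚ.* (n ÷ B) ℚ.* ⟨ D ⟩ ≡ ⟨ main + error ⟩
    cleared = trans (cong ((⟨ 2 ⟩ ℚ.+ (f ÷ M) ℚ.* (1ℚ ℚ.+ ⟨ c ⟩ ℚ.* (x ÷ M ℚ.+ M ÷ k))) ℚ.* (n ÷ B) ℚ.*_) (sym ⟨D⟩))
      (trans (clear-denominators-+ ⟨ 2 ⟩ ⟨ c ⟩ (f ÷ M) (n ÷ B) (x ÷ M) (M ÷ k) m b K (÷-cancel f M) (÷-cancel n B) (÷-cancel x M) (÷-cancel M k))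
      (trans (cong₂ ℚ._+_ ⟨main⟩ ⟨error⟩) (⟨⟩-+ main error)))

  lower-bound-÷ : ∀ C → (2 * (M * (M * k)) + f * (M * k)) * n ≤
      C * (B * (M * (M * k))) + f * (c * (x * k + M * M)) * n →
    (2 ÷ 1 ℚ.+ f ÷ M ℚ.* (1ℚ ℚ.- c ÷ 1 ℚ.* (x ÷ M ℚ.+ M ÷ k))) ℚ.* (n ÷ B) ℚ.≤ C ÷ 1
  lower-bound-÷ C le = ℚ.*-cancelʳ-≤-pos ⟨ D ⟩ {{⟨D⟩-positive}} (subst₂ ℚ._≤_ (sym cleared) (sym (⟨⟩-* C D))
    (ℚ.≤-trans (ℚ.+-monoˡ-≤ (ℚ.- ⟨ error ⟩) (⟨⟩-mono-≤ le)) (ℚ.≤-reflexive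
      (trans (cong (ℚ._- ⟨ error ⟩) (sym (⟨⟩-+ (C * D) error))) (solve 2 (λ p q → p :+ q :- q := p) refl ⟨ C * D ⟩ ⟨ error ⟩)))))
    where
    open +-*-Solver
    cleared : (⟨ 2 ⟩ ℚ.+ (f ÷ M) ℚ.* (1ℚ ℚ.- ⟨ c ⟩ ℚ.* (x ÷ M ℚ.+ M ÷ k))) ℚ.* (n ÷ B) ℚ.* ⟨ D ⟩ ≡ ⟨ main ⟩ ℚ.- ⟨ error ⟩
    cleared = trans (cong ((⟨ 2 ⟩ ℚ.+ (f ÷ M) ℚ.* (1ℚ ℚ.- ⟨ c ⟩ ℚ.* (x ÷ M ℚ.+ M ÷ k))) ℚ.* (n ÷ B) ℚ.*_) (sym ⟨D⟩))
      (trans (clear-denominators-− ⟨ 2 ⟩ ⟨ c ⟩ (f ÷ M) (n ÷ B) (x ÷ M) (M ÷ k) m b K (÷-cancel f M) (÷-cancel n B) (÷-cancel x M) (÷-cancel M k))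
      (cong₂ ℚ._-_ ⟨main⟩ ⟨error⟩))

÷<1/⇒ : ∀ {a b} K .{{_ : NonZero b}} .{{_ : NonZero K}} → ℚ.∣ a ÷ b ∣ ℚ.< 1 ÷ K → K * a < b
÷<1/⇒ {a} {b} K lt = ⟨⟩-cancel-< (subst₂ ℚ._<_ left right (ℚ.*-monoˡ-<-pos (⟨ b ⟩ ℚ.* ⟨ K ⟩) {{subst ℚ.Positive (sym (⟨⟩-* b K)) (÷-positive (b * K) 1 {{m*n≢0 b K}})}} lt))
  where
  open +-*-Solver
  left : ℚ.∣ a ÷ b ∣ ℚ.* (⟨ b ⟩ ℚ.* ⟨ K ⟩) ≡ ⟨ K * a ⟩
  left = trans (cong (ℚ._* (⟨ b ⟩ ℚ.* ⟨ K ⟩)) (ℚ.0≤p⇒∣p∣≡p (÷-nonNegative a b)))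
    (trans (sym (ℚ.*-assoc (a ÷ b) ⟨ b ⟩ ⟨ K ⟩)) (trans (cong (ℚ._* ⟨ K ⟩) (÷-cancel a b)) (trans (⟨⟩-* a K) (cong ⟨_⟩ (*-comm a K)))))
  right : (1 ÷ K) ℚ.* (⟨ b ⟩ ℚ.* ⟨ K ⟩) ≡ ⟨ b ⟩
  right = trans (cong ((1 ÷ K) ℚ.*_) (ℚ.*-comm ⟨ b ⟩ ⟨ K ⟩)) (trans (sym (ℚ.*-assoc (1 ÷ K) ⟨ K ⟩ ⟨ b ⟩))
    (trans (cong (ℚ._* ⟨ b ⟩) (÷-cancel 1 K)) (trans (⟨⟩-* 1 b) (cong ⟨_⟩ (+-identityʳ b)))))

scaled∈𝒪 : ∀ c (g : ℕ → ℚ) → (λ n → c ℚ.* g n) ∈𝒪 g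
scaled∈𝒪 c g = ℚ.∣ c ∣ , 0 , λ n _ → ℚ.≤-reflexive (ℚ.∣p*q∣≡∣p∣*∣q∣ c (g n))

-- Inequalities between natural numbers behind the two bounds

m≤m*n′ : ∀ m {n} → 1 ≤ n → m ≤ m * n
m≤m*n′ m 1≤n = ≤-trans (≤-reflexive (sym (*-identityʳ m))) (*-monoʳ-≤ m 1≤n)

-- The first constant bounds (M - sW)/B: 2s² comes from the overlap of the strips, 3s from rounding,
-- 1 from the odd window size 2R + 1, and 4 from the buffers. In the second, 96s³ = 2 · 6s · 8s² is
-- the loss of 6s per phase times the bound of `MMj≤` on the number of phases; 8s + 4 collects the
-- boundary of the grid and the incomplete last phase.
upperConstant lowerConstant : ℕ → ℕ
upperConstant s = 2 * (s * s) + 3 * s + 5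
lowerConstant s = 96 * (s * s * s) + 8 * s + 4

module UpperArithmetic (s k₁ k₂ M B : ℕ) (1≤s : 1 ≤ s) (1≤B : 1 ≤ B) where

  private
    c : ℕ
    c = upperConstant s

  4s²≤ : (4 * (s * s) + 2 * s) + (1 + 4 * B) ≤ 2 * c * B
  4s²≤ = ≤-trans (+-mono-≤ (m≤m*n′ (4 * (s * s) + 2 * s) 1≤B) (+-monoˡ-≤ (4 * B) 1≤B))
    (≤-trans (m≤m+n _ ((4 * s + 5) * B)) (≤-reflexive (eq s B)))
    where
    eq : ∀ s B → (4 * (s * s) + 2 * s) * B + (B + 4 * B) + (4 * s + 5) * B ≡ 2 * (2 * (s * s) + 3 * s + 5) * B
    eq = solve-∀

  -- The inequality that the upper bound becomes once the denominators are cleared.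
  ios-bound : ∀ {W q iB} → q * W ≤ k₁ → M ≤ s * W + c * B → 2 * c * B ≤ M → B ≤ k₂ →
    iB ≤ 2 * (k₁ * k₂) + 2 * (k₂ * ((2 + q) * (2 * s))) + 2 * B →
    iB * (M * (M * k₁)) ≤ (2 * (M * (M * k₁)) + 4 * s ^ 2 * (M * k₁)) * (k₁ * k₂) + 4 * s ^ 2 * (2 * c * (B * k₁ + M * M)) * (k₁ * k₂)
  ios-bound {W} {q} {iB} qW≤ M≤ cB≤M B≤k₂ iB≤ = begin
    iB * (M * (M * k₁))
      ≡⟨ eq₁ iB M k₁ ⟩
    iB * (M * M) * k₁
      ≤⟨ *-monoˡ-≤ k₁ total ⟩
    (2 * (k₁ * k₂) * (M * M) + 4 * (s * s) * M * (k₁ * k₂) + 4 * (s * s) * (2 * c) * (B * (k₁ * k₂) + M * M * k₂)) * k₁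
      ≡⟨ eq₂ k₁ k₂ M B s c ⟩
    (2 * (M * (M * k₁)) + 4 * s ^ 2 * (M * k₁)) * (k₁ * k₂) + 4 * s ^ 2 * (2 * c * (B * k₁ + M * M)) * (k₁ * k₂) ∎
    where
    open ≤-Reasoning
    eq₁ : ∀ i M k → i * (M * (M * k)) ≡ i * (M * M) * k
    eq₁ = solve-∀
    eq₂ : ∀ k₁ k₂ M B s c → (2 * (k₁ * k₂) * (M * M) + 4 * (s * s) * M * (k₁ * k₂) + 4 * (s * s) * (2 * c) * (B * (k₁ * k₂) + M * M * k₂)) * k₁ ≡
      (2 * (M * (M * k₁)) + 4 * (s * (s * 1)) * (M * k₁)) * (k₁ * k₂) + 4 * (s * (s * 1)) * (2 * c * (B * k₁ + M * M)) * (k₁ * k₂)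
    eq₂ = solve-∀
    Mq≤ : M * q ≤ s * k₁ + c * B * q
    Mq≤ = begin
      M * q                          ≤⟨ *-monoˡ-≤ q M≤ ⟩
      (s * W + c * B) * q            ≡⟨ eq s W c B q ⟩
      s * (q * W) + c * B * q        ≤⟨ +-monoˡ-≤ (c * B * q) (*-monoʳ-≤ s qW≤) ⟩
      s * k₁ + c * B * q             ∎
      where
      eq : ∀ s W c B q → (s * W + c * B) * q ≡ s * (q * W) + c * B * q
      eq = solve-∀
    -- A crude bound first: as 2cB ≤ M, the term cBq is at most half of Mq. Feeding this back in
    -- `MMq≤` leaves an error of relative order B/M.
    Mq≤2sk₁ : M * q ≤ 2 * (s * k₁)
    Mq≤2sk₁ = ≤-cert 0 (+-mono-≤ (*-monoʳ-≤ 2 Mq≤) (*-monoˡ-≤ q cB≤M)) (eq M q (s * k₁) c B)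
      where
      eq : ∀ M q k c B → M * q + (2 * (k + c * B * q) + M * q) + 0 ≡ 2 * k + (2 * (M * q) + 2 * c * B * q)
      eq = solve-∀
    MMq≤ : M * M * q ≤ s * k₁ * M + c * B * (2 * (s * k₁))
    MMq≤ = begin
      M * M * q                              ≡⟨ eq M q ⟩
      M * q * M                              ≤⟨ *-monoˡ-≤ M Mq≤ ⟩
      (s * k₁ + c * B * q) * M               ≡⟨ eq′ (s * k₁) (c * B) q M ⟩
      s * k₁ * M + c * B * (M * q)           ≤⟨ +-monoʳ-≤ (s * k₁ * M) (*-monoʳ-≤ (c * B) Mq≤2sk₁) ⟩
      s * k₁ * M + c * B * (2 * (s * k₁))    ∎
      where
      eq : ∀ M q → M * M * q ≡ M * q * M
      eq = solve-∀
      eq′ : ∀ a b q M → (a + b * q) * M ≡ a * M + b * (M * q)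
      eq′ = solve-∀
    -- The term 8s stems from the two additional strips that each row may meet, and 2 from the
    -- partial blocks, since B ≤ k₂.
    8s+2≤ : 8 * s + 2 ≤ 4 * (s * s) * (2 * c)
    8s+2≤ = begin
      8 * s + 2                 ≤⟨ +-monoʳ-≤ (8 * s) (*-monoʳ-≤ 2 1≤s) ⟩
      8 * s + 2 * s             ≡⟨ eq s ⟩
      10 * s                    ≤⟨ *-monoʳ-≤ 10 (m≤m*n′ s 1≤s) ⟩
      10 * (s * s)              ≤⟨ m≤m+n _ _ ⟩
      10 * (s * s) + (s * s) * (30 + 16 * (s * s) + 24 * s) ≡⟨ eq′ s ⟩
      4 * (s * s) * (2 * (2 * (s * s) + 3 * s + 5)) ∎
      where
      eq : ∀ s → 8 * s + 2 * s ≡ 10 * s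
      eq = solve-∀
      eq′ : ∀ s → 10 * (s * s) + (s * s) * (30 + 16 * (s * s) + 24 * s) ≡ 4 * (s * s) * (2 * (2 * (s * s) + 3 * s + 5))
      eq′ = solve-∀
    total : iB * (M * M) ≤ 2 * (k₁ * k₂) * (M * M) + 4 * (s * s) * M * (k₁ * k₂) + 4 * (s * s) * (2 * c) * (B * (k₁ * k₂) + M * M * k₂)
    total = begin
      iB * (M * M)
        ≤⟨ *-monoˡ-≤ (M * M) (≤-trans iB≤ (+-monoʳ-≤ (2 * (k₁ * k₂) + 2 * (k₂ * ((2 + q) * (2 * s)))) (*-monoʳ-≤ 2 B≤k₂))) ⟩
      (2 * (k₁ * k₂) + 2 * (k₂ * ((2 + q) * (2 * s))) + 2 * k₂) * (M * M)
        ≡⟨ eq₃ k₁ k₂ M q s ⟩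
      2 * (k₁ * k₂) * (M * M) + 4 * s * k₂ * (M * M * q) + (8 * s + 2) * (M * M * k₂)
        ≤⟨ +-mono-≤ (+-monoʳ-≤ (2 * (k₁ * k₂) * (M * M)) (*-monoʳ-≤ (4 * s * k₂) MMq≤)) (*-monoˡ-≤ (M * M * k₂) 8s+2≤) ⟩
      2 * (k₁ * k₂) * (M * M) + 4 * s * k₂ * (s * k₁ * M + c * B * (2 * (s * k₁))) + 4 * (s * s) * (2 * c) * (M * M * k₂)
        ≡⟨ eq₄ k₁ k₂ M B s c ⟩
      2 * (k₁ * k₂) * (M * M) + 4 * (s * s) * M * (k₁ * k₂) + 4 * (s * s) * (2 * c) * (B * (k₁ * k₂) + M * M * k₂) ∎
      where
      eq₃ : ∀ k₁ k₂ M q s → (2 * (k₁ * k₂) + 2 * (k₂ * ((2 + q) * (2 * s))) + 2 * k₂) * (M * M) ≡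
        2 * (k₁ * k₂) * (M * M) + 4 * s * k₂ * (M * M * q) + (8 * s + 2) * (M * M * k₂)
      eq₃ = solve-∀
      eq₄ : ∀ k₁ k₂ M B s c → 2 * (k₁ * k₂) * (M * M) + 4 * s * k₂ * (s * k₁ * M + c * B * (2 * (s * k₁))) + 4 * (s * s) * (2 * c) * (M * M * k₂) ≡
        2 * (k₁ * k₂) * (M * M) + 4 * (s * s) * M * (k₁ * k₂) + 4 * (s * s) * (2 * c) * (B * (k₁ * k₂) + M * M * k₂)
      eq₄ = solve-∀

  module _ (cB≤M : 2 * c * B ≤ M) where

    private
      instance
        2s≢0 : NonZero (2 * s)
        2s≢0 = >-nonZero (≤-trans 1≤s (m≤m+n s (1 * s)))

    -- Strips are as wide as the memory allows: 2hs + 1 + 4B ≤ M with h maximal.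
    h h′ W : ℕ
    h = (M ∸ (1 + 4 * B)) / (2 * s)
    h′ = pred h
    W = suc (2 * h′) ∸ 2 * s

    -- This leaves room for h ≥ 2s + 1, which makes the strips wider than their overlap of 2s
    -- diagonals.
    enough : 2 * s * suc (2 * s) + (1 + 4 * B) ≤ M
    enough = ≤-trans (≤-trans (≤-reflexive (cong (_+ (1 + 4 * B)) (eq s))) 4s²≤) cB≤M
      where
      eq : ∀ s → 2 * s * suc (2 * s) ≡ 4 * (s * s) + 2 * s
      eq = solve-∀

    2s<h : 2 * s < h
    2s<h = ≤-trans (≤-reflexive (sym (m*n/n≡m (suc (2 * s)) (2 * s)))) (/-monoˡ-≤ (2 * s)
      (≤-trans (≤-reflexive (*-comm (suc (2 * s)) (2 * s))) (m+n≤o⇒m≤o∸n (2 * s * suc (2 * s)) enough)))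

    h≡ : suc h′ ≡ h
    h≡ = suc-pred h {{>-nonZero (≤-<-trans z≤n 2s<h)}}

    2s≤h′ : 2 * s ≤ h′
    2s≤h′ = s≤s⁻¹ (≤-trans 2s<h (≤-reflexive (sym h≡)))

    2s<W : 2 * s < W
    2s<W = m+n≤o⇒m≤o∸n (suc (2 * s)) (s≤s (+-mono-≤ 2s≤h′ (≤-trans 2s≤h′ (m≤m+n h′ 0))))

    W+2s : W + 2 * s ≡ suc (2 * h′)
    W+2s = m∸n+n≡m (≤-trans 2s≤h′ (≤-trans (m≤m+n h′ (1 * h′)) (n≤1+n _)))

    memory : 2 * (suc h′ * s) + 1 + 4 * B ≤ M
    memory = begin
      2 * (suc h′ * s) + 1 + 4 * B    ≡⟨ cong (λ z → 2 * (z * s) + 1 + 4 * B) h≡ ⟩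
      2 * (h * s) + 1 + 4 * B         ≡⟨ eq h s B ⟩
      h * (2 * s) + (1 + 4 * B)       ≤⟨ +-monoˡ-≤ (1 + 4 * B) (m/n*n≤m (M ∸ (1 + 4 * B)) (2 * s)) ⟩
      M ∸ (1 + 4 * B) + (1 + 4 * B)   ≡⟨ m∸n+n≡m (≤-trans (m≤n+m (1 + 4 * B) (2 * s * suc (2 * s))) enough) ⟩
      M                               ∎
      where
      open ≤-Reasoning
      eq : ∀ h s B → 2 * (h * s) + 1 + 4 * B ≡ h * (2 * s) + (1 + 4 * B)
      eq = solve-∀

    M≤ : M ≤ s * W + c * B
    M≤ = begin
      M                                                 ≤⟨ m≤n+m∸n M (1 + 4 * B) ⟩
      1 + 4 * B + (M ∸ (1 + 4 * B))                     ≤⟨ +-monoʳ-≤ (1 + 4 * B) (<⇒≤ (m<[1+m/n]*n (M ∸ (1 + 4 * B)) (2 * s))) ⟩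
      1 + 4 * B + suc h * (2 * s)                       ≡⟨ cong (λ z → 1 + 4 * B + suc z * (2 * s)) h≡ ⟨
      1 + 4 * B + suc (suc h′) * (2 * s)                ≡⟨ eq₁ B h′ s ⟩
      s * suc (2 * h′) + (1 + 3 * s + 4 * B)            ≡⟨ cong (λ z → s * z + (1 + 3 * s + 4 * B)) W+2s ⟨
      s * (W + 2 * s) + (1 + 3 * s + 4 * B)             ≡⟨ eq₂ s W B ⟩
      s * W + ((2 * (s * s) + 3 * s + 1) + 4 * B)       ≤⟨ +-monoʳ-≤ (s * W) (+-monoˡ-≤ (4 * B) (m≤m*n′ (2 * (s * s) + 3 * s + 1) 1≤B)) ⟩
      s * W + ((2 * (s * s) + 3 * s + 1) * B + 4 * B)   ≡⟨ cong (s * W +_) (eq₃ s B) ⟩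
      s * W + c * B                                     ∎
      where
      open ≤-Reasoning
      eq₁ : ∀ B h s → 1 + 4 * B + suc (suc h) * (2 * s) ≡ s * suc (2 * h) + (1 + 3 * s + 4 * B)
      eq₁ = solve-∀
      eq₂ : ∀ s W B → s * (W + 2 * s) + (1 + 3 * s + 4 * B) ≡ s * W + ((2 * (s * s) + 3 * s + 1) + 4 * B)
      eq₂ = solve-∀
      eq₃ : ∀ s B → (2 * (s * s) + 3 * s + 1) * B + 4 * B ≡ (2 * (s * s) + 3 * s + 5) * B
      eq₃ = solve-∀

    upper : M ≤ k₂ → ∃[ i ] ComputableWith s k₁ k₂ M B i ×
      i * (B * (M * (M * k₁))) ≤ (2 * (M * (M * k₁)) + 4 * s ^ 2 * (M * k₁)) * (k₁ * k₂) + 4 * s ^ 2 * (2 * c * (B * k₁ + M * M)) * (k₁ * k₂)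
    upper M≤k₂ =
      let i , computable , bound = Diagonal.io-upper-bound s k₁ k₂ M B W h′ {{>-nonZero 1≤B}} {{W≢0}} W+2s (<⇒≤ 2s<W) memory
      in i , computable , ≤-trans (≤-reflexive (sym (*-assoc i B _)))
           (ios-bound {W} {_/_ k₁ W {{W≢0}}} (m/n*n≤m k₁ W {{W≢0}}) M≤ cB≤M (≤-trans B≤M M≤k₂) bound)
      where
      W≢0 : NonZero W
      W≢0 = >-nonZero (≤-<-trans z≤n 2s<W)
      B≤M : B ≤ M
      B≤M = ≤-trans (m≤n*m B (2 * c) {{2c≢0}}) cB≤M
        where
        2c≢0 : NonZero (2 * c)
        2c≢0 = m*n≢0 2 c {{_}} {{>-nonZero (≤-trans (s≤s z≤n) (m≤n+m 5 (2 * (s * s) + 3 * s)))}}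

module LowerArithmetic (s k₁ k₂ M B : ℕ) (1≤s : 1 ≤ s) where

  private
    c : ℕ
    c = lowerConstant s

  interior≥ : k₂ ≤ k₁ → k₁ * k₂ ≤ (k₁ ∸ 2 * s) * (k₂ ∸ 2 * s) + 4 * s * k₁
  interior≥ k₂≤k₁ = begin
    k₁ * k₂                                        ≤⟨ *-monoʳ-≤ k₁ (m≤n+m∸n k₂ (2 * s)) ⟩
    k₁ * (2 * s + (k₂ ∸ 2 * s))                    ≡⟨ *-distribˡ-+ k₁ (2 * s) _ ⟩
    k₁ * (2 * s) + k₁ * (k₂ ∸ 2 * s)               ≤⟨ +-monoʳ-≤ (k₁ * (2 * s)) (*-monoˡ-≤ (k₂ ∸ 2 * s) (m≤n+m∸n k₁ (2 * s))) ⟩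
    k₁ * (2 * s) + (2 * s + (k₁ ∸ 2 * s)) * (k₂ ∸ 2 * s)
      ≡⟨ cong (k₁ * (2 * s) +_) (*-distribʳ-+ (k₂ ∸ 2 * s) (2 * s) (k₁ ∸ 2 * s)) ⟩
    k₁ * (2 * s) + (2 * s * (k₂ ∸ 2 * s) + (k₁ ∸ 2 * s) * (k₂ ∸ 2 * s))
      ≤⟨ +-monoʳ-≤ (k₁ * (2 * s)) (+-monoˡ-≤ _ (*-monoʳ-≤ (2 * s) (≤-trans (m∸n≤m k₂ (2 * s)) k₂≤k₁))) ⟩
    k₁ * (2 * s) + (2 * s * k₁ + (k₁ ∸ 2 * s) * (k₂ ∸ 2 * s))
      ≡⟨ eq k₁ s _ ⟩
    (k₁ ∸ 2 * s) * (k₂ ∸ 2 * s) + 4 * s * k₁ ∎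
    where
    open ≤-Reasoning
    eq : ∀ k s n → k * (2 * s) + (2 * s * k + n) ≡ n + 4 * s * k
    eq = solve-∀

  -- The inequality that the lower bound becomes once the denominators are cleared; the phases consist of
  -- 2r² ≈ M²/2s² evaluations, where r ≈ M/2s, and n₀ counts the interior vertices.
  module _ {r j a reads n₀ i : ℕ} (1≤r : 1 ≤ r) (2sr≤M : 2 * s * r ≤ M) (M≤2sr+2s : M ≤ 2 * s * r + 2 * s)
    (M≤k₁ : M ≤ k₁) (1≤M : 1 ≤ M) (n≤ : k₁ * k₂ ≤ n₀ + 4 * s * k₁)
    (a< : a < 2 * (r * r)) (jm≤ : j * (2 * (r * r)) ≤ k₁ * k₂) (n₀≤ : n₀ ≤ a + j * (2 * (r * r)))
    (reads≥ : j * (2 * (r * r) + 4 * s * r ∸ 4 * s) + a ≤ reads + (M + j * M)) (ios≥ : 2 * reads ≤ i * B) where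

    private
      n m : ℕ
      n = k₁ * k₂
      m = 2 * (r * r)

    -- Each phase loses 6s: the isoperimetric inequality gives away 4s, and rounding M/2s down gives
    -- away 2s.
    reads-bound : n + 2 * s * r * j ≤ reads + M + 6 * s * j + 4 * s * k₁
    reads-bound = ≤-cert 0
      (+-mono-≤ n≤ (+-mono-≤ n₀≤ (+-mono-≤ (*-monoʳ-≤ j (m≤n+m∸n (m + 4 * s * r) (4 * s))) (+-mono-≤ reads≥ (*-monoʳ-≤ j M≤2sr+2s)))))
      (eq n n₀ k₁ a j m (m + 4 * s * r ∸ 4 * s) s r reads M)
      where
      eq : ∀ n n₀ k a j m g s r x M →
        n + 2 * s * r * j + (n₀ + 4 * s * k + (a + j * m + (j * (4 * s + g) + (x + (M + j * M) + j * (2 * s * r + 2 * s))))) + 0 ≡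
        x + M + 6 * s * j + 4 * s * k + (n + (n₀ + (j * (m + 4 * s * r) + (j * g + a + j * M))))
      eq = solve-∀

    M≤4sr : M ≤ 4 * s * r
    M≤4sr = ≤-trans M≤2sr+2s (≤-trans (+-monoʳ-≤ (2 * s * r) (m≤m*n′ (2 * s) 1≤r)) (≤-reflexive (eq s r)))
      where
      eq : ∀ s r → 2 * s * r + 2 * s * r ≡ 4 * s * r
      eq = solve-∀

    -- There are O(n/M²) phases, so a constant loss per phase is smaller by a factor of order 1/M
    -- than the main surplus of order n/M.
    MMj≤ : M * M * j ≤ 8 * (s * s) * n
    MMj≤ = begin
      M * M * j                        ≤⟨ *-monoˡ-≤ j (*-mono-≤ M≤4sr M≤4sr) ⟩
      4 * s * r * (4 * s * r) * j      ≡⟨ eq s r j ⟩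
      8 * (s * s) * (j * m)            ≤⟨ *-monoʳ-≤ (8 * (s * s)) jm≤ ⟩
      8 * (s * s) * n                  ∎
      where
      open ≤-Reasoning
      eq : ∀ s r j → 4 * s * r * (4 * s * r) * j ≡ 8 * (s * s) * (j * (2 * (r * r)))
      eq = solve-∀

    -- The surplus per vertex appears here: a phase of m = 2r² vertices has 2s²m = (2sr)² ≤ M · 2sr,
    -- so its surplus 2sr is at least 2s²m/M.
    leading≤ : 2 * (s * s) * (M * n) ≤ M * M * (2 * s * r * j) + (8 * (s * s * s) + 1) * (M * M * k₁)
    leading≤ = begin
      2 * (s * s) * (M * n)
        ≤⟨ *-monoʳ-≤ (2 * (s * s)) (*-monoʳ-≤ M (≤-trans n≤ (+-monoˡ-≤ (4 * s * k₁) (≤-trans n₀≤ (+-monoˡ-≤ (j * m) (<⇒≤ a<)))))) ⟩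
      2 * (s * s) * (M * (m + j * m + 4 * s * k₁))
        ≡⟨ eq₁ s M r j k₁ ⟩
      M * (2 * s * r * (2 * s * r)) + M * (2 * s * r * (2 * s * r * j)) + 8 * (s * s * s) * (M * k₁)
        ≤⟨ +-mono-≤ (+-mono-≤ (≤-trans (*-monoʳ-≤ M (*-mono-≤ 2sr≤M (≤-trans 2sr≤M M≤k₁))) (≤-reflexive (sym (*-assoc M M k₁))))
             (*-monoʳ-≤ M (*-monoˡ-≤ (2 * s * r * j) 2sr≤M)))
             (*-monoʳ-≤ (8 * (s * s * s)) (*-monoˡ-≤ k₁ (m≤m*n′ M 1≤M))) ⟩
      M * M * k₁ + M * (M * (2 * s * r * j)) + 8 * (s * s * s) * (M * M * k₁)
        ≡⟨ eq₂ M k₁ (2 * s * r * j) (8 * (s * s * s)) ⟩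
      M * M * (2 * s * r * j) + (8 * (s * s * s) + 1) * (M * M * k₁) ∎
      where
      open ≤-Reasoning
      eq₁ : ∀ s M r j k → 2 * (s * s) * (M * (2 * (r * r) + j * (2 * (r * r)) + 4 * s * k)) ≡
        M * (2 * s * r * (2 * s * r)) + M * (2 * s * r * (2 * s * r * j)) + 8 * (s * s * s) * (M * k)
      eq₁ = solve-∀
      eq₂ : ∀ M k x y → M * M * k + M * (M * x) + y * (M * M * k) ≡ M * M * x + (y + 1) * (M * M * k)
      eq₂ = solve-∀

    total : 2 * (M * M) * n + 4 * (s * s) * (M * n) ≤ M * M * (i * B) + c * (n + M * M * k₁)
    total = ≤-cert ((8 * s + 4) * n + (80 * (s * s * s)) * (M * M * k₁))
      (+-mono-≤ (*-monoʳ-≤ (2 * (M * M)) reads-bound) (+-mono-≤ (*-monoʳ-≤ (2 * (M * M)) M≤k₁) (+-mono-≤ (*-monoʳ-≤ (12 * s) MMj≤)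
        (+-mono-≤ (*-monoʳ-≤ 2 leading≤) (*-monoʳ-≤ (M * M) ios≥)))))
      (eq M n s r j reads k₁ (i * B))
      where
      eq : ∀ M n s r j x k iB →
        2 * (M * M) * n + 4 * (s * s) * (M * n) +
          (2 * (M * M) * (x + M + 6 * s * j + 4 * s * k) + (2 * (M * M) * k + (12 * s * (8 * (s * s) * n) +
            (2 * (M * M * (2 * s * r * j) + (8 * (s * s * s) + 1) * (M * M * k)) + M * M * iB)))) +
          ((8 * s + 4) * n + (80 * (s * s * s)) * (M * M * k)) ≡
        M * M * iB + (96 * (s * s * s) + 8 * s + 4) * (n + M * M * k) +
          (2 * (M * M) * (n + 2 * s * r * j) + (2 * (M * M) * M + (12 * s * (M * M * j) +
            (2 * (2 * (s * s) * (M * n)) + M * M * (2 * x)))))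
      eq = solve-∀

    cleared : (2 * (M * (M * k₂)) + 4 * s ^ 2 * (M * k₂)) * n ≤ i * (B * (M * (M * k₂))) + 4 * s ^ 2 * (c * (1 * k₂ + M * M)) * n
    cleared = begin
      (2 * (M * (M * k₂)) + 4 * s ^ 2 * (M * k₂)) * n
        ≡⟨ eq₁ M k₂ s n ⟩
      k₂ * (2 * (M * M) * n + 4 * (s * s) * (M * n))
        ≤⟨ *-monoʳ-≤ k₂ (≤-trans total (+-monoʳ-≤ (M * M * (i * B)) (m≤n*m _ (4 * (s * s)) {{4ss≢0}}))) ⟩
      k₂ * (M * M * (i * B) + 4 * (s * s) * (c * (n + M * M * k₁)))
        ≡⟨ eq₂ M k₁ k₂ s i B c ⟩
      i * (B * (M * (M * k₂))) + 4 * s ^ 2 * (c * (1 * k₂ + M * M)) * n ∎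
      where
      open ≤-Reasoning
      4ss≢0 : NonZero (4 * (s * s))
      4ss≢0 = >-nonZero (≤-trans (*-mono-≤ 1≤s 1≤s) (m≤n*m (s * s) 4))
      eq₁ : ∀ M k s n → (2 * (M * (M * k)) + 4 * (s * (s * 1)) * (M * k)) * n ≡ k * (2 * (M * M) * n + 4 * (s * s) * (M * n))
      eq₁ = solve-∀
      eq₂ : ∀ M k₁ k₂ s i B c → k₂ * (M * M * (i * B) + 4 * (s * s) * (c * (k₁ * k₂ + M * M * k₁))) ≡
        i * (B * (M * (M * k₂))) + 4 * (s * (s * 1)) * (c * (1 * k₂ + M * M)) * (k₁ * k₂)
      eq₂ = solve-∀

  lower : ∀ {i} → 6 * s ≤ M → M ≤ k₂ → k₂ ≤ k₁ → ComputableWith s k₁ k₂ M B i →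
    (2 * (M * (M * k₂)) + 4 * s ^ 2 * (M * k₂)) * (k₁ * k₂) ≤ i * (B * (M * (M * k₂))) + 4 * s ^ 2 * (c * (1 * k₂ + M * M)) * (k₁ * k₂)
  lower {i} 6s≤M M≤k₂ k₂≤k₁ computable =
    let j , a , reads , a< , jm≤ , n₀≤ , reads≥ , ios≥ = io-lower-bound s k₁ k₂ {{s≢0}} r 3≤r computable
    in cleared {r} {j} {a} {reads} {i = i} (≤-trans (s≤s z≤n) 3≤r) 2sr≤M M≤2sr+2s (≤-trans M≤k₂ k₂≤k₁) (≤-trans (≤-trans 1≤s (m≤n*m s 6)) 6s≤M)
         (interior≥ k₂≤k₁) a< jm≤ n₀≤ reads≥ ios≥
    where
    s≢0 : NonZero s
    s≢0 = >-nonZero 1≤s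
    instance
      2s≢0 : NonZero (2 * s)
      2s≢0 = >-nonZero (≤-trans 1≤s (m≤m+n s (1 * s)))
    r : ℕ
    r = M / (2 * s)
    3≤r : 3 ≤ r
    3≤r = ≤-trans (≤-reflexive (sym (m*n/n≡m 3 (2 * s)))) (/-monoˡ-≤ (2 * s) (≤-trans (≤-reflexive (eq s)) 6s≤M))
      where
      eq : ∀ s → 3 * (2 * s) ≡ 6 * s
      eq = solve-∀
    2sr≤M : 2 * s * r ≤ M
    2sr≤M = ≤-trans (≤-reflexive (*-comm (2 * s) r)) (m/n*n≤m M (2 * s))
    M≤2sr+2s : M ≤ 2 * s * r + 2 * s
    M≤2sr+2s = ≤-trans (<⇒≤ (m<[1+m/n]*n M (2 * s))) (≤-reflexive (eq r (2 * s)))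
      where
      eq : ∀ r t → suc r * t ≡ t * r + t
      eq = solve-∀

mainTheorem1 : (s : ℕ) → s ≥ 1 →
    (k₁ k₂ M B : ℕ → ℕ) →
    {{_ : ∀ {n} → NonZero (k₁ n)}} {{_ : ∀ {n} → NonZero (k₂ n)}} →
    {{_ : ∀ {n} → NonZero (M n)}} {{_ : ∀ {n} → NonZero (B n)}} →
    Monotonic₁ _≤_ _≤_ k₁ → Monotonic₁ _≤_ _≤_ k₂ →
    Monotonic₁ _≤_ _≤_ M → Monotonic₁ _≤_ _≤_ B →
    (∀ n → k₁ n ≥ k₂ n) →
    TendsToZero (λ n → M n ÷ k₂ n) →
    TendsToZero (λ n → B n ÷ M n) →
    Eventually (λ n → ∃[ i ] ComputableWith s (k₁ n) (k₂ n) (M n) (B n) i) ×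
    (∃[ h ] h ∈𝒪 (λ n → B n ÷ M n ℚ.+ M n ÷ k₁ n) ×
    Eventually (λ n → ∀ C → IsMinimumIO s (k₁ n) (k₂ n) (M n) (B n) C →
    C ÷ 1 ℚ.≤ (2 ÷ 1 ℚ.+ (4 * s ^ 2) ÷ M n ℚ.* (1ℚ ℚ.+ h n)) ℚ.* ((k₁ n * k₂ n) ÷ B n))) ×
    (∃[ h ] h ∈𝒪 (λ n → 1 ÷ M n ℚ.+ M n ÷ k₂ n) ×
    Eventually (λ n → ∀ C → IsMinimumIO s (k₁ n) (k₂ n) (M n) (B n) C →
    (2 ÷ 1 ℚ.+ (4 * s ^ 2) ÷ M n ℚ.* (1ℚ ℚ.- h n)) ℚ.* ((k₁ n * k₂ n) ÷ B n) ℚ.≤ C ÷ 1))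
mainTheorem1 s s≥1 k₁ k₂ M B _ _ _ _ k₁≥k₂ M/k₂→0 B/M→0 =
    (n₀ , λ n n≥n₀ → let i , computable , _ = algorithm n n≥n₀ in i , computable) ,
    -- Both error functions are constant multiples of their comparison functions, so membership in 𝒪
    -- is immediate.
    ((λ n → (2 * c₁) ÷ 1 ℚ.* (B n ÷ M n ℚ.+ M n ÷ k₁ n)) , scaled∈𝒪 ((2 * c₁) ÷ 1) (λ n → B n ÷ M n ℚ.+ M n ÷ k₁ n) , n₀ , upper-bound) ,
    ((λ n → c₂ ÷ 1 ℚ.* (1 ÷ M n ℚ.+ M n ÷ k₂ n)) , scaled∈𝒪 (c₂ ÷ 1) (λ n → 1 ÷ M n ℚ.+ M n ÷ k₂ n) , n₀ , lower-bound)
  where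
  c₁ c₂ : ℕ
  c₁ = upperConstant s
  c₂ = lowerConstant s
  instance
    2c₁≢0 : NonZero (2 * c₁)
    2c₁≢0 = >-nonZero (≤-trans (s≤s z≤n) (≤-trans (m≤n+m 5 (2 * (s * s) + 3 * s)) (m≤m+n c₁ (1 * c₁))))
  M<k₂ : Eventually (λ n → M n < k₂ n)
  M<k₂ = let n₁ , small = M/k₂→0 1ℚ (ℚ.positive⁻¹ 1ℚ)
         in n₁ , λ n n≥n₁ → ≤-trans (s≤s (m≤m+n (M n) 0)) (÷<1/⇒ 1 (small n n≥n₁))
  -- Taking ε = 1/2c₁ gives 2c₁B < M; since B ≥ 1, this also makes `M` large compared with `s`, as
  -- both bounds require.
  cB<M : Eventually (λ n → 2 * c₁ * B n < M n)
  cB<M = let n₂ , small = B/M→0 (1 ÷ (2 * c₁)) (ℚ.positive⁻¹ (1 ÷ (2 * c₁)) {{÷-positive 1 (2 * c₁)}})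
         in n₂ , λ n n≥n₂ → ÷<1/⇒ (2 * c₁) (small n n≥n₂)
  n₀ : ℕ
  n₀ = proj₁ M<k₂ ⊔ proj₁ cB<M
  M≤k₂ : ∀ n → n ≥ n₀ → M n ≤ k₂ n
  M≤k₂ n n≥n₀ = <⇒≤ (proj₂ M<k₂ n (m⊔n≤o⇒m≤o (proj₁ M<k₂) (proj₁ cB<M) n≥n₀))
  cB≤M : ∀ n → n ≥ n₀ → 2 * c₁ * B n ≤ M n
  cB≤M n n≥n₀ = <⇒≤ (proj₂ cB<M n (m⊔n≤o⇒n≤o (proj₁ M<k₂) (proj₁ cB<M) n≥n₀))
  algorithm : ∀ n → n ≥ n₀ → _
  algorithm n n≥n₀ = UpperArithmetic.upper s (k₁ n) (k₂ n) (M n) (B n) s≥1 (>-nonZero⁻¹ (B n)) (cB≤M n n≥n₀) (M≤k₂ n n≥n₀)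
  upper-bound : ∀ n → n ≥ n₀ → ∀ C → IsMinimumIO s (k₁ n) (k₂ n) (M n) (B n) C → _
  upper-bound n n≥n₀ C (_ , minimal) =
    let i , computable , bound = algorithm n n≥n₀
    in upper-bound-÷ (M n) (B n) (k₁ n) (4 * s ^ 2) (k₁ n * k₂ n) (2 * c₁) (B n) C (≤-trans (*-monoˡ-≤ (B n * (M n * (M n * k₁ n))) (minimal i computable)) bound)
  6s≤M : ∀ n → n ≥ n₀ → 6 * s ≤ M n
  6s≤M n n≥n₀ = ≤-trans (≤-trans (≤-trans (m≤m+n (6 * s) (4 * (s * s) + 10)) (≤-reflexive (eq s))) (m≤m*n′ (2 * c₁) (>-nonZero⁻¹ (B n)))) (cB≤M n n≥n₀)
    where
    eq : ∀ s → 6 * s + (4 * (s * s) + 10) ≡ 2 * (2 * (s * s) + 3 * s + 5)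
    eq = solve-∀
  lower-bound : ∀ n → n ≥ n₀ → ∀ C → IsMinimumIO s (k₁ n) (k₂ n) (M n) (B n) C → _
  lower-bound n n≥n₀ C (computable , _) = lower-bound-÷ (M n) (B n) (k₂ n) (4 * s ^ 2) (k₁ n * k₂ n) c₂ 1 C
    (LowerArithmetic.lower s (k₁ n) (k₂ n) (M n) (B n) s≥1 (6s≤M n n≥n₀) (M≤k₂ n n≥n₀) (k₁≥k₂ n) computable)
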